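{- Let $q\ge2$ be a fixed integer and let $p=p(n)\in(0,1]$ be a sequence with $pn/\log n\to\infty$ and $np^2\to0$. Then asymptotically almost surely $\Gamma=G(n,p)$ contains a spanning triangle-free subgraph $H$ with $$\delta(H)=(1-o(1))pn,\qquad \operatorname{del}_q(H)=\left(\frac1{2q}+o(1)\right)pn^2.$$
   Context: All graphs are finite and simple. $G(n,p)$ is the binomial random graph on vertex set $[n]$, in which each pair of vertices is an edge independently with probability $p=p(n)$. An event holds asymptotically almost surely if its probability tends to $1$ as $n\to\infty$. A subgraph is spanning if its vertex set is $[n]$. $\delta$ denotes minimum degree. Logarithms are natural, and asymptotic notation refers to $n\to\infty$. For a graph $G$ and an integer $q\ge2$, $$\operatorname{del}_q(G)=\min_{\phi:V(G)\to[q]}\bigl|\{xy\in E(G):\phi(x)=\phi(y)\}\bigr|,$$ i.e. the minimum number of edges whose deletion makes $G$ $q$-partite. -}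

module Defs where

open import Data.Bool.Base using (Bool; true; false; if_then_else_; _∧_; T)
open import Data.Fin.Base as Fin using (Fin; zero; suc)
import Data.Fin.Properties as Fin
open import Data.Integer.Base using (+_)
import Data.Integer.Base as ℤ
import Data.Integer.Properties as ℤ
open import Data.List.Base
  using (List; []; _∷_; map; foldr; length; filter; filterᵇ; allFin; cartesianProduct; cartesianProductWith)
open import Data.List.Extrema.Nat using (min)
open import Data.Nat.Base as ℕ using (ℕ; zero; suc)
import Data.Nat.Properties as ℕ
open import Data.Product.Base using (Σ; ∃; _×_; _,_)
open import Data.Rational.Base as ℚ using (ℚ; 0ℚ; 1ℚ; ½)
import Data.Rational.Properties as ℚ
import Data.Rational.Unnormalised.Base as ℚᵘ
import Data.Rational.Unnormalised.Properties as ℚᵘ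
open import Data.Rational.Solver using (module +-*-Solver)
open import Data.Sum.Base using (inj₁; inj₂)
open import Data.Vec.Base as Vec using (Vec; []; _∷_; lookup)
import Data.Vec.Properties as Vec
open import Relation.Binary.PropositionalEquality
  using (_≡_; refl; sym; trans; cong; cong₂; subst; subst₂)
open import Relation.Nullary using (¬_)
open import Relation.Nullary.Decidable using (⌊_⌋)

------------------------------------------------------------------------
-- Auxiliary facts about ℚ

module ℚ-Lemmas where

  open import Data.Rational.Base hiding (ℚ; 0ℚ; 1ℚ; ½)
  open +-*-Solver

  0<½ : 0ℚ < ½
  0<½ = ℚ.positive⁻¹ ½

  half-pos : ∀ {ε} → 0ℚ < ε → 0ℚ < ½ * ε
  half-pos {ε} 0<ε = subst (_< ½ * ε) (ℚ.*-zeroʳ ½) (ℚ.*-monoʳ-<-pos ½ 0<ε)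

  half+half : ∀ ε → ½ * ε + ½ * ε ≡ ε
  half+half ε = trans (sym (ℚ.*-distribʳ-+ ε ½ ½)) (ℚ.*-identityˡ ε)

  dist-sym : ∀ a b → ∣ a - b ∣ ≡ ∣ b - a ∣
  dist-sym a b = trans (cong ∣_∣ (solve 2 (λ a b → a :- b := :- (b :- a)) refl a b)) (ℚ.∣-p∣≡∣p∣ (b - a))

  dist-refl : ∀ a → ∣ a - a ∣ ≡ 0ℚ
  dist-refl a = cong ∣_∣ (ℚ.+-inverseʳ a)

  ∣a∣≤∣b∣+dist : ∀ a b → ∣ a ∣ ≤ ∣ b ∣ + ∣ a - b ∣
  ∣a∣≤∣b∣+dist a b =
    subst (λ t → ∣ t ∣ ≤ ∣ b ∣ + ∣ a - b ∣) (solve 2 (λ a b → b :+ (a :- b) := a) refl a b)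
      (ℚ.∣p+q∣≤∣p∣+∣q∣ b (a - b))

  p≤∣p∣ : ∀ p → p ≤ ∣ p ∣
  p≤∣p∣ p with ℚ.≤-total 0ℚ p
  ... | inj₁ 0≤p = ℚ.≤-reflexive (sym (ℚ.0≤p⇒∣p∣≡p 0≤p))
  ... | inj₂ p≤0 = ℚ.≤-trans p≤0 (ℚ.0≤∣p∣ p)

  ∣∣-lub : ∀ {p b} → p ≤ b → - p ≤ b → ∣ p ∣ ≤ b
  ∣∣-lub {p} p≤b -p≤b with ℚ.∣p∣≡p∨∣p∣≡-p p
  ... | inj₁ e = subst (_≤ _) (sym e) p≤b
  ... | inj₂ e = subst (_≤ _) (sym e) -p≤b

  a≤b+c⇒a-b≤c : ∀ {a b c} → a ≤ b + c → a - b ≤ c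
  a≤b+c⇒a-b≤c {a} {b} {c} h =
    subst (a - b ≤_) (solve 2 (λ b c → (b :+ c) :- b := c) refl b c) (ℚ.+-monoˡ-≤ (- b) h)

  dist-∣∣ : ∀ a b → ∣ ∣ a ∣ - ∣ b ∣ ∣ ≤ ∣ a - b ∣
  dist-∣∣ a b = ∣∣-lub
    (a≤b+c⇒a-b≤c (∣a∣≤∣b∣+dist a b))
    (subst₂ _≤_ (solve 2 (λ a b → b :- a := :- (a :- b)) refl ∣ a ∣ ∣ b ∣) (dist-sym b a)
      (a≤b+c⇒a-b≤c (∣a∣≤∣b∣+dist b a)))

  dist-+ : ∀ a b c d → ∣ (a + b) - (c + d) ∣ ≤ ∣ a - c ∣ + ∣ b - d ∣
  dist-+ a b c d =
    subst (λ t → ∣ t ∣ ≤ ∣ a - c ∣ + ∣ b - d ∣)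
      (solve 4 (λ a b c d → (a :- c) :+ (b :- d) := (a :+ b) :- (c :+ d)) refl a b c d)
      (ℚ.∣p+q∣≤∣p∣+∣q∣ (a - c) (b - d))

  dist-neg : ∀ a b → ∣ (- a) - (- b) ∣ ≡ ∣ a - b ∣
  dist-neg a b = trans (cong ∣_∣ (solve 2 (λ a b → (:- a) :- (:- b) := b :- a) refl a b)) (dist-sym b a)

  dist-* : ∀ a b c d → ∣ a * b - c * d ∣ ≤ ∣ a ∣ * ∣ b - d ∣ + ∣ d ∣ * ∣ a - c ∣
  dist-* a b c d =
    subst₂ (λ s t → ∣ s ∣ ≤ t)
      (solve 4 (λ a b c d → a :* (b :- d) :+ d :* (a :- c) := a :* b :- c :* d) refl a b c d)
      (cong₂ _+_ (ℚ.∣p*q∣≡∣p∣*∣q∣ a (b - d)) (ℚ.∣p*q∣≡∣p∣*∣q∣ d (a - c)))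
      (ℚ.∣p+q∣≤∣p∣+∣q∣ (a * (b - d)) (d * (a - c)))

  *-mono-≤-nonNeg : ∀ {a b c d} → 0ℚ ≤ b → 0ℚ ≤ c → a ≤ b → c ≤ d → a * c ≤ b * d
  *-mono-≤-nonNeg {a} {b} {c} {d} 0≤b 0≤c a≤b c≤d = ℚ.≤-trans
    (ℚ.*-monoʳ-≤-nonNeg c {{nonNegative 0≤c}} a≤b)
    (ℚ.*-monoˡ-≤-nonNeg b {{nonNegative 0≤b}} c≤d)

  *-nonNeg : ∀ a b → 0ℚ ≤ a → 0ℚ ≤ b → 0ℚ ≤ a * b
  *-nonNeg a b 0≤a 0≤b = subst (_≤ a * b) (ℚ.*-zeroʳ a) (ℚ.*-monoˡ-≤-nonNeg a {{nonNegative 0≤a}} 0≤b)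

  ≤-+-nonNeg : ∀ a b → 0ℚ ≤ b → a ≤ a + b
  ≤-+-nonNeg a b 0≤b = subst (_≤ a + b) (ℚ.+-identityʳ a) (ℚ.+-monoʳ-≤ a 0≤b)

  shrink : ∀ {B ε} → 0ℚ < B → 0ℚ < ε → ∃ λ δ → 0ℚ < δ × B * δ ≡ ε
  shrink {B} {ε} 0<B 0<ε =
    ε * 1/B ,
    subst (_< ε * 1/B) (ℚ.*-zeroˡ 1/B) (ℚ.*-monoˡ-<-pos 1/B {{ℚ.1/pos⇒pos B}} 0<ε) ,
    trans (solve 3 (λ b e i → b :* (e :* i) := e :* (b :* i)) refl B ε 1/B)
      (trans (cong (ε *_) (ℚ.*-inverseʳ B)) (ℚ.*-identityʳ ε))
    where
    instance
      B>0 : Positive B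
      B>0 = positive 0<B
      B≠0 : NonZero B
      B≠0 = ℚ.pos⇒nonZero B
    1/B : ℚ
    1/B = 1/ B

  fraction-nonNeg : ∀ m n .{{_ : ℕ.NonZero n}} → 0ℚ ≤ + m / n
  fraction-nonNeg m n = ℚ.nonNegative⁻¹ (+ m / n) {{ℚ.normalize-nonNeg m n}}

  fraction-≤ : ∀ {a b c d} → a ℕ.* suc d ℕ.≤ c ℕ.* suc b → + a / suc b ≤ + c / suc d
  fraction-≤ {a} {b} {c} {d} h = ℚ.toℚᵘ-cancel-≤
    (ℚᵘ.≤-respʳ-≃ (ℚᵘ.≃-sym (ℚ.toℚᵘ-fromℚᵘ (ℚᵘ.mkℚᵘ (+ c) d)))
      (ℚᵘ.≤-respˡ-≃ (ℚᵘ.≃-sym (ℚ.toℚᵘ-fromℚᵘ (ℚᵘ.mkℚᵘ (+ a) b)))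
        (ℚᵘ.*≤* (subst₂ ℤ._≤_ (ℤ.pos-* a (suc d)) (ℤ.pos-* c (suc b)) (ℤ.+≤+ h)))))

  -- every positive rational exceeds some 1 / (N + 1)
  archimedean : ∀ {ε} → 0ℚ < ε → ∃ λ N → + 1 / suc N ≤ ε
  archimedean {ε} 0<ε = go ε (positive 0<ε)
    where
    go : ∀ ε → Positive ε → ∃ λ N → + 1 / suc N ≤ ε
    go ε@(mkℚ (+ suc a) b _) _ =
      b , subst (+ 1 / suc b ≤_) (ℚ.↥p/↧p≡p ε)
            (fraction-≤ {1} {b} {suc a} {b} (ℕ.*-monoˡ-≤ (suc b) {1} {suc a} (ℕ.s≤s ℕ.z≤n)))

open ℚ-Lemmas

------------------------------------------------------------------------
-- Natural logarithm of a positive integer n, by the Taylor expansion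
--   log n = - log (1 - r) = r + r² / 2 + r³ / 3 + ⋯   with  r = (n - 1) / n.

IsCauchy : (ℕ → ℚ) → Set
IsCauchy x = ∀ ε → 0ℚ ℚ.< ε → ∃ λ N → ∀ m n → N ℕ.≤ m → N ℕ.≤ n → ℚ.∣ x m ℚ.- x n ∣ ℚ.≤ ε

infixr 9 _^_

_^_ : ℚ → ℕ → ℚ
r ^ zero  = 1ℚ
r ^ suc k = r ℚ.* r ^ k

logPartialSum : ℚ → ℕ → ℚ
logPartialSum r zero    = 0ℚ
logPartialSum r (suc k) = logPartialSum r k ℚ.+ r ^ suc k ℚ.* (+ 1 ℚ./ suc k)

private
  module Log (m : ℕ) where

    open import Data.Rational.Base hiding (ℚ; 0ℚ; 1ℚ; ½)
    open +-*-Solver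

    s r : ℚ
    s = + suc m / 1
    r = + m / suc m

    S : ℕ → ℚ
    S = logPartialSum r

    0≤r : 0ℚ ≤ r
    0≤r = fraction-nonNeg m (suc m)

    r≤1 : r ≤ 1ℚ
    r≤1 = fraction-≤ {m} {m} {1} {0}
      (subst₂ ℕ._≤_ (sym (ℕ.*-identityʳ m)) (sym (ℕ.*-identityˡ (suc m))) (ℕ.n≤1+n m))

    r*s : r * s ≡ + m / 1
    r*s = ℚ.toℚᵘ-injective (ℚᵘ.≃-trans (ℚ.toℚᵘ-homo-* r s)
      (ℚᵘ.≃-trans (ℚᵘ.*-cong (ℚ.toℚᵘ-fromℚᵘ (ℚᵘ.mkℚᵘ (+ m) m)) (ℚ.toℚᵘ-fromℚᵘ (ℚᵘ.mkℚᵘ (+ suc m) 0)))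
        (ℚᵘ.≃-trans
          (ℚᵘ.*≡* (trans (ℤ.*-identityʳ _) (cong (λ t → + m ℤ.* (+ t)) (sym (ℕ.*-identityʳ (suc m))))))
          (ℚᵘ.≃-sym (ℚ.toℚᵘ-fromℚᵘ (ℚᵘ.mkℚᵘ (+ m) 0))))))

    m+1 : + m / 1 + 1ℚ ≡ s
    m+1 = ℚ.toℚᵘ-injective (ℚᵘ.≃-trans (ℚ.toℚᵘ-homo-+ (+ m / 1) 1ℚ)
      (ℚᵘ.≃-trans (ℚᵘ.+-congˡ (ℚ.toℚᵘ 1ℚ) (ℚ.toℚᵘ-fromℚᵘ (ℚᵘ.mkℚᵘ (+ m) 0)))
        (ℚᵘ.≃-trans
          (ℚᵘ.*≡* (cong (ℤ._* + 1)
            (trans (cong (ℤ._+ + 1) (ℤ.*-identityʳ (+ m))) (cong (λ t → + t) (ℕ.+-comm m 1)))))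
          (ℚᵘ.≃-sym (ℚ.toℚᵘ-fromℚᵘ (ℚᵘ.mkℚᵘ (+ suc m) 0))))))

    r*s+1 : r * s + 1ℚ ≡ s
    r*s+1 = trans (cong (_+ 1ℚ) r*s) m+1

    ^-nonNeg : ∀ k → 0ℚ ≤ r ^ k
    ^-nonNeg zero    = ℚ.nonNegative⁻¹ 1ℚ
    ^-nonNeg (suc k) = *-nonNeg r (r ^ k) 0≤r (^-nonNeg k)

    r*^≤^ : ∀ k → r ^ suc k ≤ r ^ k
    r*^≤^ k = subst (r ^ suc k ≤_) (ℚ.*-identityˡ (r ^ k))
      (ℚ.*-monoʳ-≤-nonNeg (r ^ k) {{nonNegative (^-nonNeg k)}} r≤1)

    ^≤1 : ∀ k → r ^ k ≤ 1ℚ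
    ^≤1 zero    = ℚ.≤-refl
    ^≤1 (suc k) = ℚ.≤-trans (r*^≤^ k) (^≤1 k)

    S-mono : ∀ N d → S N ≤ S (d ℕ.+ N)
    S-mono N zero    = ℚ.≤-refl
    S-mono N (suc d) = ℚ.≤-trans (S-mono N d)
      (≤-+-nonNeg (S k) (r ^ suc k * (+ 1 / suc k))
        (*-nonNeg (r ^ suc k) (+ 1 / suc k) (^-nonNeg (suc k)) (fraction-nonNeg 1 (suc k))))
      where
      k : ℕ
      k = d ℕ.+ N

    module _ (N : ℕ) where

      c : ℚ
      c = + 1 / suc N

      0≤c : 0ℚ ≤ c
      0≤c = fraction-nonNeg 1 (suc N)

      -- the geometric tail after k terms, added to S k, decreases in k
      tail : ∀ d → S (d ℕ.+ N) + c * s * r ^ (d ℕ.+ N) ≤ S N + c * s * r ^ N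
      tail zero    = ℚ.≤-refl
      tail (suc d) = ℚ.≤-trans
        (ℚ.+-monoˡ-≤ (c * s * r ^ suc k)
          (ℚ.+-monoʳ-≤ (S k)
            (*-mono-≤-nonNeg {r ^ suc k} {r ^ k} {+ 1 / suc k} {c}
              (^-nonNeg k) (fraction-nonNeg 1 (suc k)) (r*^≤^ k)
              (fraction-≤ {1} {k} {1} {N} (ℕ.*-monoʳ-≤ 1 (ℕ.s≤s (ℕ.m≤n+m N d)))))))
        (subst (_≤ S N + c * s * r ^ N) eq (tail d))
        where
        k : ℕ
        k = d ℕ.+ N
        eq : S k + c * s * r ^ k ≡ S k + r ^ k * c + c * s * (r * r ^ k)
        eq = trans (cong (λ t → S k + c * t * r ^ k) (sym r*s+1))
          (solve 5 (λ a c x r s → a :+ c :* (r :* s :+ con 1ℚ) :* x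
                                    := a :+ x :* c :+ c :* s :* (r :* x))
            refl (S k) c (r ^ k) r s)

      0≤s : 0ℚ ≤ s
      0≤s = fraction-nonNeg (suc m) 1

      0≤c*s : 0ℚ ≤ c * s
      0≤c*s = *-nonNeg c s 0≤c 0≤s

      S-upper : ∀ d → S (d ℕ.+ N) ≤ S N + c * s
      S-upper d = ℚ.≤-trans
        (≤-+-nonNeg (S (d ℕ.+ N)) (c * s * r ^ (d ℕ.+ N))
          (*-nonNeg (c * s) (r ^ (d ℕ.+ N)) 0≤c*s (^-nonNeg (d ℕ.+ N))))
        (ℚ.≤-trans (tail d)
          (ℚ.+-monoʳ-≤ (S N)
            (subst (c * s * r ^ N ≤_) (ℚ.*-identityʳ (c * s))
              (ℚ.*-monoˡ-≤-nonNeg (c * s) {{nonNegative 0≤c*s}} (^≤1 N)))))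

      dist-N : ∀ k → N ℕ.≤ k → ∣ S k - S N ∣ ≤ c * s
      dist-N k N≤k = ∣∣-lub
        (a≤b+c⇒a-b≤c (subst (λ t → S t ≤ S N + c * s) (ℕ.m∸n+n≡m N≤k) (S-upper (k ℕ.∸ N))))
        (ℚ.≤-trans
          (subst (_≤ 0ℚ) (solve 2 (λ a b → a :- b := :- (b :- a)) refl (S N) (S k))
            (a≤b+c⇒a-b≤c
              (subst (S N ≤_) (sym (ℚ.+-identityʳ (S k)))
                (subst (λ t → S N ≤ S t) (ℕ.m∸n+n≡m N≤k) (S-mono N (k ℕ.∸ N))))))
          0≤c*s)

    S-cauchy : IsCauchy S
    S-cauchy ε 0<ε =
      let (δ , 0<δ , eδ) = shrink {s} (ℚ.positive⁻¹ s {{ℚ.normalize-pos (suc m) 1}}) (half-pos 0<ε)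
          (N , hN)       = archimedean 0<δ
          bound : ∀ k → N ℕ.≤ k → ∣ S k - S N ∣ ≤ ½ * ε
          bound k N≤k = ℚ.≤-trans (dist-N N k N≤k)
            (subst (c N * s ≤_) (trans (ℚ.*-comm δ s) eδ)
              (ℚ.*-monoʳ-≤-nonNeg s {{nonNegative (fraction-nonNeg (suc m) 1)}} hN))
      in N , λ i j i≥ j≥ →
        subst (λ t → ∣ t ∣ ≤ ε)
          (solve 3 (λ a b c → (a :- c) :+ (c :- b) := a :- b) refl (S i) (S j) (S N))
          (ℚ.≤-trans (ℚ.∣p+q∣≤∣p∣+∣q∣ (S i - S N) (S N - S j))
            (subst (∣ S i - S N ∣ + ∣ S N - S j ∣ ≤_) (half+half ε)
              (ℚ.+-mono-≤ (bound i i≥) (subst (_≤ ½ * ε) (dist-sym (S j) (S N)) (bound j j≥)))))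

------------------------------------------------------------------------
-- Real numbers: Cauchy sequences of rationals.  Two sequences may represent
-- the same real, and all notions below respect this.

record ℝ : Set where
  constructor real
  field
    seq    : ℕ → ℚ
    cauchy : IsCauchy seq

open ℝ public

infix  4 _<_ _≤_
infix  8 -_
infixl 7 _*_
infixl 6 _+_ _-_

_≤_ : ℝ → ℝ → Set
x ≤ y = ∀ ε → 0ℚ ℚ.< ε → ∃ λ N → ∀ n → N ℕ.≤ n → seq x n ℚ.≤ seq y n ℚ.+ ε

_<_ : ℝ → ℝ → Set
x < y = ∃ λ ε → 0ℚ ℚ.< ε × ∃ λ N → ∀ n → N ℕ.≤ n → seq x n ℚ.+ ε ℚ.≤ seq y n

fromℚ : ℚ → ℝ
fromℚ r = real (λ _ → r) λ ε 0<ε → 0 , λ _ _ _ _ →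
  subst (ℚ._≤ ε) (sym (dist-refl r)) (ℚ.<⇒≤ 0<ε)

fromℕ : ℕ → ℝ
fromℕ n = fromℚ (+ n ℚ./ 1)

0ℝ 1ℝ : ℝ
0ℝ = fromℕ 0
1ℝ = fromℕ 1

_+_ : ℝ → ℝ → ℝ
real x cx + real y cy = real (λ n → x n ℚ.+ y n) λ ε 0<ε →
  let (M , hM) = cx (½ ℚ.* ε) (half-pos 0<ε)
      (N , hN) = cy (½ ℚ.* ε) (half-pos 0<ε)
  in M ℕ.⊔ N , λ m n m≥ n≥ →
    ℚ.≤-trans (dist-+ (x m) (y m) (x n) (y n))
      (subst (_ ℚ.≤_) (half+half ε)
        (ℚ.+-mono-≤ (hM m n (ℕ.m⊔n≤o⇒m≤o M N m≥) (ℕ.m⊔n≤o⇒m≤o M N n≥))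
                    (hN m n (ℕ.m⊔n≤o⇒n≤o M N m≥) (ℕ.m⊔n≤o⇒n≤o M N n≥))))

-_ : ℝ → ℝ
- real x cx = real (λ n → ℚ.- x n) λ ε 0<ε →
  let (N , hN) = cx ε 0<ε
  in N , λ m n m≥ n≥ → subst (ℚ._≤ ε) (sym (dist-neg (x m) (x n))) (hN m n m≥ n≥)

_-_ : ℝ → ℝ → ℝ
x - y = x + (- y)

∣_∣ : ℝ → ℝ
∣ real x cx ∣ = real (λ n → ℚ.∣ x n ∣) λ ε 0<ε →
  let (N , hN) = cx ε 0<ε
  in N , λ m n m≥ n≥ → ℚ.≤-trans (dist-∣∣ (x m) (x n)) (hN m n m≥ n≥)

eventually-bounded : ∀ x → IsCauchy x →
  ∃ λ B → 0ℚ ℚ.< B × ∃ λ N → ∀ n → N ℕ.≤ n → ℚ.∣ x n ∣ ℚ.≤ B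
eventually-bounded x cx =
  let (N , hN) = cx 1ℚ (ℚ.positive⁻¹ 1ℚ)
  in ℚ.∣ x N ∣ ℚ.+ 1ℚ ,
     ℚ.+-mono-≤-< (ℚ.0≤∣p∣ (x N)) (ℚ.positive⁻¹ 1ℚ) ,
     N , λ n n≥ → ℚ.≤-trans (∣a∣≤∣b∣+dist (x n) (x N))
                    (ℚ.+-monoʳ-≤ ℚ.∣ x N ∣ (hN n N n≥ ℕ.≤-refl))

_*_ : ℝ → ℝ → ℝ
real x cx * real y cy = real (λ n → x n ℚ.* y n) λ ε 0<ε →
  let (B , 0<B , K , hK) = eventually-bounded x cx
      (C , 0<C , L , hL) = eventually-bounded y cy
      (β , 0<β , eβ)     = shrink 0<B (half-pos 0<ε)
      (γ , 0<γ , eγ)     = shrink 0<C (half-pos 0<ε)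
      (M , hM)           = cx γ 0<γ
      (N , hN)           = cy β 0<β
      KL = K ℕ.⊔ L
      MN = M ℕ.⊔ N
  in KL ℕ.⊔ MN , λ m n m≥ n≥ →
    let m≥KL = ℕ.m⊔n≤o⇒m≤o KL MN m≥
        n≥KL = ℕ.m⊔n≤o⇒m≤o KL MN n≥
        m≥MN = ℕ.m⊔n≤o⇒n≤o KL MN m≥
        n≥MN = ℕ.m⊔n≤o⇒n≤o KL MN n≥
    in ℚ.≤-trans (dist-* (x m) (y m) (x n) (y n))
         (subst (_ ℚ.≤_) (trans (cong₂ ℚ._+_ eβ eγ) (half+half ε))
           (ℚ.+-mono-≤
             (*-mono-≤-nonNeg (ℚ.<⇒≤ 0<B) (ℚ.0≤∣p∣ _) (hK m (ℕ.m⊔n≤o⇒m≤o K L m≥KL))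
               (hN m n (ℕ.m⊔n≤o⇒n≤o M N m≥MN) (ℕ.m⊔n≤o⇒n≤o M N n≥MN)))
             (*-mono-≤-nonNeg (ℚ.<⇒≤ 0<C) (ℚ.0≤∣p∣ _) (hL n (ℕ.m⊔n≤o⇒n≤o K L n≥KL))
               (hM m n (ℕ.m⊔n≤o⇒m≤o M N m≥MN) (ℕ.m⊔n≤o⇒m≤o M N n≥MN)))))

-- The value at 0 is junk.
log : ℕ → ℝ
log zero      = 0ℝ
log n@(suc m) = real (logPartialSum (+ m ℚ./ n)) (Log.S-cauchy m)

------------------------------------------------------------------------
-- Limits as n → ∞

TendsTo : (ℕ → ℝ) → ℝ → Set
TendsTo x ℓ = ∀ ε → 0ℝ < ε → ∃ λ N → ∀ n → N ℕ.≤ n → ∣ x n - ℓ ∣ < ε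

-- x n / y n → ∞ for an eventually positive y, with the denominator cleared.
RatioTendsTo∞ : (ℕ → ℝ) → (ℕ → ℝ) → Set
RatioTendsTo∞ x y = ∀ K → ∃ λ N → ∀ n → N ℕ.≤ n → K * y n < x n

------------------------------------------------------------------------
-- Finite simple graphs on the vertex set Fin n, given by the strict upper
-- triangle of the adjacency matrix: `extend v G` adds a new first vertex
-- with neighbourhood v to G.

data Graph : ℕ → Set where
  empty  : Graph 0
  extend : ∀ {n} → Vec Bool n → Graph n → Graph (suc n)

adj : ∀ {n} → Graph n → Fin n → Fin n → Bool
adj (extend v G) zero    zero    = false
adj (extend v G) zero    (suc j) = lookup v j
adj (extend v G) (suc i) zero    = lookup v i
adj (extend v G) (suc i) (suc j) = adj G i j

Adj : ∀ {n} → Graph n → Fin n → Fin n → Set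
Adj G i j = T (adj G i j)

adj-sym : ∀ {n} (G : Graph n) i j → adj G i j ≡ adj G j i
adj-sym (extend v G) zero    zero    = refl
adj-sym (extend v G) zero    (suc j) = refl
adj-sym (extend v G) (suc i) zero    = refl
adj-sym (extend v G) (suc i) (suc j) = adj-sym G i j

adj-irrefl : ∀ {n} (G : Graph n) i → adj G i i ≡ false
adj-irrefl (extend v G) zero    = refl
adj-irrefl (extend v G) (suc i) = adj-irrefl G i

-- Graphs are exactly the symmetric irreflexive relations.
fromRelation : ∀ {n} → (Fin n → Fin n → Bool) → Graph n
fromRelation {zero}  f = empty
fromRelation {suc n} f =
  extend (Vec.tabulate λ j → f zero (suc j)) (fromRelation λ i j → f (suc i) (suc j))

adj-fromRelation : ∀ {n} (f : Fin n → Fin n → Bool) →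
  (∀ i j → f i j ≡ f j i) → (∀ i → f i i ≡ false) →
  ∀ i j → adj (fromRelation f) i j ≡ f i j
adj-fromRelation f s r zero    zero    = sym (r zero)
adj-fromRelation f s r zero    (suc j) = Vec.lookup∘tabulate _ j
adj-fromRelation f s r (suc i) zero    = trans (Vec.lookup∘tabulate _ i) (s zero (suc i))
adj-fromRelation f s r (suc i) (suc j) =
  adj-fromRelation (λ i j → f (suc i) (suc j)) (λ i j → s (suc i) (suc j)) (λ i → r (suc i)) i j

fromRelation-adj : ∀ {n} (G : Graph n) → fromRelation (adj G) ≡ G
fromRelation-adj empty        = refl
fromRelation-adj (extend v G) = cong₂ extend (Vec.tabulate∘lookup v) (fromRelation-adj G)

infix 4 _⊆_

-- Containment as a spanning subgraph: both graphs have vertex set Fin n.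
_⊆_ : ∀ {n} → Graph n → Graph n → Set
H ⊆ G = ∀ i j → Adj H i j → Adj G i j

TriangleFree : ∀ {n} → Graph n → Set
TriangleFree G = ∀ i j k → ¬ (Adj G i j × Adj G j k × Adj G i k)

count : ∀ {A : Set} → (A → Bool) → List A → ℕ
count P xs = length (filterᵇ P xs)

allVecs : ∀ {A : Set} → List A → ∀ n → List (Vec A n)
allVecs xs zero    = [] ∷ []
allVecs xs (suc n) = cartesianProductWith _∷_ xs (allVecs xs n)

-- The unordered pairs of distinct vertices, each listed once as i < j.
pairs : ∀ n → List (Fin n × Fin n)
pairs n = filter (λ (i , j) → i Fin.<? j) (cartesianProduct (allFin n) (allFin n))

edgeCount : ∀ {n} → Graph n → ℕ
edgeCount {n} G = count (λ (i , j) → adj G i j) (pairs n)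

degree : ∀ {n} → Graph n → Fin n → ℕ
degree {n} G i = count (adj G i) (allFin n)

-- The value for the graph without vertices is junk.
δ : ∀ {n} → Graph n → ℕ
δ {zero}  G = 0
δ {suc n} G = min (degree G zero) (map (degree G) (allFin (suc n)))

monochromatic : ∀ {q n} → Graph n → Vec (Fin q) n → ℕ
monochromatic {n = n} G φ = count (λ (i , j) → adj G i j ∧ ⌊ lookup φ i Fin.≟ lookup φ j ⌋) (pairs n)

-- `min` also ranges over its first argument; as no colouring has more than
-- edgeCount G monochromatic edges, this has no effect when q ≥ 1.
del : ∀ {n} → ℕ → Graph n → ℕ
del {n} q G = min (edgeCount G) (map (monochromatic G) (allVecs (allFin q) n))

------------------------------------------------------------------------
-- The binomial random graph G(n, p)

allGraphs : ∀ n → List (Graph n)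
allGraphs zero    = empty ∷ []
allGraphs (suc n) = cartesianProductWith extend (allVecs (false ∷ true ∷ []) n) (allGraphs n)

-- ℙ[G(n, p) = G]
weight : ∀ {n} → ℝ → Graph n → ℝ
weight {n} p G = foldr (λ (i , j) w → (if adj G i j then p else 1ℝ - p) * w) 1ℝ (pairs n)

-- ℙ[G(n, p) ∈ A]
Pr : ∀ {n} → ℝ → (Graph n → Bool) → ℝ
Pr {n} p A = foldr (λ G w → (if A G then weight p G else 0ℝ) + w) 0ℝ (allGraphs n)

-- G(n, p n) satisfies E asymptotically almost surely.  Classically A can be
-- taken to be E itself; constructively E need not be decidable (it may
-- compare real numbers), so its probability is bounded from below by that
-- of decidable subevents.
AAS : (ℕ → ℝ) → (∀ n → Graph n → Set) → Set
AAS p E = Σ (∀ n → Graph n → Bool) λ A →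
  (∀ n G → T (A n G) → E n G) × TendsTo (λ n → Pr (p n) (A n)) 1ℝ

-- 1 / n, with junk value 0 at n = 0
1/ℕ : ℕ → ℝ
1/ℕ zero      = 0ℝ
1/ℕ n@(suc _) = fromℚ (+ 1 ℚ./ n)

{-# OPTIONS --safe #-}

-- Let H consist of the edges of Γ that lie in no triangle of Γ.  A vertex v loses at most 2 e(N(v))
-- edges, and e(N(v)) is about p (pn)² / 2 = o(pn) because np² → 0; so H has nearly all the edges of Γ,
-- at every vertex.  Chernoff bounds control the degrees, the e(N(v)) and the number of monochromatic
-- edges of every q-colouring of Γ, and they survive the union bounds over the n vertices (as
-- pn / log n → ∞) and the q^n colourings.  Every q-colouring has at least n²/2q - n/2 monochromatic
-- pairs by Cauchy-Schwarz, and a greedy colouring shows del_q(H) ≤ e(H)/q.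
--
-- For constructivity, all estimates are made for rational approximations r of p(n).  A natural number
-- R with 1/(R+3) ≤ r ≤ 1/R stands in for 1/p, so that thresholds become natural numbers and the
-- exponential function is replaced by (1 + x)^R (1 - Rx) ≤ 1 and (1 - x)^R (1 + Rx) ≤ 1.  The accuracy
-- 1/D is finally let tend to 0 along n by diagonalisation.

module Submission where

-- The neighbourhood of v is itself random, so e(N(v)) is not a sum over a fixed set of pairs. It
-- becomes one by resampling: G(n,p) has the law of the graph that takes its edges at v from one
-- copy and all others from an independent second copy. With the first copy fixed, every random
-- quantity in the proof counts the edges within a fixed set of pairs, and one tail bound in each
-- direction serves for all. The bounds mention neither means nor square roots. A count of mean at
-- most d(d+1)j reaches (d+1)(d+2)j with probability at most 2^(-j), and a count of mean at least
-- (d+1)(d+2)j falls to d(d+1)j equally rarely. The ratio 1 + 2/d of the thresholds is the accuracy,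
-- while j has only to exceed the binary logarithm of the number of events: of order log n for
-- vertices and of order n for colourings. Choosing j is then division of natural numbers. The
-- threshold for e(N(v)) is not its mean p(pn)²/2 but about pn/(2Dq), just small enough to be an
-- error term; np² → 0 puts the mean below it.

-- Rational arithmetic: naturals as rationals, powers, Bernoulli's inequalities.

module Rationals where

  open import Defs using (_^_; module ℚ-Lemmas)
  import Data.Integer.Base as ℤ
  import Data.Integer.Properties as ℤ
  open import Data.Nat.Base as ℕ using (ℕ; zero; suc)
  import Data.Nat.Properties as ℕ
  open import Data.Rational.Base
  import Data.Rational.Properties as ℚ
  import Data.Rational.Unnormalised.Base as ℚᵘ
  import Data.Rational.Unnormalised.Properties as ℚᵘ
  open import Data.Rational.Solver using (module +-*-Solver)
  open import Relation.Binary.PropositionalEquality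
  open ℚ-Lemmas public
    using (*-mono-≤-nonNeg; *-nonNeg; ≤-+-nonNeg; shrink; fraction-nonNeg; fraction-≤; archimedean; ∣∣-lub; p≤∣p∣)
  open +-*-Solver using (solve; _:=_; _:+_; _:*_; _:-_; :-_; con)

  ι : ℕ → ℚ
  ι n = ℤ.+ n / 1

  1/suc : ℕ → ℚ
  1/suc k = ℤ.+ 1 / suc k

  ≤-by : ∀ {a b} c → 0ℚ ≤ c → b ≡ a + c → a ≤ b
  ≤-by {a} c 0≤c b≡a+c = subst (a ≤_) (sym b≡a+c) (≤-+-nonNeg a c 0≤c)

  ≤⇒0≤- : ∀ {a b} → a ≤ b → 0ℚ ≤ b - a
  ≤⇒0≤- {a} {b} a≤b = subst (_≤ b - a) (ℚ.+-inverseʳ a) (ℚ.+-monoˡ-≤ (- a) a≤b)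

  +-nonNeg : ∀ {a b} → 0ℚ ≤ a → 0ℚ ≤ b → 0ℚ ≤ a + b
  +-nonNeg 0≤a 0≤b = ℚ.+-mono-≤ 0≤a 0≤b

  *-monoˡ : ∀ {a b} c → 0ℚ ≤ c → a ≤ b → c * a ≤ c * b
  *-monoˡ c 0≤c = ℚ.*-monoˡ-≤-nonNeg c {{nonNegative 0≤c}}

  *-monoʳ : ∀ {a b} c → 0ℚ ≤ c → a ≤ b → a * c ≤ b * c
  *-monoʳ c 0≤c = ℚ.*-monoʳ-≤-nonNeg c {{nonNegative 0≤c}}

  *-cancelˡ : ∀ {a b} c → 0ℚ < c → c * a ≤ c * b → a ≤ b
  *-cancelˡ c 0<c = ℚ.*-cancelˡ-≤-pos c {{positive 0<c}}

  0≤1 : 0ℚ ≤ 1ℚ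
  0≤1 = ℚ.nonNegative⁻¹ 1ℚ

  0<1 : 0ℚ < 1ℚ
  0<1 = ℚ.positive⁻¹ 1ℚ

  ι-suc : ∀ n → ι (suc n) ≡ 1ℚ + ι n
  ι-suc n = ℚ.toℚᵘ-injective (ℚᵘ.≃-sym (ℚᵘ.≃-trans (ℚ.toℚᵘ-homo-+ 1ℚ (ι n))
    (ℚᵘ.≃-trans (ℚᵘ.+-congʳ (toℚᵘ 1ℚ) (ℚ.toℚᵘ-fromℚᵘ (ℚᵘ.mkℚᵘ (ℤ.+ n) 0)))
      (ℚᵘ.≃-trans (ℚᵘ.*≡* (cong (ℤ._* ℤ.+ 1) (cong (λ t → ℤ.+ 1 ℤ.+ t) (ℤ.*-identityʳ (ℤ.+ n)))))
        (ℚᵘ.≃-sym (ℚ.toℚᵘ-fromℚᵘ (ℚᵘ.mkℚᵘ (ℤ.+ suc n) 0)))))))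

  ι-+ : ∀ m n → ι (m ℕ.+ n) ≡ ι m + ι n
  ι-+ zero    n = sym (ℚ.+-identityˡ (ι n))
  ι-+ (suc m) n = begin
    ι (suc (m ℕ.+ n))   ≡⟨ ι-suc (m ℕ.+ n) ⟩
    1ℚ + ι (m ℕ.+ n)    ≡⟨ cong (1ℚ +_) (ι-+ m n) ⟩
    1ℚ + (ι m + ι n)    ≡⟨ ℚ.+-assoc 1ℚ (ι m) (ι n) ⟨
    1ℚ + ι m + ι n      ≡⟨ cong (_+ ι n) (ι-suc m) ⟨
    ι (suc m) + ι n     ∎
    where open ≡-Reasoning

  ι-* : ∀ m n → ι (m ℕ.* n) ≡ ι m * ι n
  ι-* zero    n = sym (ℚ.*-zeroˡ (ι n))
  ι-* (suc m) n = begin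
    ι (n ℕ.+ m ℕ.* n)     ≡⟨ ι-+ n (m ℕ.* n) ⟩
    ι n + ι (m ℕ.* n)     ≡⟨ cong (ι n +_) (ι-* m n) ⟩
    ι n + ι m * ι n       ≡⟨ solve 2 (λ m n → n :+ m :* n := (con 1ℚ :+ m) :* n) refl (ι m) (ι n) ⟩
    (1ℚ + ι m) * ι n      ≡⟨ cong (_* ι n) (ι-suc m) ⟨
    ι (suc m) * ι n       ∎
    where open ≡-Reasoning

  ι-nonNeg : ∀ n → 0ℚ ≤ ι n
  ι-nonNeg n = fraction-nonNeg n 1

  ι-mono : ∀ {m n} → m ℕ.≤ n → ι m ≤ ι n
  ι-mono {m} {n} m≤n = ≤-by (ι (n ℕ.∸ m)) (ι-nonNeg (n ℕ.∸ m))
    (trans (cong ι (sym (ℕ.m+[n∸m]≡n m≤n))) (ι-+ m (n ℕ.∸ m)))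

  ι-pos : ∀ {n} → 1 ℕ.≤ n → 0ℚ < ι n
  ι-pos 1≤n = ℚ.<-≤-trans 0<1 (ι-mono 1≤n)

  ι-cancel : ∀ {m n} → ι m ≤ ι n → m ℕ.≤ n
  ι-cancel {m} {n} h = ℕ.≮⇒≥ λ n<m → ℚ.<-irrefl refl
    (ℚ.<-≤-trans (subst (_< 1ℚ + ι n) (ℚ.+-identityˡ (ι n)) (ℚ.+-monoˡ-< (ι n) 0<1))
      (subst (_≤ ι n) (ι-suc n) (ℚ.≤-trans (ι-mono n<m) h)))

  1/suc-nonNeg : ∀ k → 0ℚ ≤ 1/suc k
  1/suc-nonNeg k = fraction-nonNeg 1 (suc k)

  ι*fraction : ∀ m k → ι (suc k) * (ℤ.+ m / suc k) ≡ ι m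
  ι*fraction m k = ℚ.toℚᵘ-injective (ℚᵘ.≃-trans (ℚ.toℚᵘ-homo-* (ι (suc k)) (ℤ.+ m / suc k))
    (ℚᵘ.≃-trans (ℚᵘ.*-cong (ℚ.toℚᵘ-fromℚᵘ (ℚᵘ.mkℚᵘ (ℤ.+ suc k) 0)) (ℚ.toℚᵘ-fromℚᵘ (ℚᵘ.mkℚᵘ (ℤ.+ m) k)))
      (ℚᵘ.≃-trans
        (ℚᵘ.*≡* (trans (ℤ.*-identityʳ (ℤ.+ suc k ℤ.* ℤ.+ m)) (trans (ℤ.*-comm (ℤ.+ suc k) (ℤ.+ m)) (cong (λ t → ℤ.+ m ℤ.* (ℤ.+ t)) (sym (ℕ.+-identityʳ (suc k)))))))
        (ℚᵘ.≃-sym (ℚ.toℚᵘ-fromℚᵘ (ℚᵘ.mkℚᵘ (ℤ.+ m) 0))))))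

  ι*1/suc : ∀ k → ι (suc k) * 1/suc k ≡ 1ℚ
  ι*1/suc k = ι*fraction 1 k

  ^-nonNeg : ∀ {a} → 0ℚ ≤ a → ∀ n → 0ℚ ≤ a ^ n
  ^-nonNeg         0≤a zero    = 0≤1
  ^-nonNeg {a}     0≤a (suc n) = *-nonNeg a (a ^ n) 0≤a (^-nonNeg 0≤a n)

  1≤^ : ∀ {a} → 1ℚ ≤ a → ∀ n → 1ℚ ≤ a ^ n
  1≤^     1≤a zero    = ℚ.≤-refl
  1≤^ {a} 1≤a (suc n) = *-mono-≤-nonNeg {1ℚ} {a} {1ℚ} {a ^ n} (ℚ.≤-trans 0≤1 1≤a) 0≤1 1≤a (1≤^ 1≤a n)

  ^≤1 : ∀ {a} → 0ℚ ≤ a → a ≤ 1ℚ → ∀ n → a ^ n ≤ 1ℚ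
  ^≤1     0≤a a≤1 zero    = ℚ.≤-refl
  ^≤1 {a} 0≤a a≤1 (suc n) = *-mono-≤-nonNeg {a} {1ℚ} {a ^ n} {1ℚ} 0≤1 (^-nonNeg 0≤a n) a≤1 (^≤1 0≤a a≤1 n)

  ^-monoˡ : ∀ {a b} → 0ℚ ≤ a → a ≤ b → ∀ n → a ^ n ≤ b ^ n
  ^-monoˡ         0≤a a≤b zero    = ℚ.≤-refl
  ^-monoˡ {a} {b} 0≤a a≤b (suc n) =
    *-mono-≤-nonNeg {a} {b} {a ^ n} {b ^ n} (ℚ.≤-trans 0≤a a≤b) (^-nonNeg 0≤a n) a≤b (^-monoˡ 0≤a a≤b n)

  ^-+ : ∀ a m n → a ^ (m ℕ.+ n) ≡ a ^ m * a ^ n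
  ^-+ a zero    n = sym (ℚ.*-identityˡ (a ^ n))
  ^-+ a (suc m) n = trans (cong (a *_) (^-+ a m n)) (sym (ℚ.*-assoc a (a ^ m) (a ^ n)))

  ^-distrib : ∀ a b n → (a * b) ^ n ≡ a ^ n * b ^ n
  ^-distrib a b zero    = refl
  ^-distrib a b (suc n) = trans (cong (a * b *_) (^-distrib a b n))
    (solve 4 (λ a b x y → a :* b :* (x :* y) := a :* x :* (b :* y)) refl a b (a ^ n) (b ^ n))

  1^ : ∀ n → 1ℚ ^ n ≡ 1ℚ
  1^ zero    = refl
  1^ (suc n) = trans (ℚ.*-identityˡ (1ℚ ^ n)) (1^ n)

  ^-* : ∀ a m n → a ^ (m ℕ.* n) ≡ (a ^ m) ^ n
  ^-* a zero    n = sym (1^ n)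
  ^-* a (suc m) n = begin
    a ^ (n ℕ.+ m ℕ.* n)      ≡⟨ ^-+ a n (m ℕ.* n) ⟩
    a ^ n * a ^ (m ℕ.* n)    ≡⟨ cong (a ^ n *_) (^-* a m n) ⟩
    a ^ n * (a ^ m) ^ n      ≡⟨ ^-distrib a (a ^ m) n ⟨
    (a * a ^ m) ^ n          ∎
    where open ≡-Reasoning

  ^-monoʳ : ∀ {a} → 1ℚ ≤ a → ∀ {m n} → m ℕ.≤ n → a ^ m ≤ a ^ n
  ^-monoʳ {a} 1≤a {m} {n} m≤n = subst₂ _≤_ (ℚ.*-identityʳ (a ^ m))
    (trans (sym (^-+ a m (n ℕ.∸ m))) (cong (a ^_) (ℕ.m+[n∸m]≡n m≤n)))
    (*-monoˡ (a ^ m) (^-nonNeg (ℚ.≤-trans 0≤1 1≤a) m) (1≤^ 1≤a (n ℕ.∸ m)))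

  ^-antimonoʳ : ∀ {a} → 0ℚ ≤ a → a ≤ 1ℚ → ∀ {m n} → m ℕ.≤ n → a ^ n ≤ a ^ m
  ^-antimonoʳ {a} 0≤a a≤1 {m} {n} m≤n = subst₂ _≤_
    (trans (sym (^-+ a m (n ℕ.∸ m))) (cong (a ^_) (ℕ.m+[n∸m]≡n m≤n)))
    (ℚ.*-identityʳ (a ^ m))
    (*-monoˡ (a ^ m) (^-nonNeg 0≤a m) (^≤1 0≤a a≤1 (n ℕ.∸ m)))

  ι-^ : ∀ m n → ι (m ℕ.^ n) ≡ ι m ^ n
  ι-^ m zero    = refl
  ι-^ m (suc n) = trans (ι-* m (m ℕ.^ n)) (cong (ι m *_) (ι-^ m n))

  bernoulli⁺ : ∀ {x} → 0ℚ ≤ x → ∀ n → 1ℚ + ι n * x ≤ (1ℚ + x) ^ n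
  bernoulli⁺ {x} 0≤x zero    = ℚ.≤-reflexive (trans (cong (λ t → 1ℚ + t) (ℚ.*-zeroˡ x)) (ℚ.+-identityʳ 1ℚ))
  bernoulli⁺ {x} 0≤x (suc n) = ℚ.≤-trans
    (≤-by (ι n * (x * x)) (*-nonNeg (ι n) (x * x) (ι-nonNeg n) (*-nonNeg x x 0≤x 0≤x))
      (trans (solve 2 (λ x n → (con 1ℚ :+ x) :* (con 1ℚ :+ n :* x)
                                 := con 1ℚ :+ (con 1ℚ :+ n) :* x :+ n :* (x :* x)) refl x (ι n))
        (cong (λ t → 1ℚ + t * x + ι n * (x * x)) (sym (ι-suc n)))))
    (*-monoˡ (1ℚ + x) (+-nonNeg 0≤1 0≤x) (bernoulli⁺ 0≤x n))

  bernoulli⁻ : ∀ {x} → 0ℚ ≤ x → x ≤ 1ℚ → ∀ n → 1ℚ - ι n * x ≤ (1ℚ - x) ^ n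
  bernoulli⁻ {x} 0≤x x≤1 zero    = ℚ.≤-reflexive (trans (cong (λ t → 1ℚ - t) (ℚ.*-zeroˡ x)) (ℚ.+-identityʳ 1ℚ))
  bernoulli⁻ {x} 0≤x x≤1 (suc n) = ℚ.≤-trans
    (≤-by (ι n * (x * x)) (*-nonNeg (ι n) (x * x) (ι-nonNeg n) (*-nonNeg x x 0≤x 0≤x))
      (trans (solve 2 (λ x n → (con 1ℚ :- x) :* (con 1ℚ :- n :* x)
                                 := con 1ℚ :- (con 1ℚ :+ n) :* x :+ n :* (x :* x)) refl x (ι n))
        (cong (λ t → 1ℚ - t * x + ι n * (x * x)) (sym (ι-suc n)))))
    (*-monoˡ (1ℚ - x) (≤⇒0≤- x≤1) (bernoulli⁻ 0≤x x≤1 n))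

  -- The product decreases in n: its value at n exceeds that at n + 1 by (1 + x)^n (n + 1) x².
  [1+x]^n[1-nx]≤1 : ∀ {x} → 0ℚ ≤ x → ∀ n → (1ℚ + x) ^ n * (1ℚ - ι n * x) ≤ 1ℚ
  [1+x]^n[1-nx]≤1 {x} 0≤x zero    = ℚ.≤-reflexive (solve 1 (λ x → con 1ℚ :* (con 1ℚ :- con 0ℚ :* x) := con 1ℚ) refl x)
  [1+x]^n[1-nx]≤1 {x} 0≤x (suc n) = ℚ.≤-trans
    (≤-by ((1ℚ + x) ^ n * (ι (suc n) * (x * x)))
      (*-nonNeg ((1ℚ + x) ^ n) (ι (suc n) * (x * x)) (^-nonNeg (+-nonNeg 0≤1 0≤x) n)
        (*-nonNeg (ι (suc n)) (x * x) (ι-nonNeg (suc n)) (*-nonNeg x x 0≤x 0≤x)))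
      (subst (λ t → (1ℚ + x) ^ n * (1ℚ - ι n * x)
                      ≡ (1ℚ + x) * (1ℚ + x) ^ n * (1ℚ - t * x) + (1ℚ + x) ^ n * (t * (x * x)))
        (sym (ι-suc n))
        (solve 3 (λ x n y → y :* (con 1ℚ :- n :* x)
                     := (con 1ℚ :+ x) :* y :* (con 1ℚ :- (con 1ℚ :+ n) :* x) :+ y :* ((con 1ℚ :+ n) :* (x :* x)))
          refl x (ι n) ((1ℚ + x) ^ n))))
    ([1+x]^n[1-nx]≤1 0≤x n)

  -- Again the product decreases in n, now by (1 - x)^n (n + 1) x², which is nonnegative because x ≤
  -- 1.
  [1-x]^n[1+nx]≤1 : ∀ {x} → 0ℚ ≤ x → x ≤ 1ℚ → ∀ n → (1ℚ - x) ^ n * (1ℚ + ι n * x) ≤ 1ℚ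
  [1-x]^n[1+nx]≤1 {x} 0≤x x≤1 zero    = ℚ.≤-reflexive (solve 1 (λ x → con 1ℚ :* (con 1ℚ :+ con 0ℚ :* x) := con 1ℚ) refl x)
  [1-x]^n[1+nx]≤1 {x} 0≤x x≤1 (suc n) = ℚ.≤-trans
    (≤-by ((1ℚ - x) ^ n * (ι (suc n) * (x * x)))
      (*-nonNeg ((1ℚ - x) ^ n) (ι (suc n) * (x * x)) (^-nonNeg (≤⇒0≤- x≤1) n)
        (*-nonNeg (ι (suc n)) (x * x) (ι-nonNeg (suc n)) (*-nonNeg x x 0≤x 0≤x)))
      (subst (λ t → (1ℚ - x) ^ n * (1ℚ + ι n * x)
                      ≡ (1ℚ - x) * (1ℚ - x) ^ n * (1ℚ + t * x) + (1ℚ - x) ^ n * (t * (x * x)))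
        (sym (ι-suc n))
        (solve 3 (λ x n y → y :* (con 1ℚ :+ n :* x)
                     := (con 1ℚ :- x) :* y :* (con 1ℚ :+ (con 1ℚ :+ n) :* x) :+ y :* ((con 1ℚ :+ n) :* (x :* x)))
          refl x (ι n) ((1ℚ - x) ^ n))))
    ([1-x]^n[1+nx]≤1 0≤x x≤1 n)

-- Sums over vertices and over pairs of vertices.

module Counting where

  open import Defs using (Graph; adj; adj-sym; adj-irrefl; count; pairs; edgeCount; degree; monochromatic)
  open import Data.Bool.Base using (Bool; true; false; if_then_else_; _∧_)
  open import Data.Bool.Properties using (T?)
  open import Data.Fin.Base as Fin using (Fin; zero; suc)
  import Data.Fin.Properties as Fin
  open import Data.List.Base
    using (List; []; _∷_; _++_; map; length; filter; allFin; tabulate; cartesianProduct)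
  import Data.List.Properties as List
  open import Data.Nat.Base
  open import Data.Nat.Properties
  open import Data.Nat.Tactic.RingSolver using (solve-∀)
  open import Data.Product.Base using (_×_; _,_)
  open import Data.Sum.Base using (inj₁; inj₂)
  open import Data.Vec.Base using (Vec; lookup)
  open import Function.Base using (_∘_)
  open import Relation.Binary.PropositionalEquality
  open import Relation.Nullary.Decidable using (does; ⌊_⌋)
  open import Relation.Unary using (Decidable)
  open import Algebra.Properties.Semiring.Sum +-*-semiring public
    using (sum-cong-≗; ∑-distrib-+; ∑-comm; *-distribˡ-sum; *-distribʳ-sum)
    renaming (sum to ∑)

  ⟦_⟧ : Bool → ℕ
  ⟦ false ⟧ = 0
  ⟦ true ⟧  = 1

  ⟦∧⟧ : ∀ a b → ⟦ a ∧ b ⟧ ≡ ⟦ a ⟧ * ⟦ b ⟧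
  ⟦∧⟧ false b = refl
  ⟦∧⟧ true  b = sym (*-identityˡ ⟦ b ⟧)

  ⟦⟧≤1 : ∀ b → ⟦ b ⟧ ≤ 1
  ⟦⟧≤1 false = z≤n
  ⟦⟧≤1 true  = ≤-refl

  ⟦⟧-idem : ∀ b → ⟦ b ⟧ * ⟦ b ⟧ ≡ ⟦ b ⟧
  ⟦⟧-idem false = refl
  ⟦⟧-idem true  = refl

  ∑-mono : ∀ {n} {f g : Fin n → ℕ} → (∀ i → f i ≤ g i) → ∑ f ≤ ∑ g
  ∑-mono {zero}  f≤g = z≤n
  ∑-mono {suc n} f≤g = +-mono-≤ (f≤g zero) (∑-mono (f≤g ∘ suc))

  ∑-const : ∀ n c → ∑ {n} (λ _ → c) ≡ n * c
  ∑-const zero    c = refl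
  ∑-const (suc n) c = cong (c +_) (∑-const n c)

  ∑-zero : ∀ n → ∑ {n} (λ _ → 0) ≡ 0
  ∑-zero n = trans (∑-const n 0) (*-zeroʳ n)

  ∑-bound : ∀ {n c} {f : Fin n → ℕ} → (∀ i → f i ≤ c) → ∑ f ≤ n * c
  ∑-bound {n} {c} f≤c = subst (_ ≤_) (∑-const n c) (∑-mono f≤c)

  term≤∑ : ∀ {n} (f : Fin n → ℕ) i → f i ≤ ∑ f
  term≤∑ f zero    = m≤m+n (f zero) _
  term≤∑ f (suc i) = ≤-trans (term≤∑ (f ∘ suc) i) (m≤n+m _ (f zero))

  -- In place of the square of a - b, the larger number is written as the smaller plus c; the two
  -- sides then differ by c².
  2ab≤a²+b² : ∀ a b → 2 * (a * b) ≤ a * a + b * b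
  2ab≤a²+b² a b with ≤-total a b
  ... | inj₁ a≤b = subst (λ b → 2 * (a * b) ≤ a * a + b * b) (m+[n∸m]≡n a≤b)
    (subst (2 * (a * (a + c)) ≤_) (identity a c) (m≤m+n _ (c * c)))
    where
    c = b ∸ a
    identity : ∀ a c → 2 * (a * (a + c)) + c * c ≡ a * a + (a + c) * (a + c)
    identity = solve-∀
  ... | inj₂ b≤a = subst (λ a → 2 * (a * b) ≤ a * a + b * b) (m+[n∸m]≡n b≤a)
    (subst (2 * ((b + c) * b) ≤_) (identity b c) (m≤m+n _ (c * c)))
    where
    c = a ∸ b
    identity : ∀ b c → 2 * ((b + c) * b) + c * c ≡ (b + c) * (b + c) + b * b
    identity = solve-∀

  -- Induction on the number of terms: the cross term 2aF is a sum of n terms 2 a g(i), each at most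
  -- a² + g(i)².
  cauchy-schwarz : ∀ {n} (f : Fin n → ℕ) → ∑ f * ∑ f ≤ n * ∑ (λ i → f i * f i)
  cauchy-schwarz {zero}  f = z≤n
  cauchy-schwarz {suc n} f = begin
    (a + F) * (a + F)                             ≡⟨ expand a F ⟩
    a * a + 2 * (a * F) + F * F                   ≤⟨ +-mono-≤ (+-monoʳ-≤ (a * a) cross) (cauchy-schwarz g) ⟩
    a * a + (n * (a * a) + S) + n * S             ≡⟨ collect n a S ⟩
    suc n * (a * a + S)                           ∎
    where
    open ≤-Reasoning
    a = f zero
    g = f ∘ suc
    F = ∑ g
    S = ∑ (λ i → g i * g i)
    expand : ∀ a F → (a + F) * (a + F) ≡ a * a + 2 * (a * F) + F * F
    expand = solve-∀
    collect : ∀ n a S → a * a + (n * (a * a) + S) + n * S ≡ suc n * (a * a + S)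
    collect = solve-∀
    cross : 2 * (a * F) ≤ n * (a * a) + S
    cross = begin
      2 * (a * F)                          ≡⟨ cong (2 *_) (*-distribˡ-sum a g) ⟩
      2 * ∑ (λ i → a * g i)                ≡⟨ *-distribˡ-sum 2 (λ i → a * g i) ⟩
      ∑ (λ i → 2 * (a * g i))              ≤⟨ ∑-mono (λ i → 2ab≤a²+b² a (g i)) ⟩
      ∑ (λ i → a * a + g i * g i)          ≡⟨ ∑-distrib-+ (λ _ → a * a) (λ i → g i * g i) ⟩
      ∑ {n} (λ _ → a * a) + S              ≡⟨ cong (_+ S) (∑-const n (a * a)) ⟩
      n * (a * a) + S                      ∎

  -- Splitting off the first row matches `extend`, so that sums over the pairs i < j and
  -- expectations over graphs unfold in step.
  upper : ∀ {n} → (Fin n → Fin n → ℕ) → ℕ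
  upper {zero}  f = 0
  upper {suc n} f = ∑ (λ j → f zero (suc j)) + upper (λ i j → f (suc i) (suc j))

  upper-mono : ∀ {n} {f g : Fin n → Fin n → ℕ} → (∀ i j → f i j ≤ g i j) → upper f ≤ upper g
  upper-mono {zero}  f≤g = z≤n
  upper-mono {suc n} f≤g = +-mono-≤ (∑-mono (λ j → f≤g zero (suc j))) (upper-mono (λ i j → f≤g (suc i) (suc j)))

  upper-cong : ∀ {n} {f g : Fin n → Fin n → ℕ} → (∀ i j → f i j ≡ g i j) → upper f ≡ upper g
  upper-cong {zero}  f≡g = refl
  upper-cong {suc n} f≡g = cong₂ _+_ (sum-cong-≗ (λ j → f≡g zero (suc j))) (upper-cong (λ i j → f≡g (suc i) (suc j)))

  upper-+ : ∀ {n} (f g : Fin n → Fin n → ℕ) → upper (λ i j → f i j + g i j) ≡ upper f + upper g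
  upper-+ {zero}  f g = refl
  upper-+ {suc n} f g = trans
    (cong₂ _+_ (∑-distrib-+ (λ j → f zero (suc j)) (λ j → g zero (suc j)))
      (upper-+ (λ i j → f (suc i) (suc j)) (λ i j → g (suc i) (suc j))))
    (rearrange (∑ (λ j → f zero (suc j))) _ _ _)
    where
    rearrange : ∀ a b c d → a + b + (c + d) ≡ a + c + (b + d)
    rearrange = solve-∀

  ∑∑≡diagonal+2upper : ∀ {n} (f : Fin n → Fin n → ℕ) → (∀ i j → f i j ≡ f j i) →
    ∑ (λ i → ∑ (λ j → f i j)) ≡ ∑ (λ i → f i i) + 2 * upper f
  ∑∑≡diagonal+2upper {zero}  f f-sym = refl
  ∑∑≡diagonal+2upper {suc n} f f-sym = begin
    d + r + ∑ (λ i → f (suc i) zero + ∑ (λ j → f (suc i) (suc j)))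
      ≡⟨ cong (d + r +_) (∑-distrib-+ (λ i → f (suc i) zero) (λ i → ∑ (λ j → f (suc i) (suc j)))) ⟩
    d + r + (∑ (λ i → f (suc i) zero) + ∑ (λ i → ∑ (λ j → f (suc i) (suc j))))
      ≡⟨ cong₂ (λ x y → d + r + (x + y)) (sum-cong-≗ (λ i → f-sym (suc i) zero))
           (∑∑≡diagonal+2upper (λ i j → f (suc i) (suc j)) (λ i j → f-sym (suc i) (suc j))) ⟩
    d + r + (r + (d′ + 2 * u))
      ≡⟨ rearrange d r d′ u ⟩
    d + d′ + 2 * (r + u) ∎
    where
    open ≡-Reasoning
    d = f zero zero
    d′ = ∑ (λ i → f (suc i) (suc i))
    r = ∑ (λ j → f zero (suc j))
    u = upper (λ i j → f (suc i) (suc j))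
    rearrange : ∀ d r d′ u → d + r + (r + (d′ + 2 * u)) ≡ d + d′ + 2 * (r + u)
    rearrange = solve-∀

  ∑∑≡2upper : ∀ {n} (f : Fin n → Fin n → ℕ) → (∀ i j → f i j ≡ f j i) → (∀ i → f i i ≡ 0) →
    ∑ (λ i → ∑ (λ j → f i j)) ≡ 2 * upper f
  ∑∑≡2upper {n} f f-sym f-irrefl = trans (∑∑≡diagonal+2upper f f-sym)
    (cong (_+ 2 * upper f) (trans (sum-cong-≗ f-irrefl) (∑-zero n)))

  count-∷ : ∀ {A : Set} (P : A → Bool) x xs → count P (x ∷ xs) ≡ ⟦ P x ⟧ + count P xs
  count-∷ P x xs with P x
  ... | false = refl
  ... | true  = refl

  count-++ : ∀ {A : Set} (P : A → Bool) xs ys → count P (xs ++ ys) ≡ count P xs + count P ys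
  count-++ P xs ys = trans (cong length (List.filter-++ (T? ∘ P) xs ys)) (List.length-++ (filter (T? ∘ P) xs))

  count-map : ∀ {A B : Set} (P : B → Bool) (f : A → B) xs → count P (map f xs) ≡ count (P ∘ f) xs
  count-map P f []       = refl
  count-map P f (x ∷ xs) = trans (count-∷ P (f x) (map f xs))
    (trans (cong (⟦ P (f x) ⟧ +_) (count-map P f xs)) (sym (count-∷ (P ∘ f) x xs)))

  count-tabulate : ∀ {A : Set} {n} (P : A → Bool) (f : Fin n → A) → count P (tabulate f) ≡ ∑ (λ i → ⟦ P (f i) ⟧)
  count-tabulate {n = zero}  P f = refl
  count-tabulate {n = suc n} P f = trans (count-∷ P (f zero) (tabulate (f ∘ suc)))
    (cong (⟦ P (f zero) ⟧ +_) (count-tabulate P (f ∘ suc)))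

  private module Pairs where

    filter-∷ : ∀ {A : Set} {P : A → Set} (P? : Decidable P) x xs →
      filter P? (x ∷ xs) ≡ (if does (P? x) then x ∷ filter P? xs else filter P? xs)
    filter-∷ P? x xs with does (P? x)
    ... | false = refl
    ... | true  = refl

    lt? : ∀ {n} → Decidable {A = Fin n × Fin n} (λ (i , j) → i Fin.< j)
    lt? (i , j) = i Fin.<? j

    shift : ∀ {n} → Fin n × Fin n → Fin (suc n) × Fin (suc n)
    shift (i , j) = suc i , suc j

    first-row : ∀ {n} (ys : List (Fin n)) →
      filter lt? (map (zero ,_) (map suc ys)) ≡ map (λ j → zero , suc j) ys
    first-row []       = refl
    first-row (y ∷ ys) = cong (_ ∷_) (first-row ys)

    map-if : ∀ {A B : Set} (f : A → B) b x xs →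
      (if b then f x ∷ map f xs else map f xs) ≡ map f (if b then x ∷ xs else xs)
    map-if f false x xs = refl
    map-if f true  x xs = refl

    other-row : ∀ {n} (x : Fin n) ys →
      filter lt? (map (suc x ,_) (map suc ys)) ≡ map shift (filter lt? (map (x ,_) ys))
    other-row x []       = refl
    other-row x (y ∷ ys) = begin
      filter lt? ((suc x , suc y) ∷ map (suc x ,_) (map suc ys))
        ≡⟨ filter-∷ lt? (suc x , suc y) (map (suc x ,_) (map suc ys)) ⟩
      (if b then (suc x , suc y) ∷ zs else zs)
        ≡⟨ cong (λ zs → if b then (suc x , suc y) ∷ zs else zs) (other-row x ys) ⟩
      (if b then (suc x , suc y) ∷ map shift ws else map shift ws)
        ≡⟨ map-if shift b (x , y) ws ⟩
      map shift (if b then (x , y) ∷ ws else ws)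
        ≡⟨ cong (map shift) (filter-∷ lt? (x , y) (map (x ,_) ys)) ⟨
      map shift (filter lt? ((x , y) ∷ map (x ,_) ys)) ∎
      where
      open ≡-Reasoning
      b = does (x Fin.<? y)
      zs = filter lt? (map (suc x ,_) (map suc ys))
      ws = filter lt? (map (x ,_) ys)

    other-rows : ∀ {n} (xs ys : List (Fin n)) →
      filter lt? (cartesianProduct (map suc xs) (zero ∷ map suc ys)) ≡ map shift (filter lt? (cartesianProduct xs ys))
    other-rows []       ys = refl
    other-rows (x ∷ xs) ys = begin
      filter lt? (map (suc x ,_) (map suc ys) ++ cartesianProduct (map suc xs) (zero ∷ map suc ys))
        ≡⟨ List.filter-++ lt? (map (suc x ,_) (map suc ys)) _ ⟩
      filter lt? (map (suc x ,_) (map suc ys)) ++ filter lt? (cartesianProduct (map suc xs) (zero ∷ map suc ys))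
        ≡⟨ cong₂ _++_ (other-row x ys) (other-rows xs ys) ⟩
      map shift (filter lt? (map (x ,_) ys)) ++ map shift (filter lt? (cartesianProduct xs ys))
        ≡⟨ List.map-++ shift (filter lt? (map (x ,_) ys)) _ ⟨
      map shift (filter lt? (map (x ,_) ys) ++ filter lt? (cartesianProduct xs ys))
        ≡⟨ cong (map shift) (List.filter-++ lt? (map (x ,_) ys) _) ⟨
      map shift (filter lt? (cartesianProduct (x ∷ xs) ys)) ∎
      where open ≡-Reasoning

    -- Of the new pairs, (zero, zero) and all (suc i, zero) fail the test i < j, so one full row
    -- remains besides the shifted list. Through this recursion both the edge counts and the weights
    -- of graphs are reduced to induction along `extend`.
    pairs-suc : ∀ n → pairs (suc n) ≡ map (λ j → zero , suc j) (allFin n) ++ map shift (pairs n)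
    pairs-suc n = begin
      filter lt? (map (zero ,_) (tabulate suc) ++ cartesianProduct (tabulate suc) (zero ∷ tabulate suc))
        ≡⟨ cong (λ zs → filter lt? (map (zero ,_) zs ++ cartesianProduct zs (zero ∷ zs))) (sym (List.map-tabulate (λ i → i) suc)) ⟩
      filter lt? (map (zero ,_) (map suc xs) ++ cartesianProduct (map suc xs) (zero ∷ map suc xs))
        ≡⟨ List.filter-++ lt? (map (zero ,_) (map suc xs)) _ ⟩
      filter lt? (map (zero ,_) (map suc xs)) ++ filter lt? (cartesianProduct (map suc xs) (zero ∷ map suc xs))
        ≡⟨ cong₂ _++_ (first-row xs) (other-rows xs xs) ⟩
      map (λ j → zero , suc j) xs ++ map shift (pairs n) ∎
      where
      open ≡-Reasoning
      xs = allFin n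

  open Pairs public using (pairs-suc)
  open Pairs using (shift)

  count-pairs : ∀ n (P : Fin n → Fin n → Bool) → count (λ (i , j) → P i j) (pairs n) ≡ upper (λ i j → ⟦ P i j ⟧)
  count-pairs zero    P = refl
  count-pairs (suc n) P = begin
    count P′ (pairs (suc n))
      ≡⟨ cong (count P′) (pairs-suc n) ⟩
    count P′ (map (λ j → zero , suc j) (allFin n) ++ map shift (pairs n))
      ≡⟨ count-++ P′ (map (λ j → zero , suc j) (allFin n)) _ ⟩
    count P′ (map (λ j → zero , suc j) (allFin n)) + count P′ (map shift (pairs n))
      ≡⟨ cong₂ _+_ (count-map P′ (λ j → zero , suc j) (allFin n)) (count-map P′ shift (pairs n)) ⟩
    count (λ j → P zero (suc j)) (allFin n) + count (λ (i , j) → P (suc i) (suc j)) (pairs n)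
      ≡⟨ cong₂ _+_ (count-tabulate (λ j → P zero (suc j)) (λ j → j)) (count-pairs n (λ i j → P (suc i) (suc j))) ⟩
    upper (λ i j → ⟦ P i j ⟧) ∎
    where
    open ≡-Reasoning
    P′ : Fin (suc n) × Fin (suc n) → Bool
    P′ (i , j) = P i j

  -- Every random quantity of the proof is such a count: `star v` yields a degree, `neighbours G v`
  -- the triangles at v, `sameColour φ` the monochromatic edges. `S` is read only at i < j.
  edges : ∀ {n} → (Fin n → Fin n → Bool) → Graph n → ℕ
  edges S G = upper (λ i j → ⟦ adj G i j ∧ S i j ⟧)

  size : ∀ {n} → (Fin n → Fin n → Bool) → ℕ
  size S = upper (λ i j → ⟦ S i j ⟧)

  degree≡∑ : ∀ {n} (G : Graph n) i → degree G i ≡ ∑ (λ j → ⟦ adj G i j ⟧)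
  degree≡∑ G i = count-tabulate (adj G i) (λ j → j)

  sameColour : ∀ {q n} → Vec (Fin q) n → Fin n → Fin n → Bool
  sameColour φ i j = ⌊ lookup φ i Fin.≟ lookup φ j ⌋

  monochromatic≡edges : ∀ {q n} (G : Graph n) (φ : Vec (Fin q) n) → monochromatic G φ ≡ edges (sameColour φ) G
  monochromatic≡edges {n = n} G φ = count-pairs n (λ i j → adj G i j ∧ sameColour φ i j)

  handshake : ∀ {n} (G : Graph n) → ∑ (degree G) ≡ 2 * edgeCount G
  handshake {n} G = begin
    ∑ (degree G)                              ≡⟨ sum-cong-≗ (degree≡∑ G) ⟩
    ∑ (λ i → ∑ (λ j → ⟦ adj G i j ⟧))         ≡⟨ ∑∑≡2upper (λ i j → ⟦ adj G i j ⟧) (λ i j → cong ⟦_⟧ (adj-sym G i j)) (λ i → cong ⟦_⟧ (adj-irrefl G i)) ⟩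
    2 * upper (λ i j → ⟦ adj G i j ⟧)         ≡⟨ cong (2 *_) (count-pairs n (adj G)) ⟨
    2 * edgeCount G                           ∎
    where open ≡-Reasoning

-- Deleting every edge that lies in a triangle.

module TriangleDeletion where

  open import Defs hiding (_+_; _*_; _≤_; _<_; _-_; -_; ∣_∣; _^_)
  open Counting
  open import Data.Bool.Base using (Bool; true; false; _∧_; T)
  open import Data.Bool.Properties using (∧-comm; ∧-identityʳ; ∧-zeroʳ; T-∧)
  open import Data.Empty using (⊥-elim)
  open import Data.Fin.Base as Fin using (Fin; zero; suc)
  import Data.Fin.Properties as Fin
  open import Data.List.Base using (List; []; _∷_; map; allFin)
  open import Data.List.Extrema.Nat using (min≤xs; min≤⊤; v≤min⁺)
  open import Data.List.Membership.Propositional using (_∈_)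
  open import Data.List.Membership.Propositional.Properties using (∈-map⁺; ∈-allFin; ∈-cartesianProductWith⁺)
  open import Data.List.Relation.Unary.All as All using (All)
  import Data.List.Relation.Unary.All.Properties as All
  open import Data.List.Relation.Unary.Any using (here)
  open import Data.Nat.Base
  open import Data.Nat.Properties
  open import Data.Product.Base using (∃; _×_; _,_; proj₁; proj₂)
  open import Data.Sum.Base using (inj₁; inj₂)
  open import Data.Vec.Base using (Vec; []; _∷_; lookup)
  open import Function.Base using (_∘_)
  open import Function.Bundles using (Equivalence)
  open import Relation.Binary.PropositionalEquality
  open import Relation.Nullary using (¬_; yes; no)
  open import Relation.Nullary.Decidable using (⌊_⌋)

  ⟦∧⟧≤ : ∀ a b → ⟦ a ∧ b ⟧ ≤ ⟦ a ⟧
  ⟦∧⟧≤ false b = z≤n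
  ⟦∧⟧≤ true  b = ⟦⟧≤1 b

  codegree : ∀ {n} → Graph n → Fin n → Fin n → ℕ
  codegree G i j = ∑ (λ k → ⟦ adj G i k ∧ adj G j k ⟧)

  codegree-sym : ∀ {n} (G : Graph n) i j → codegree G i j ≡ codegree G j i
  codegree-sym G i j = sum-cong-≗ (λ k → cong ⟦_⟧ (∧-comm (adj G i k) (adj G j k)))

  private
    -- The common neighbours of adjacent i and j are the third vertices of the triangles on ij.
    survives : ∀ {n} → Graph n → Fin n → Fin n → Bool
    survives G i j = adj G i j ∧ (codegree G i j ≡ᵇ 0)

  deleteTriangles : ∀ {n} → Graph n → Graph n
  deleteTriangles G = fromRelation (survives G)

  neighbours : ∀ {n} → Graph n → Fin n → Fin n → Fin n → Bool
  neighbours G v j k = adj G v j ∧ adj G v k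

  module _ {n} (G : Graph n) where

    private
      H : Graph n
      H = deleteTriangles G

    adj-deleteTriangles : ∀ i j → adj H i j ≡ survives G i j
    adj-deleteTriangles = adj-fromRelation (survives G)
      (λ i j → cong₂ (λ a c → a ∧ (c ≡ᵇ 0)) (adj-sym G i j) (codegree-sym G i j))
      (λ i → cong (_∧ (codegree G i i ≡ᵇ 0)) (adj-irrefl G i))

    deleteTriangles-edge : ∀ i j → Adj H i j → Adj G i j × codegree G i j ≡ 0
    deleteTriangles-edge i j h =
      let (a , c) = Equivalence.to T-∧ (subst T (adj-deleteTriangles i j) h)
      in a , ≡ᵇ⇒≡ (codegree G i j) 0 c

    deleteTriangles-⊆ : H ⊆ G
    deleteTriangles-⊆ i j h = proj₁ (deleteTriangles-edge i j h)

    deleteTriangles-triangleFree : TriangleFree H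
    deleteTriangles-triangleFree i j k (ij , jk , ik) =
      absurd (Equivalence.from T-∧ (deleteTriangles-⊆ i k ik , deleteTriangles-⊆ j k jk))
        (≤-trans (term≤∑ (λ k → ⟦ adj G i k ∧ adj G j k ⟧) k) (≤-reflexive (proj₂ (deleteTriangles-edge i j ij))))
      where
      absurd : ∀ {b} → T b → ¬ ⟦ b ⟧ ≤ 0
      absurd {true} _ ()

    private
      -- The number of triangles on the edge ij. It dominates the indicator that ij is deleted and,
      -- unlike the indicator, sums exactly to counts of edges in neighbourhoods.
      lost : Fin n → Fin n → ℕ
      lost i j = ⟦ adj G i j ⟧ * codegree G i j

      lost-sym : ∀ i j → lost i j ≡ lost j i
      lost-sym i j = cong₂ (λ a c → ⟦ a ⟧ * c) (adj-sym G i j) (codegree-sym G i j)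

      survives-or-lost : ∀ a s c → ⟦ a ∧ s ⟧ ≤ ⟦ (a ∧ (c ≡ᵇ 0)) ∧ s ⟧ + ⟦ a ⟧ * c
      survives-or-lost false s c       = z≤n
      survives-or-lost true  s zero    = m≤m+n ⟦ s ⟧ 0
      survives-or-lost true  s (suc c) = ≤-trans (⟦⟧≤1 s) (s≤s z≤n)

      -- A pair (j, k) for which ij, ik and jk are edges is an edge inside the neighbourhood of i
      -- with an orientation, whence the factor 2.
      ∑-lost : ∀ i → ∑ (lost i) ≡ 2 * edges (neighbours G i) G
      ∑-lost i = begin
        ∑ (λ j → ⟦ adj G i j ⟧ * codegree G i j)
          ≡⟨ sum-cong-≗ (λ j → *-distribˡ-sum ⟦ adj G i j ⟧ (λ k → ⟦ adj G i k ∧ adj G j k ⟧)) ⟩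
        ∑ (λ j → ∑ (λ k → ⟦ adj G i j ⟧ * ⟦ adj G i k ∧ adj G j k ⟧))
          ≡⟨ sum-cong-≗ (λ j → sum-cong-≗ (λ k → regroup (adj G i j) (adj G i k) (adj G j k))) ⟩
        ∑ (λ j → ∑ (λ k → ⟦ adj G j k ∧ neighbours G i j k ⟧))
          ≡⟨ ∑∑≡2upper (λ j k → ⟦ adj G j k ∧ neighbours G i j k ⟧)
               (λ j k → cong₂ (λ a b → ⟦ a ∧ b ⟧) (adj-sym G j k) (∧-comm (adj G i j) (adj G i k)))
               (λ j → cong (λ a → ⟦ a ∧ neighbours G i j j ⟧) (adj-irrefl G j)) ⟩
        2 * edges (neighbours G i) G ∎
        where
        open ≡-Reasoning
        regroup : ∀ a b c → ⟦ a ⟧ * ⟦ b ∧ c ⟧ ≡ ⟦ c ∧ (a ∧ b) ⟧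
        regroup false false false = refl
        regroup false false true  = refl
        regroup false true  false = refl
        regroup false true  true  = refl
        regroup true  false false = refl
        regroup true  false true  = refl
        regroup true  true  false = refl
        regroup true  true  true  = refl

    degree-deleteTriangles : ∀ i → degree G i ≤ degree H i + 2 * edges (neighbours G i) G
    degree-deleteTriangles i = begin
      degree G i                                        ≡⟨ degree≡∑ G i ⟩
      ∑ (λ j → ⟦ adj G i j ⟧)                           ≤⟨ ∑-mono (λ j → bound j) ⟩
      ∑ (λ j → ⟦ adj H i j ⟧ + lost i j)                ≡⟨ ∑-distrib-+ (λ j → ⟦ adj H i j ⟧) (lost i) ⟩
      ∑ (λ j → ⟦ adj H i j ⟧) + ∑ (lost i)              ≡⟨ cong₂ _+_ (sym (degree≡∑ H i)) (∑-lost i) ⟩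
      degree H i + 2 * edges (neighbours G i) G         ∎
      where
      open ≤-Reasoning
      bound : ∀ j → ⟦ adj G i j ⟧ ≤ ⟦ adj H i j ⟧ + lost i j
      bound j = subst₂ (λ a b → ⟦ a ⟧ ≤ ⟦ b ⟧ + lost i j)
        (∧-identityʳ (adj G i j)) (trans (∧-identityʳ (survives G i j)) (sym (adj-deleteTriangles i j)))
        (survives-or-lost (adj G i j) true (codegree G i j))

    -- Both `upper lost` and the sum of the e(N(i)) count each triangle three times, once per edge
    -- and once per vertex respectively. The proof compares their doubles, since `∑-lost` speaks of
    -- ordered pairs.
    edges-deleteTriangles : ∀ S → edges S G ≤ edges S H + ∑ (λ i → edges (neighbours G i) G)
    edges-deleteTriangles S = begin
      edges S G                                                 ≤⟨ upper-mono bound ⟩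
      upper (λ i j → ⟦ adj H i j ∧ S i j ⟧ + lost i j)          ≡⟨ upper-+ (λ i j → ⟦ adj H i j ∧ S i j ⟧) lost ⟩
      edges S H + upper lost                                    ≡⟨ cong (edges S H +_) (*-cancelˡ-≡ _ _ 2 double) ⟩
      edges S H + ∑ (λ i → edges (neighbours G i) G)            ∎
      where
      open ≤-Reasoning
      bound : ∀ i j → ⟦ adj G i j ∧ S i j ⟧ ≤ ⟦ adj H i j ∧ S i j ⟧ + lost i j
      bound i j = subst (λ a → ⟦ adj G i j ∧ S i j ⟧ ≤ ⟦ a ∧ S i j ⟧ + lost i j)
        (sym (adj-deleteTriangles i j)) (survives-or-lost (adj G i j) (S i j) (codegree G i j))
      double : 2 * upper lost ≡ 2 * ∑ (λ i → edges (neighbours G i) G)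
      double = trans (sym (∑∑≡2upper lost lost-sym (λ i → cong (λ a → ⟦ a ⟧ * codegree G i i) (adj-irrefl G i))))
        (trans (sum-cong-≗ ∑-lost) (sym (*-distribˡ-sum 2 (λ i → edges (neighbours G i) G))))

    edgeCount-deleteTriangles : edgeCount H ≤ edgeCount G
    edgeCount-deleteTriangles = subst₂ _≤_ (sym (count-pairs n (adj H))) (sym (count-pairs n (adj G)))
      (upper-mono (λ i j → subst (λ a → ⟦ a ⟧ ≤ ⟦ adj G i j ⟧) (sym (adj-deleteTriangles i j))
        (⟦∧⟧≤ (adj G i j) (codegree G i j ≡ᵇ 0))))

  -- Minimum degree, `del` and colourings.

  ≤δ : ∀ {n c} (G : Graph n) → 1 ≤ n → (∀ v → c ≤ degree G v) → c ≤ δ G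
  ≤δ {suc n} G _ h = v≤min⁺ (h zero) (All.map⁺ (All.universal h (allFin (suc n))))

  δ≤ : ∀ {n c} (G : Graph n) → 1 ≤ n → (∀ v → degree G v ≤ c) → δ G ≤ c
  δ≤ {suc n} G _ h = ≤-trans (min≤⊤ (degree G zero) (map (degree G) (allFin (suc n)))) (h zero)

  ∈-allVecs : ∀ {q n} (φ : Vec (Fin q) n) → φ ∈ allVecs (allFin q) n
  ∈-allVecs []      = here refl
  ∈-allVecs (c ∷ φ) = ∈-cartesianProductWith⁺ _∷_ (∈-allFin c) (∈-allVecs φ)

  del≤monochromatic : ∀ {q n} (G : Graph n) (φ : Vec (Fin q) n) → del q G ≤ monochromatic G φ
  del≤monochromatic G φ = All.lookup (min≤xs (edgeCount G) _) (∈-map⁺ (monochromatic G) (∈-allVecs φ))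

  -- The minimum in `del` starts from `edgeCount G`. The constant colouring, which exists because q
  -- ≥ 1, shows that this starting value respects the bound as well.
  ≤del : ∀ {q n c} (G : Graph n) → 1 ≤ q → (∀ (φ : Vec (Fin q) n) → c ≤ monochromatic G φ) → c ≤ del q G
  ≤del {suc q} {n} {c} G _ h = v≤min⁺ (≤-trans (h constant) mono≤edgeCount) (All.map⁺ (All.universal h (allVecs (allFin (suc q)) n)))
    where
    constant : ∀ {n} → Vec (Fin (suc q)) n
    constant {zero}  = []
    constant {suc n} = zero ∷ constant
    mono≤edgeCount : monochromatic G constant ≤ edgeCount G
    mono≤edgeCount = subst₂ _≤_ (sym (monochromatic≡edges G constant)) (sym (count-pairs n (adj G)))
      (upper-mono (λ i j → ⟦∧⟧≤ (adj G i j) (sameColour constant i j)))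

  ≟-sym : ∀ {n} (x y : Fin n) → ⌊ x Fin.≟ y ⌋ ≡ ⌊ y Fin.≟ x ⌋
  ≟-sym x y with x Fin.≟ y | y Fin.≟ x
  ... | yes _    | yes _   = refl
  ... | no  _    | no  _   = refl
  ... | yes x≡y  | no y≢x  = ⊥-elim (y≢x (sym x≡y))
  ... | no x≢y   | yes y≡x = ⊥-elim (x≢y (sym y≡x))

  suc≟suc : ∀ {n} (x c : Fin n) → ⌊ suc x Fin.≟ suc c ⌋ ≡ ⌊ x Fin.≟ c ⌋
  suc≟suc x c with x Fin.≟ c
  ... | yes _ = refl
  ... | no  _ = refl

  ∑-≟ : ∀ {q} (x : Fin q) → ∑ (λ c → ⟦ ⌊ x Fin.≟ c ⌋ ⟧) ≡ 1
  ∑-≟ {suc q} zero = cong suc (∑-zero q)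
  ∑-≟ {suc q} (suc x) = trans (sum-cong-≗ (λ c → cong ⟦_⟧ (suc≟suc x c))) (∑-≟ x)

  ∑-select : ∀ {q} (f : Fin q → Bool) x → ∑ (λ c → ⟦ f c ∧ ⌊ x Fin.≟ c ⌋ ⟧) ≡ ⟦ f x ⟧
  ∑-select {suc q} f zero    = trans (cong₂ _+_ (cong ⟦_⟧ (∧-identityʳ (f zero)))
    (trans (sum-cong-≗ (λ c → cong ⟦_⟧ (∧-zeroʳ (f (suc c))))) (∑-zero q))) (+-identityʳ ⟦ f zero ⟧)
  ∑-select {suc q} f (suc x) = trans
    (cong₂ _+_ (cong ⟦_⟧ (∧-zeroʳ (f zero))) (sum-cong-≗ (λ c → cong (λ b → ⟦ f (suc c) ∧ b ⟧) (suc≟suc x c))))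
    (∑-select (f ∘ suc) x)

  below-average : ∀ {q} (f : Fin (suc q) → ℕ) → ∃ λ c → suc q * f c ≤ ∑ f
  below-average {zero}  f = zero , ≤-refl
  below-average {suc q} f with below-average (f ∘ suc)
  ... | c , h with ≤-total (f zero) (f (suc c))
  ... | inj₁ f0≤fc = zero , +-monoʳ-≤ (f zero) (≤-trans (*-monoʳ-≤ (suc q) f0≤fc) h)
  ... | inj₂ fc≤f0 = suc c , +-mono-≤ fc≤f0 h

  -- The new vertex takes a colour used at most averagely often among its neighbours, all of them
  -- already coloured. At most a share of 1/(q + 1) of its edges becomes monochromatic, and
  -- induction adds up these shares.
  greedy-colouring : ∀ {q n} (G : Graph n) → ∃ λ (φ : Vec (Fin (suc q)) n) →
    suc q * edges (sameColour φ) G ≤ upper (λ i j → ⟦ adj G i j ⟧)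
  greedy-colouring {q} empty = [] , ≤-reflexive (*-zeroʳ (suc q))
  greedy-colouring {q} (extend {n} v G) =
    let (φ , hφ) = greedy-colouring G
        f        = λ c → ∑ (λ j → ⟦ lookup v j ∧ ⌊ lookup φ j Fin.≟ c ⌋ ⟧)
        (c , hc) = below-average f
    in c ∷ φ , (begin
      suc q * (∑ (λ j → ⟦ lookup v j ∧ ⌊ c Fin.≟ lookup φ j ⌋ ⟧) + edges (sameColour φ) G)
        ≡⟨ *-distribˡ-+ (suc q) (∑ (λ j → ⟦ lookup v j ∧ ⌊ c Fin.≟ lookup φ j ⌋ ⟧)) _ ⟩
      suc q * ∑ (λ j → ⟦ lookup v j ∧ ⌊ c Fin.≟ lookup φ j ⌋ ⟧) + suc q * edges (sameColour φ) G
        ≡⟨ cong (λ s → suc q * s + suc q * edges (sameColour φ) G)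
             (sum-cong-≗ (λ j → cong (λ b → ⟦ lookup v j ∧ b ⟧) (≟-sym c (lookup φ j)))) ⟩
      suc q * f c + suc q * edges (sameColour φ) G
        ≤⟨ +-mono-≤ hc hφ ⟩
      ∑ f + upper (λ i j → ⟦ adj G i j ⟧)
        ≡⟨ cong (_+ upper (λ i j → ⟦ adj G i j ⟧)) (total φ) ⟩
      ∑ (λ j → ⟦ lookup v j ⟧) + upper (λ i j → ⟦ adj G i j ⟧) ∎)
    where
    open ≤-Reasoning
    total : (φ : Vec (Fin (suc q)) n) →
      ∑ (λ c → ∑ (λ j → ⟦ lookup v j ∧ ⌊ lookup φ j Fin.≟ c ⌋ ⟧)) ≡ ∑ (λ j → ⟦ lookup v j ⟧)
    total φ = trans (∑-comm (λ c j → ⟦ lookup v j ∧ ⌊ lookup φ j Fin.≟ c ⌋ ⟧)) (sum-cong-≗ λ j →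
      trans (sum-cong-≗ (λ c → ⟦∧⟧ (lookup v j) ⌊ lookup φ j Fin.≟ c ⌋))
        (trans (sym (*-distribˡ-sum ⟦ lookup v j ⟧ (λ c → ⟦ ⌊ lookup φ j Fin.≟ c ⌋ ⟧)))
          (trans (cong (⟦ lookup v j ⟧ *_) (∑-≟ (lookup φ j))) (*-identityʳ _))))

  q*del≤edgeCount : ∀ {q n} (G : Graph n) → 1 ≤ q → q * del q G ≤ edgeCount G
  q*del≤edgeCount {suc q} {n} G _ =
    let (φ , h) = greedy-colouring G
    in ≤-trans (*-monoʳ-≤ (suc q) (≤-trans (del≤monochromatic G φ) (≤-reflexive (monochromatic≡edges G φ))))
         (≤-trans h (≤-reflexive (sym (count-pairs n (adj G)))))

  -- The squares of the class sizes add up to the number of ordered pairs of equal colour, n of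
  -- which lie on the diagonal; Cauchy-Schwarz is applied to the q classes. Rearranged, at least n(n
  -- - q)/2q unordered pairs are monochromatic.
  size-sameColour : ∀ {q n} (φ : Vec (Fin q) n) → n * n ≤ q * (n + 2 * size (sameColour φ))
  size-sameColour {q} {n} φ = begin
    n * n                                            ≡⟨ cong₂ _*_ total total ⟨
    ∑ class * ∑ class                                ≤⟨ cauchy-schwarz class ⟩
    q * ∑ (λ c → class c * class c)                  ≡⟨ cong (q *_) squares ⟩
    q * (n + 2 * size (sameColour φ))                ∎
    where
    open ≤-Reasoning
    χ : Fin n → Fin q → ℕ
    χ i c = ⟦ ⌊ lookup φ i Fin.≟ c ⌋ ⟧
    class : Fin q → ℕ
    class c = ∑ (λ i → χ i c)
    total : ∑ class ≡ n
    total = trans (∑-comm (λ c i → χ i c)) (trans (sum-cong-≗ (λ i → ∑-≟ (lookup φ i)))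
      (trans (∑-const n 1) (*-identityʳ n)))
    ∑-χχ : ∀ {q} (x y : Fin q) → ∑ (λ c → ⟦ ⌊ x Fin.≟ c ⌋ ⟧ * ⟦ ⌊ y Fin.≟ c ⌋ ⟧) ≡ ⟦ ⌊ x Fin.≟ y ⌋ ⟧
    ∑-χχ {q} x y with x Fin.≟ y
    ... | yes refl = trans (sum-cong-≗ (λ c → ⟦⟧-idem ⌊ x Fin.≟ c ⌋)) (∑-≟ x)
    ... | no x≢y   = trans (sum-cong-≗ disjoint) (∑-zero q)
      where
      disjoint : ∀ c → ⟦ ⌊ x Fin.≟ c ⌋ ⟧ * ⟦ ⌊ y Fin.≟ c ⌋ ⟧ ≡ 0
      disjoint c with x Fin.≟ c | y Fin.≟ c
      ... | no  _   | _       = refl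
      ... | yes _   | no  _   = refl
      ... | yes x≡c | yes y≡c = ⊥-elim (x≢y (trans x≡c (sym y≡c)))
    ≟-refl : ∀ {n} (x : Fin n) → ⟦ ⌊ x Fin.≟ x ⌋ ⟧ ≡ 1
    ≟-refl x with x Fin.≟ x
    ... | yes _   = refl
    ... | no  x≢x = ⊥-elim (x≢x refl)
    squares : ∑ (λ c → class c * class c) ≡ n + 2 * size (sameColour φ)
    squares = begin-equality
      ∑ (λ c → class c * class c)
        ≡⟨ sum-cong-≗ (λ c → trans (*-distribʳ-sum (class c) (λ i → χ i c))
             (sum-cong-≗ (λ i → *-distribˡ-sum (χ i c) (λ j → χ j c)))) ⟩
      ∑ (λ c → ∑ (λ i → ∑ (λ j → χ i c * χ j c)))
        ≡⟨ ∑-comm (λ c i → ∑ (λ j → χ i c * χ j c)) ⟩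
      ∑ (λ i → ∑ (λ c → ∑ (λ j → χ i c * χ j c)))
        ≡⟨ sum-cong-≗ (λ i → ∑-comm (λ c j → χ i c * χ j c)) ⟩
      ∑ (λ i → ∑ (λ j → ∑ (λ c → χ i c * χ j c)))
        ≡⟨ sum-cong-≗ (λ i → sum-cong-≗ (λ j → ∑-χχ (lookup φ i) (lookup φ j))) ⟩
      ∑ (λ i → ∑ (λ j → ⟦ sameColour φ i j ⟧))
        ≡⟨ ∑∑≡diagonal+2upper (λ i j → ⟦ sameColour φ i j ⟧) (λ i j → cong ⟦_⟧ (≟-sym (lookup φ i) (lookup φ j))) ⟩
      ∑ (λ i → ⟦ sameColour φ i i ⟧) + 2 * size (sameColour φ)
        ≡⟨ cong (_+ 2 * size (sameColour φ)) (trans (sum-cong-≗ (λ i → ≟-refl (lookup φ i)))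
             (trans (∑-const n 1) (*-identityʳ n))) ⟩
      n + 2 * size (sameColour φ) ∎

-- Expectation and probability over G(n, r) for rational r.

module RandomGraphs where

  open import Defs hiding (_+_; _*_; _≤_; _<_; _-_; -_; ∣_∣)
  open Rationals
  open Counting using (⟦_⟧; ∑; edges; size; pairs-suc)
  open import Data.Bool.Base using (Bool; true; false; if_then_else_; _∧_; _∨_)
  open import Data.Bool.ListAction using (any)
  open import Data.Empty using (⊥-elim)
  open import Data.Fin.Base using (Fin; zero; suc)
  open import Data.List.Base using (List; []; _∷_; _++_; map; foldr; length; allFin; tabulate; cartesianProductWith)
  import Data.List.Properties as List
  open import Data.Nat.Base as ℕ using (ℕ; zero; suc)
  import Data.Nat.Properties as ℕ
  open import Data.Product.Base using (_×_; _,_)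
  open import Data.Rational.Base
  import Data.Rational.Properties as ℚ
  open import Data.Rational.Solver using (module +-*-Solver)
  open import Data.Vec.Base using (Vec; []; _∷_; lookup; _[_]≔_)
  open import Data.Vec.Properties using (lookup∘update; lookup∘update′)
  open import Function.Base using (_∘_)
  open import Relation.Binary.PropositionalEquality
  open +-*-Solver using (solve; _:=_; _:+_; _:*_; _:-_; :-_; con)

  indicator : Bool → ℚ
  indicator b = if b then 1ℚ else 0ℚ

  indicator-nonNeg : ∀ b → 0ℚ ≤ indicator b
  indicator-nonNeg false = ℚ.≤-refl
  indicator-nonNeg true  = 0≤1

  indicator≤1 : ∀ b → indicator b ≤ 1ℚ
  indicator≤1 false = 0≤1
  indicator≤1 true  = ℚ.≤-refl

  indicator-∨ : ∀ a b → indicator (a ∨ b) ≤ indicator a + indicator b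
  indicator-∨ false b = ℚ.≤-reflexive (sym (ℚ.+-identityˡ (indicator b)))
  indicator-∨ true  b = ≤-+-nonNeg 1ℚ (indicator b) (indicator-nonNeg b)

  -- mergeStar v G G′ takes the edges at v from G and all others from G′.
  mergeStar : ∀ {n} → Fin n → Graph n → Graph n → Graph n
  mergeStar zero    (extend w G) (extend w′ G′) = extend w G′
  mergeStar (suc v) (extend w G) (extend w′ G′) = extend (w′ [ v ]≔ lookup w v) (mergeStar v G G′)

  adj-mergeStar-at : ∀ {n} (v : Fin n) G G′ j → adj (mergeStar v G G′) v j ≡ adj G v j
  adj-mergeStar-at zero    (extend w G) (extend w′ G′) zero    = refl
  adj-mergeStar-at zero    (extend w G) (extend w′ G′) (suc j) = refl
  adj-mergeStar-at (suc v) (extend w G) (extend w′ G′) zero    = lookup∘update v w′ (lookup w v)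
  adj-mergeStar-at (suc v) (extend w G) (extend w′ G′) (suc j) = adj-mergeStar-at v G G′ j

  adj-mergeStar-off : ∀ {n} (v : Fin n) G G′ i j → i ≢ v → j ≢ v → adj (mergeStar v G G′) i j ≡ adj G′ i j
  adj-mergeStar-off zero    (extend w G) (extend w′ G′) zero    j       i≢v j≢v = ⊥-elim (i≢v refl)
  adj-mergeStar-off zero    (extend w G) (extend w′ G′) (suc i) zero    i≢v j≢v = ⊥-elim (j≢v refl)
  adj-mergeStar-off zero    (extend w G) (extend w′ G′) (suc i) (suc j) i≢v j≢v = refl
  adj-mergeStar-off (suc v) (extend w G) (extend w′ G′) zero    zero    i≢v j≢v = refl
  adj-mergeStar-off (suc v) (extend w G) (extend w′ G′) zero    (suc j) i≢v j≢v =
    lookup∘update′ (j≢v ∘ cong suc) w′ (lookup w v)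
  adj-mergeStar-off (suc v) (extend w G) (extend w′ G′) (suc i) zero    i≢v j≢v =
    lookup∘update′ (i≢v ∘ cong suc) w′ (lookup w v)
  adj-mergeStar-off (suc v) (extend w G) (extend w′ G′) (suc i) (suc j) i≢v j≢v =
    adj-mergeStar-off v G G′ i j (i≢v ∘ cong suc) (j≢v ∘ cong suc)

  module Expectation (r : ℚ) where

    -- Expectation by recursion on the coordinates rather than as a weighted sum, so that
    -- independence is mere nesting; `EG≡∑ᴸ` identifies the two. The identities that follow are
    -- polynomial in r, and 0 ≤ r ≤ 1 enters with `Monotone`.
    EV : ∀ {n} → (Vec Bool n → ℚ) → ℚ
    EV {zero}  f = f []
    EV {suc n} f = (1ℚ - r) * EV (f ∘ (false ∷_)) + r * EV (f ∘ (true ∷_))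

    EG : ∀ {n} → (Graph n → ℚ) → ℚ
    EG {zero}  f = f empty
    EG {suc n} f = EV (λ v → EG (f ∘ extend v))

    prob : ∀ {n} → (Graph n → Bool) → ℚ
    prob P = EG (indicator ∘ P)

    EV-cong : ∀ {n} {f g : Vec Bool n → ℚ} → (∀ v → f v ≡ g v) → EV f ≡ EV g
    EV-cong {zero}  f≡g = f≡g []
    EV-cong {suc n} f≡g = cong₂ (λ x y → (1ℚ - r) * x + r * y)
      (EV-cong (λ v → f≡g (false ∷ v))) (EV-cong (λ v → f≡g (true ∷ v)))

    EV-+ : ∀ {n} (f g : Vec Bool n → ℚ) → EV (λ v → f v + g v) ≡ EV f + EV g
    EV-+ {zero}  f g = refl
    EV-+ {suc n} f g = trans
      (cong₂ (λ x y → (1ℚ - r) * x + r * y) (EV-+ (f ∘ (false ∷_)) (g ∘ (false ∷_))) (EV-+ (f ∘ (true ∷_)) (g ∘ (true ∷_))))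
      (solve 6 (λ s r a b c d → s :* (a :+ b) :+ r :* (c :+ d) := s :* a :+ r :* c :+ (s :* b :+ r :* d)) refl
        (1ℚ - r) r (EV (f ∘ (false ∷_))) (EV (g ∘ (false ∷_))) (EV (f ∘ (true ∷_))) (EV (g ∘ (true ∷_))))

    EV-* : ∀ {n} c (f : Vec Bool n → ℚ) → EV (λ v → c * f v) ≡ c * EV f
    EV-* {zero}  c f = refl
    EV-* {suc n} c f = trans
      (cong₂ (λ x y → (1ℚ - r) * x + r * y) (EV-* c (f ∘ (false ∷_))) (EV-* c (f ∘ (true ∷_))))
      (solve 5 (λ s r c a b → s :* (c :* a) :+ r :* (c :* b) := c :* (s :* a :+ r :* b)) refl
        (1ℚ - r) r c (EV (f ∘ (false ∷_))) (EV (f ∘ (true ∷_))))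

    average : ∀ c → (1ℚ - r) * c + r * c ≡ c
    average c = solve 2 (λ r c → (con 1ℚ :- r) :* c :+ r :* c := c) refl r c

    EV-const : ∀ {n} c → EV {n} (λ _ → c) ≡ c
    EV-const {zero}  c = refl
    EV-const {suc n} c = trans (average (EV {n} (λ _ → c))) (EV-const {n} c)

    EG-cong : ∀ {n} {f g : Graph n → ℚ} → (∀ G → f G ≡ g G) → EG f ≡ EG g
    EG-cong {zero}  f≡g = f≡g empty
    EG-cong {suc n} f≡g = EV-cong (λ v → EG-cong (λ G → f≡g (extend v G)))

    EG-+ : ∀ {n} (f g : Graph n → ℚ) → EG (λ G → f G + g G) ≡ EG f + EG g
    EG-+ {zero}  f g = refl
    EG-+ {suc n} f g = trans (EV-cong (λ v → EG-+ (f ∘ extend v) (g ∘ extend v)))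
      (EV-+ (λ v → EG (f ∘ extend v)) (λ v → EG (g ∘ extend v)))

    EG-* : ∀ {n} c (f : Graph n → ℚ) → EG (λ G → c * f G) ≡ c * EG f
    EG-* {zero}  c f = refl
    EG-* {suc n} c f = trans (EV-cong (λ v → EG-* c (f ∘ extend v))) (EV-* c (λ v → EG (f ∘ extend v)))

    EG-const : ∀ {n} c → EG {n} (λ _ → c) ≡ c
    EG-const {zero}  c = refl
    EG-const {suc n} c = trans (EV-cong {n} (λ v → EG-const {n} c)) (EV-const {n} c)

    EG-EV-swap : ∀ {m n} (F : Graph m → Vec Bool n → ℚ) →
      EG (λ G → EV (F G)) ≡ EV (λ w → EG (λ G → F G w))
    EG-EV-swap {n = zero}  F = refl
    EG-EV-swap {m} {suc n} F = begin
      EG (λ G → (1ℚ - r) * F₀ G + r * F₁ G)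
        ≡⟨ EG-+ (λ G → (1ℚ - r) * F₀ G) (λ G → r * F₁ G) ⟩
      EG (λ G → (1ℚ - r) * F₀ G) + EG (λ G → r * F₁ G)
        ≡⟨ cong₂ _+_ (EG-* (1ℚ - r) F₀) (EG-* r F₁) ⟩
      (1ℚ - r) * EG F₀ + r * EG F₁
        ≡⟨ cong₂ (λ x y → (1ℚ - r) * x + r * y)
             (EG-EV-swap (λ G w → F G (false ∷ w))) (EG-EV-swap (λ G w → F G (true ∷ w))) ⟩
      EV (λ w → EG (λ G → F G w)) ∎
      where
      open ≡-Reasoning
      F₀ F₁ : Graph m → ℚ
      F₀ G = EV (λ w → F G (false ∷ w))
      F₁ G = EV (λ w → F G (true ∷ w))

    -- Overwriting entry i by an independent copy of itself does not change the law of a vector of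
    -- independent bits. Entry i of w′ and all other entries of w average out.
    EV-resample : ∀ {n} (i : Fin n) (F : Vec Bool n → ℚ) →
      EV (λ w → EV (λ w′ → F (w′ [ i ]≔ lookup w i))) ≡ EV F
    EV-resample {suc n} zero F = cong₂ (λ x y → (1ℚ - r) * x + r * y) (fresh false) (fresh true)
      where
      fresh : ∀ x → EV {n} (λ w → (1ℚ - r) * EV (F ∘ (x ∷_)) + r * EV (F ∘ (x ∷_))) ≡ EV (F ∘ (x ∷_))
      fresh x = trans (EV-const {n} _) (average (EV (F ∘ (x ∷_))))
    EV-resample {suc n} (suc i) F = begin
      (1ℚ - r) * B + r * B
        ≡⟨ average B ⟩
      EV (λ w → (1ℚ - r) * F₀ w + r * F₁ w)
        ≡⟨ EV-+ (λ w → (1ℚ - r) * F₀ w) (λ w → r * F₁ w) ⟩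
      EV (λ w → (1ℚ - r) * F₀ w) + EV (λ w → r * F₁ w)
        ≡⟨ cong₂ _+_ (EV-* (1ℚ - r) F₀) (EV-* r F₁) ⟩
      (1ℚ - r) * EV F₀ + r * EV F₁
        ≡⟨ cong₂ (λ x y → (1ℚ - r) * x + r * y) (EV-resample i (F ∘ (false ∷_))) (EV-resample i (F ∘ (true ∷_))) ⟩
      EV F ∎
      where
      open ≡-Reasoning
      F₀ F₁ : Vec Bool n → ℚ
      F₀ w = EV (λ w′ → F (false ∷ (w′ [ i ]≔ lookup w i)))
      F₁ w = EV (λ w′ → F (true ∷ (w′ [ i ]≔ lookup w i)))
      B = EV (λ w → (1ℚ - r) * F₀ w + r * F₁ w)

    -- The star of v is independent of the other edges. This is what allows N(v) to be held fixed
    -- while the edges inside it are still random.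
    EG-resample : ∀ {n} (v : Fin n) (f : Graph n → ℚ) →
      EG (λ G → EG (λ G′ → f (mergeStar v G G′))) ≡ EG f
    EG-resample {suc n} zero f = EV-cong λ w →
      trans (EG-cong {n} (λ _ → EV-const {n} (EG (f ∘ extend w)))) (EG-const {n} (EG (f ∘ extend w)))
    EG-resample {suc n} (suc v) f = begin
      EV (λ w → EG (λ G → EV (λ w′ → Φ G (w′ [ v ]≔ lookup w v))))
        -- Only entry v of the first row belongs to the star of `suc v`. The swap puts the two
        -- copies of this row next to each other, where `EV-resample` applies; the remaining rows
        -- are left to induction.
        ≡⟨ EV-cong (λ w → EG-EV-swap (λ G w′ → Φ G (w′ [ v ]≔ lookup w v))) ⟩
      EV (λ w → EV (λ w′ → EG (λ G → Φ G (w′ [ v ]≔ lookup w v))))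
        ≡⟨ EV-resample v (λ u → EG (λ G → Φ G u)) ⟩
      EV (λ u → EG (λ G → Φ G u))
        ≡⟨ EV-cong (λ u → EG-resample v (f ∘ extend u)) ⟩
      EG f ∎
      where
      open ≡-Reasoning
      Φ : Graph n → Vec Bool n → ℚ
      Φ G u = EG (λ G′ → f (extend u (mergeStar v G G′)))

    EV-moment : ∀ {n} t (s : Fin n → Bool) →
      EV (λ v → t ^ ∑ (λ j → ⟦ lookup v j ∧ s j ⟧)) ≡ (1ℚ - r + r * t) ^ ∑ (λ j → ⟦ s j ⟧)
    EV-moment {zero}  t s = refl
    EV-moment {suc n} t s with s zero
    ... | false = trans (average _) (EV-moment t (s ∘ suc))
    ... | true  = begin
      (1ℚ - r) * X + r * EV (λ v → t * t ^ ∑ (λ j → ⟦ lookup v j ∧ s (suc j) ⟧))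
        ≡⟨ cong (λ y → (1ℚ - r) * X + r * y) (EV-* t (λ v → t ^ ∑ (λ j → ⟦ lookup v j ∧ s (suc j) ⟧))) ⟩
      (1ℚ - r) * X + r * (t * X)
        ≡⟨ solve 4 (λ s r t x → s :* x :+ r :* (t :* x) := (s :+ r :* t) :* x) refl (1ℚ - r) r t X ⟩
      (1ℚ - r + r * t) * X
        ≡⟨ cong ((1ℚ - r + r * t) *_) (EV-moment t (s ∘ suc)) ⟩
      (1ℚ - r + r * t) ^ suc (∑ (λ j → ⟦ s (suc j) ⟧)) ∎
      where
      open ≡-Reasoning
      X = EV (λ v → t ^ ∑ (λ j → ⟦ lookup v j ∧ s (suc j) ⟧))

    -- The generating function of a binomial variable with `size S` trials: the row of the first
    -- vertex is independent of the rest of the graph, so the expectation factorises.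
    moment : ∀ {n} t (S : Fin n → Fin n → Bool) → EG (λ G → t ^ edges S G) ≡ (1ℚ - r + r * t) ^ size S
    moment {zero}  t S = refl
    moment {suc n} t S = begin
      EV (λ v → EG (λ G → t ^ (row v ℕ.+ edges S′ G)))
        ≡⟨ EV-cong (λ v → EG-cong (λ G → ^-+ t (row v) (edges S′ G))) ⟩
      EV (λ v → EG (λ G → t ^ row v * t ^ edges S′ G))
        ≡⟨ EV-cong (λ v → EG-* (t ^ row v) (λ G → t ^ edges S′ G)) ⟩
      EV (λ v → t ^ row v * EG (λ G → t ^ edges S′ G))
        ≡⟨ EV-cong (λ v → ℚ.*-comm (t ^ row v) (EG (λ G → t ^ edges S′ G))) ⟩
      EV (λ v → EG (λ G → t ^ edges S′ G) * t ^ row v)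
        ≡⟨ EV-* (EG (λ G → t ^ edges S′ G)) (λ v → t ^ row v) ⟩
      EG (λ G → t ^ edges S′ G) * EV (λ v → t ^ row v)
        ≡⟨ cong₂ _*_ (moment t S′) (EV-moment t (λ j → S zero (suc j))) ⟩
      base ^ size S′ * base ^ ∑ (λ j → ⟦ S zero (suc j) ⟧)
        ≡⟨ ℚ.*-comm (base ^ size S′) _ ⟩
      base ^ ∑ (λ j → ⟦ S zero (suc j) ⟧) * base ^ size S′
        ≡⟨ ^-+ base (∑ (λ j → ⟦ S zero (suc j) ⟧)) (size S′) ⟨
      base ^ size S ∎
      where
      open ≡-Reasoning
      base = 1ℚ - r + r * t
      S′ : Fin n → Fin n → Bool
      S′ i j = S (suc i) (suc j)
      row : Vec Bool n → ℕ
      row v = ∑ (λ j → ⟦ lookup v j ∧ S zero (suc j) ⟧)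

    module Monotone (0≤r : 0ℚ ≤ r) (r≤1 : r ≤ 1ℚ) where

      EV-mono : ∀ {n} {f g : Vec Bool n → ℚ} → (∀ v → f v ≤ g v) → EV f ≤ EV g
      EV-mono {zero}  f≤g = f≤g []
      EV-mono {suc n} f≤g = ℚ.+-mono-≤
        (*-monoˡ (1ℚ - r) (≤⇒0≤- r≤1) (EV-mono (λ v → f≤g (false ∷ v))))
        (*-monoˡ r 0≤r (EV-mono (λ v → f≤g (true ∷ v))))

      EG-mono : ∀ {n} {f g : Graph n → ℚ} → (∀ G → f G ≤ g G) → EG f ≤ EG g
      EG-mono {zero}  f≤g = f≤g empty
      EG-mono {suc n} f≤g = EV-mono (λ v → EG-mono (λ G → f≤g (extend v G)))

      EG-≤ : ∀ {n} {f : Graph n → ℚ} {c} → (∀ G → f G ≤ c) → EG f ≤ c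
      EG-≤ {n} {f} {c} f≤c = subst (EG f ≤_) (EG-const {n} c) (EG-mono f≤c)

      prob-nonNeg : ∀ {n} (P : Graph n → Bool) → 0ℚ ≤ prob P
      prob-nonNeg {n} P = subst (_≤ prob P) (EG-const {n} 0ℚ) (EG-mono (indicator-nonNeg ∘ P))

      prob≤1 : ∀ {n} (P : Graph n → Bool) → prob P ≤ 1ℚ
      prob≤1 P = EG-≤ (indicator≤1 ∘ P)

      prob-∨ : ∀ {n} (P Q : Graph n → Bool) → prob (λ G → P G ∨ Q G) ≤ prob P + prob Q
      prob-∨ P Q = subst (prob (λ G → P G ∨ Q G) ≤_) (EG-+ (indicator ∘ P) (indicator ∘ Q))
        (EG-mono (λ G → indicator-∨ (P G) (Q G)))

      -- The union bound multiplied through by c, the reciprocal of a common bound for the single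
      -- events, so that no division occurs.
      prob-any : ∀ {n} {X : Set} (P : X → Graph n → Bool) c → 0ℚ ≤ c → (∀ x → c * prob (P x) ≤ 1ℚ) →
        ∀ xs → c * prob (λ G → any (λ x → P x G) xs) ≤ ι (length xs)
      prob-any {n} P c 0≤c rare []       =
        ℚ.≤-reflexive (trans (cong (c *_) (EG-const {n} 0ℚ)) (ℚ.*-zeroʳ c))
      prob-any P c 0≤c rare (x ∷ xs) = begin
        c * prob (λ G → P x G ∨ any (λ x → P x G) xs)
          ≤⟨ *-monoˡ c 0≤c (prob-∨ (P x) (λ G → any (λ x → P x G) xs)) ⟩
        c * (prob (P x) + prob (λ G → any (λ x → P x G) xs))
          ≡⟨ ℚ.*-distribˡ-+ c (prob (P x)) _ ⟩
        c * prob (P x) + c * prob (λ G → any (λ x → P x G) xs)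
          ≤⟨ ℚ.+-mono-≤ (rare x) (prob-any P c 0≤c rare xs) ⟩
        1ℚ + ι (length xs)
          ≡⟨ ι-suc (length xs) ⟨
        ι (length (x ∷ xs)) ∎
        where open ℚ.≤-Reasoning

    bit : Bool → ℚ
    bit b = if b then r else 1ℚ - r

    weightℚ : ∀ {n} → Graph n → ℚ
    weightℚ {n} G = foldr (λ (i , j) w → bit (adj G i j) * w) 1ℚ (pairs n)

    ∏ : ∀ {n} → (Fin n → ℚ) → ℚ
    ∏ {zero}  f = 1ℚ
    ∏ {suc n} f = f zero * ∏ (f ∘ suc)

    ∑ᴸ : ∀ {X : Set} → (X → ℚ) → List X → ℚ
    ∑ᴸ f = foldr (λ x w → f x + w) 0ℚ

    foldr-tabulate : ∀ {X : Set} {n} (φ : X → ℚ) c (g : Fin n → X) →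
      foldr (λ x w → φ x * w) c (tabulate g) ≡ ∏ (φ ∘ g) * c
    foldr-tabulate {n = zero}  φ c g = sym (ℚ.*-identityˡ c)
    foldr-tabulate {n = suc n} φ c g = trans (cong (φ (g zero) *_) (foldr-tabulate φ c (g ∘ suc)))
      (sym (ℚ.*-assoc (φ (g zero)) (∏ (φ ∘ g ∘ suc)) c))

    weightℚ-extend : ∀ {n} v (G : Graph n) → weightℚ (extend v G) ≡ ∏ (bit ∘ lookup v) * weightℚ G
    weightℚ-extend {n} v G = begin
      foldr f 1ℚ (pairs (suc n))
        ≡⟨ cong (foldr f 1ℚ) (pairs-suc n) ⟩
      foldr f 1ℚ (map first (allFin n) ++ map both (pairs n))
        ≡⟨ List.foldr-++ f 1ℚ (map first (allFin n)) (map both (pairs n)) ⟩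
      foldr f (foldr f 1ℚ (map both (pairs n))) (map first (allFin n))
        ≡⟨ cong₂ (foldr f) (shifted (pairs n)) (List.map-tabulate (λ j → j) first) ⟩
      foldr f (weightℚ G) (tabulate first)
        ≡⟨ foldr-tabulate (λ (i , j) → bit (adj (extend v G) i j)) (weightℚ G) first ⟩
      ∏ (bit ∘ lookup v) * weightℚ G ∎
      where
      open ≡-Reasoning
      f : Fin (suc n) × Fin (suc n) → ℚ → ℚ
      f (i , j) w = bit (adj (extend v G) i j) * w
      first : Fin n → Fin (suc n) × Fin (suc n)
      first j = zero , suc j
      both : Fin n × Fin n → Fin (suc n) × Fin (suc n)
      both (i , j) = suc i , suc j
      shifted : ∀ ps → foldr f 1ℚ (map both ps) ≡ foldr (λ (i , j) w → bit (adj G i j) * w) 1ℚ ps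
      shifted []       = refl
      shifted (p ∷ ps) = cong (f (both p)) (shifted ps)

    ∑ᴸ-cong : ∀ {X : Set} {f g : X → ℚ} → (∀ x → f x ≡ g x) → ∀ xs → ∑ᴸ f xs ≡ ∑ᴸ g xs
    ∑ᴸ-cong f≡g []       = refl
    ∑ᴸ-cong f≡g (x ∷ xs) = cong₂ _+_ (f≡g x) (∑ᴸ-cong f≡g xs)

    ∑ᴸ-++ : ∀ {X : Set} (f : X → ℚ) xs ys → ∑ᴸ f (xs ++ ys) ≡ ∑ᴸ f xs + ∑ᴸ f ys
    ∑ᴸ-++ f []       ys = sym (ℚ.+-identityˡ (∑ᴸ f ys))
    ∑ᴸ-++ f (x ∷ xs) ys = trans (cong (f x +_) (∑ᴸ-++ f xs ys)) (sym (ℚ.+-assoc (f x) (∑ᴸ f xs) (∑ᴸ f ys)))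

    ∑ᴸ-map : ∀ {X Y : Set} (f : Y → ℚ) (g : X → Y) xs → ∑ᴸ f (map g xs) ≡ ∑ᴸ (f ∘ g) xs
    ∑ᴸ-map f g []       = refl
    ∑ᴸ-map f g (x ∷ xs) = cong (f (g x) +_) (∑ᴸ-map f g xs)

    ∑ᴸ-* : ∀ {X : Set} c (f : X → ℚ) xs → ∑ᴸ (λ x → c * f x) xs ≡ c * ∑ᴸ f xs
    ∑ᴸ-* c f []       = sym (ℚ.*-zeroʳ c)
    ∑ᴸ-* c f (x ∷ xs) = trans (cong (c * f x +_) (∑ᴸ-* c f xs)) (sym (ℚ.*-distribˡ-+ c (f x) (∑ᴸ f xs)))

    ∑ᴸ-product : ∀ {X Y Z : Set} (f : Z → ℚ) (g : X → Y → Z) xs ys →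
      ∑ᴸ f (cartesianProductWith g xs ys) ≡ ∑ᴸ (λ x → ∑ᴸ (f ∘ g x) ys) xs
    ∑ᴸ-product f g []       ys = refl
    ∑ᴸ-product f g (x ∷ xs) ys = trans (∑ᴸ-++ f (map (g x) ys) _) (cong₂ _+_ (∑ᴸ-map f (g x) ys) (∑ᴸ-product f g xs ys))

    EV≡∑ᴸ : ∀ {n} (f : Vec Bool n → ℚ) →
      EV f ≡ ∑ᴸ (λ v → ∏ (bit ∘ lookup v) * f v) (allVecs (false ∷ true ∷ []) n)
    EV≡∑ᴸ {zero}  f = sym (trans (ℚ.+-identityʳ _) (ℚ.*-identityˡ (f [])))
    EV≡∑ᴸ {suc n} f = begin
      (1ℚ - r) * EV (f ∘ (false ∷_)) + r * EV (f ∘ (true ∷_))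
        ≡⟨ cong₂ _+_ (half false) (trans (half true) (sym (ℚ.+-identityʳ _))) ⟩
      ∑ᴸ (F ∘ (false ∷_)) vs + (∑ᴸ (F ∘ (true ∷_)) vs + 0ℚ)
        ≡⟨ ∑ᴸ-product F _∷_ (false ∷ true ∷ []) vs ⟨
      ∑ᴸ F (allVecs (false ∷ true ∷ []) (suc n)) ∎
      where
      open ≡-Reasoning
      vs = allVecs (false ∷ true ∷ []) n
      F : Vec Bool (suc n) → ℚ
      F v = ∏ (bit ∘ lookup v) * f v
      half : ∀ b → bit b * EV (f ∘ (b ∷_)) ≡ ∑ᴸ (F ∘ (b ∷_)) vs
      half b = trans (cong (bit b *_) (EV≡∑ᴸ (f ∘ (b ∷_))))
        (trans (sym (∑ᴸ-* (bit b) (λ v → ∏ (bit ∘ lookup v) * f (b ∷ v)) vs))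
          (∑ᴸ-cong (λ v → sym (ℚ.*-assoc (bit b) (∏ (bit ∘ lookup v)) (f (b ∷ v)))) vs))

    EG≡∑ᴸ : ∀ {n} (f : Graph n → ℚ) → EG f ≡ ∑ᴸ (λ G → weightℚ G * f G) (allGraphs n)
    EG≡∑ᴸ {zero}  f = sym (trans (ℚ.+-identityʳ _) (ℚ.*-identityˡ (f empty)))
    EG≡∑ᴸ {suc n} f = begin
      EV (λ v → EG (f ∘ extend v))
        ≡⟨ EV-cong (λ v → EG≡∑ᴸ (f ∘ extend v)) ⟩
      EV (λ v → ∑ᴸ (λ G → weightℚ G * f (extend v G)) (allGraphs n))
        ≡⟨ EV≡∑ᴸ {n} (λ v → ∑ᴸ (λ G → weightℚ G * f (extend v G)) (allGraphs n)) ⟩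
      ∑ᴸ (λ v → ∏ (bit ∘ lookup v) * ∑ᴸ (λ G → weightℚ G * f (extend v G)) (allGraphs n)) vs
        ≡⟨ ∑ᴸ-cong (λ v → trans (sym (∑ᴸ-* (∏ (bit ∘ lookup v)) (λ G → weightℚ G * f (extend v G)) (allGraphs n)))
             (∑ᴸ-cong (λ G → trans (sym (ℚ.*-assoc (∏ (bit ∘ lookup v)) (weightℚ G) (f (extend v G))))
               (cong (_* f (extend v G)) (sym (weightℚ-extend v G)))) (allGraphs n))) vs ⟩
      ∑ᴸ (λ v → ∑ᴸ (λ G → weightℚ (extend v G) * f (extend v G)) (allGraphs n)) vs
        ≡⟨ ∑ᴸ-product (λ G → weightℚ G * f G) extend vs (allGraphs n) ⟨
      ∑ᴸ (λ G → weightℚ G * f G) (allGraphs (suc n)) ∎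
      where
      open ≡-Reasoning
      vs = allVecs (false ∷ true ∷ []) n

  open Expectation using (prob; weightℚ; EG≡∑ᴸ; bit; ∑ᴸ)

  seq-* : ∀ x y k → seq (x Defs.* y) k ≡ seq x k * seq y k
  seq-* x y k = refl

  seq-+ : ∀ x y k → seq (x Defs.+ y) k ≡ seq x k + seq y k
  seq-+ x y k = refl

  seq-bit : ∀ p b k → seq (if b then p else (1ℝ Defs.- p)) k ≡ bit (seq p k) b
  seq-bit p false k = refl
  seq-bit p true  k = refl

  seq-weight : ∀ {n} p (G : Graph n) k → seq (weight p G) k ≡ weightℚ (seq p k) G
  seq-weight {n} p G k = go (pairs n)
    where
    go : ∀ ps → seq (foldr (λ (i , j) w → (if adj G i j then p else (1ℝ Defs.- p)) Defs.* w) 1ℝ ps) k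
      ≡ foldr (λ (i , j) w → bit (seq p k) (adj G i j) * w) 1ℚ ps
    go []             = refl
    go ((i , j) ∷ ps) = trans
      (seq-* (if adj G i j then p else (1ℝ Defs.- p)) (foldr (λ (i , j) w → (if adj G i j then p else (1ℝ Defs.- p)) Defs.* w) 1ℝ ps) k)
      (cong₂ _*_ (seq-bit p (adj G i j) k) (go ps))

  -- Real operations act termwise on the representing sequences, so the k-th approximation of a
  -- probability is itself the probability at the k-th approximation of p. Hence all estimates can
  -- be made for rational r.
  seq-Pr : ∀ {n} p (A : Graph n → Bool) k → seq (Pr p A) k ≡ prob (seq p k) A
  seq-Pr {n} p A k = trans (go (allGraphs n)) (sym (EG≡∑ᴸ (seq p k) (indicator ∘ A)))
    where
    term : ∀ b (G : Graph n) → seq (if b then weight p G else 0ℝ) k ≡ weightℚ (seq p k) G * indicator b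
    term false G = sym (ℚ.*-zeroʳ (weightℚ (seq p k) G))
    term true  G = trans (seq-weight p G k) (sym (ℚ.*-identityʳ (weightℚ (seq p k) G)))
    go : ∀ Gs → seq (foldr (λ G w → (if A G then weight p G else 0ℝ) Defs.+ w) 0ℝ Gs) k
      ≡ ∑ᴸ (seq p k) (λ G → weightℚ (seq p k) G * indicator (A G)) Gs
    go []       = refl
    go (G ∷ Gs) = trans
      (seq-+ (if A G then weight p G else 0ℝ) (foldr (λ G w → (if A G then weight p G else 0ℝ) Defs.+ w) 0ℝ Gs) k)
      (cong₂ _+_ (term (A G) G) (go Gs))

-- Chernoff bounds without exponentials.

module Concentration where

  open import Defs using (Graph; _^_)
  open Rationals
  open Counting using (edges; size)
  open RandomGraphs
  open import Data.Bool.Base using (Bool; true; false; T)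
  open import Data.Fin.Base using (Fin)
  open import Data.Nat.Base as ℕ using (ℕ; suc; _≤ᵇ_)
  import Data.Nat.Properties as ℕ
  open import Data.Product.Base using (_,_)
  open import Data.Rational.Base hiding (_≤ᵇ_)
  import Data.Rational.Properties as ℚ
  open import Data.Rational.Solver using (module +-*-Solver)
  open import Data.Unit.Base using (tt)
  open import Function.Base using (_∘_)
  open import Relation.Binary.PropositionalEquality
  open +-*-Solver using (solve; _:=_; _:+_; _:*_; _:-_; :-_; con)

  -- A count with mean lo j is unlikely to reach hi j and vice versa; the ratio of the two is 1 + 2/d.
  module Tilt (d : ℕ) where

    u a b : ℚ
    u = 1/suc d
    a = 1ℚ + u
    b = 1ℚ - u

    lo hi : ℕ → ℕ
    lo j = d ℕ.* suc d ℕ.* j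
    hi j = suc d ℕ.* suc (suc d) ℕ.* j

    0≤u : 0ℚ ≤ u
    0≤u = 1/suc-nonNeg d

    u≤1 : u ≤ 1ℚ
    u≤1 = fraction-≤ {1} {d} {1} {0} (ℕ.*-monoʳ-≤ 1 (ℕ.s≤s ℕ.z≤n))

    0≤b : 0ℚ ≤ b
    0≤b = ≤⇒0≤- u≤1

    b≤1 : b ≤ 1ℚ
    b≤1 = ≤-by u 0≤u (solve 1 (λ u → con 1ℚ := con 1ℚ :- u :+ u) refl u)

    1≤a : 1ℚ ≤ a
    1≤a = ≤-+-nonNeg 1ℚ u 0≤u

    0≤a : 0ℚ ≤ a
    0≤a = ℚ.≤-trans 0≤1 1≤a

    [1+d]u≡1 : (1ℚ + ι d) * u ≡ 1ℚ
    [1+d]u≡1 = trans (cong (_* u) (sym (ι-suc d))) (ι*1/suc d)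

    2≤a^[1+d] : ι 2 ≤ a ^ suc d
    2≤a^[1+d] = subst (_≤ a ^ suc d) (cong (1ℚ +_) (ι*1/suc d)) (bernoulli⁺ 0≤u (suc d))

    -- The right side is a (1 - u²)^d, and Bernoulli leaves a (1 - d u²) = 1 + u³, because d u = 1 -
    -- u.
    1≤a^[1+d]b^d : 1ℚ ≤ a ^ suc d * b ^ d
    1≤a^[1+d]b^d = begin
      1ℚ                              ≤⟨ ≤-by (u * (u * u)) (*-nonNeg u (u * u) 0≤u (*-nonNeg u u 0≤u 0≤u)) identity ⟩
      a * (1ℚ - ι d * (u * u))        ≤⟨ *-monoˡ a 0≤a (bernoulli⁻ (*-nonNeg u u 0≤u 0≤u) (*-mono-≤-nonNeg {u} {1ℚ} {u} {1ℚ} 0≤1 0≤u u≤1 u≤1) d) ⟩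
      a * (1ℚ - u * u) ^ d            ≡⟨ cong (λ x → a * x ^ d) (solve 1 (λ u → con 1ℚ :- u :* u := (con 1ℚ :+ u) :* (con 1ℚ :- u)) refl u) ⟩
      a * (a * b) ^ d                 ≡⟨ cong (a *_) (^-distrib a b d) ⟩
      a * (a ^ d * b ^ d)             ≡⟨ ℚ.*-assoc a (a ^ d) (b ^ d) ⟨
      a ^ suc d * b ^ d               ∎
      where
      open ℚ.≤-Reasoning
      identity : a * (1ℚ - ι d * (u * u)) ≡ 1ℚ + u * (u * u)
      identity = trans
        (solve 2 (λ u d → (con 1ℚ :+ u) :* (con 1ℚ :- d :* (u :* u))
            := (con 1ℚ :+ u :* (u :* u)) :+ (u :+ u :* u) :* (con 1ℚ :- (con 1ℚ :+ d) :* u)) refl u (ι d))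
        (trans (cong (λ t → 1ℚ + u * (u * u) + (u + u * u) * (1ℚ - t)) [1+d]u≡1)
          (solve 1 (λ u → con 1ℚ :+ u :* (u :* u) :+ (u :+ u :* u) :* (con 1ℚ :- con 1ℚ) := con 1ℚ :+ u :* (u :* u)) refl u))

    -- This rests on the monotonicity of (1 + 1/d)^d, in the form a^(d+1) b^d ≥ 1.
    2^j≤a^hi*b^lo : ∀ j → ι (2 ℕ.^ j) ≤ a ^ hi j * b ^ lo j
    2^j≤a^hi*b^lo j = subst₂ _≤_ (sym (ι-^ 2 j)) eq (^-monoˡ (ι-nonNeg 2) 2≤ j)
      where
      A = a ^ suc d
      B = b ^ d
      2≤ : ι 2 ≤ A * (A * B) ^ suc d
      2≤ = subst (_≤ A * (A * B) ^ suc d) (ℚ.*-identityʳ (ι 2))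
        (*-mono-≤-nonNeg {ι 2} {A} {1ℚ} {(A * B) ^ suc d} (^-nonNeg 0≤a (suc d)) 0≤1 2≤a^[1+d] (1≤^ 1≤a^[1+d]b^d (suc d)))
      eq : (A * (A * B) ^ suc d) ^ j ≡ a ^ hi j * b ^ lo j
      eq = begin
        (A * (A * B) ^ suc d) ^ j
          ≡⟨ cong (λ x → (A * x) ^ j) (^-distrib A B (suc d)) ⟩
        (A * (A ^ suc d * B ^ suc d)) ^ j
          ≡⟨ cong (_^ j) (sym (ℚ.*-assoc A (A ^ suc d) (B ^ suc d))) ⟩
        (A ^ suc (suc d) * B ^ suc d) ^ j
          ≡⟨ cong₂ (λ x y → (x * y) ^ j) (^-* a (suc d) (suc (suc d))) (^-* b d (suc d)) ⟨
        (a ^ (suc d ℕ.* suc (suc d)) * b ^ (d ℕ.* suc d)) ^ j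
          ≡⟨ ^-distrib (a ^ (suc d ℕ.* suc (suc d))) (b ^ (d ℕ.* suc d)) j ⟩
        (a ^ (suc d ℕ.* suc (suc d))) ^ j * (b ^ (d ℕ.* suc d)) ^ j
          ≡⟨ cong₂ _*_ (^-* a (suc d ℕ.* suc (suc d)) j) (^-* b (d ℕ.* suc d) j) ⟨
        a ^ hi j * b ^ lo j ∎
        where open ≡-Reasoning

  module Tails (r : ℚ) (0≤r : 0ℚ ≤ r) (r≤1 : r ≤ 1ℚ) (d : ℕ) where

    open Expectation r
    open Monotone 0≤r r≤1
    open Tilt d

    upper-tail : ∀ {n} (S : Fin n → Fin n → Bool) j {R} → ι R * r ≤ 1ℚ → size S ℕ.≤ R ℕ.* lo j →
      ι (2 ℕ.^ j) * prob (λ G → hi j ≤ᵇ edges S G) ≤ 1ℚ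
    upper-tail {n} S j {R} Rr≤1 small = begin
      ι (2 ℕ.^ j) * P
        ≤⟨ *-monoʳ P (prob-nonNeg tail) (2^j≤a^hi*b^lo j) ⟩
      a ^ hi j * b ^ lo j * P
        ≡⟨ solve 3 (λ x y p → x :* y :* p := (x :* p) :* y) refl (a ^ hi j) (b ^ lo j) P ⟩
      (a ^ hi j * P) * b ^ lo j
        ≤⟨ *-monoʳ (b ^ lo j) (^-nonNeg 0≤b (lo j)) markov ⟩
      c ^ size S * b ^ lo j
        ≤⟨ *-monoʳ (b ^ lo j) (^-nonNeg 0≤b (lo j)) (^-monoʳ 1≤c small) ⟩
      c ^ (R ℕ.* lo j) * b ^ lo j
        ≡⟨ trans (cong (_* b ^ lo j) (^-* c R (lo j))) (sym (^-distrib (c ^ R) b (lo j))) ⟩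
      (c ^ R * b) ^ lo j
        ≤⟨ ^≤1 (*-nonNeg (c ^ R) b (^-nonNeg 0≤c R) 0≤b) c^Rb≤1 (lo j) ⟩
      1ℚ ∎
      where
      open ℚ.≤-Reasoning
      tail : Graph n → Bool
      tail G = hi j ≤ᵇ edges S G
      P c : ℚ
      P = prob tail
      c = 1ℚ + r * u
      0≤ru : 0ℚ ≤ r * u
      0≤ru = *-nonNeg r u 0≤r 0≤u
      1≤c : 1ℚ ≤ c
      1≤c = ≤-+-nonNeg 1ℚ (r * u) 0≤ru
      0≤c : 0ℚ ≤ c
      0≤c = ℚ.≤-trans 0≤1 1≤c
      c^Rb≤1 : c ^ R * b ≤ 1ℚ
      c^Rb≤1 = ℚ.≤-trans
        (*-monoˡ (c ^ R) (^-nonNeg 0≤c R)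
          (≤-by (u * (1ℚ - ι R * r)) (*-nonNeg u (1ℚ - ι R * r) 0≤u (≤⇒0≤- Rr≤1))
            (solve 3 (λ u R r → con 1ℚ :- R :* (r :* u) := con 1ℚ :- u :+ u :* (con 1ℚ :- R :* r)) refl u (ι R) r)))
        ([1+x]^n[1-nx]≤1 0≤ru R)
      tilt : ∀ x → a ^ hi j * indicator (hi j ≤ᵇ x) ≤ a ^ x
      tilt x with hi j ≤ᵇ x in eq
      ... | false = subst (_≤ a ^ x) (sym (ℚ.*-zeroʳ (a ^ hi j))) (^-nonNeg 0≤a x)
      ... | true  = subst (_≤ a ^ x) (sym (ℚ.*-identityʳ (a ^ hi j)))
        (^-monoʳ 1≤a (ℕ.≤ᵇ⇒≤ (hi j) x (subst T (sym eq) tt)))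
      markov : a ^ hi j * P ≤ c ^ size S
      markov = subst₂ _≤_ (EG-* (a ^ hi j) (indicator ∘ tail))
        (trans (moment a S) (cong (_^ size S)
          (solve 2 (λ r u → con 1ℚ :- r :+ r :* (con 1ℚ :+ u) := con 1ℚ :+ r :* u) refl r u)))
        (EG-mono (λ G → tilt (edges S G)))

    -- The mirror image: Markov's inequality for b^e, where e has mean at least `hi j`. The roles of
    -- a and b are exchanged, and (1 - ru)^R a ≤ 1 because Rr ≥ 1.
    lower-tail : ∀ {n} (S : Fin n → Fin n → Bool) j {R} → 1ℚ ≤ ι R * r → R ℕ.* hi j ℕ.≤ size S →
      ι (2 ℕ.^ j) * prob (λ G → edges S G ≤ᵇ lo j) ≤ 1ℚ
    lower-tail {n} S j {R} 1≤Rr large = begin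
      ι (2 ℕ.^ j) * P
        ≤⟨ *-monoʳ P (prob-nonNeg tail) (2^j≤a^hi*b^lo j) ⟩
      a ^ hi j * b ^ lo j * P
        ≡⟨ ℚ.*-assoc (a ^ hi j) (b ^ lo j) P ⟩
      a ^ hi j * (b ^ lo j * P)
        ≤⟨ *-monoˡ (a ^ hi j) (^-nonNeg 0≤a (hi j)) markov ⟩
      a ^ hi j * c ^ size S
        ≤⟨ *-monoˡ (a ^ hi j) (^-nonNeg 0≤a (hi j)) (^-antimonoʳ 0≤c c≤1 large) ⟩
      a ^ hi j * c ^ (R ℕ.* hi j)
        ≡⟨ trans (ℚ.*-comm (a ^ hi j) _) (trans (cong (_* a ^ hi j) (^-* c R (hi j))) (sym (^-distrib (c ^ R) a (hi j)))) ⟩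
      (c ^ R * a) ^ hi j
        ≤⟨ ^≤1 (*-nonNeg (c ^ R) a (^-nonNeg 0≤c R) 0≤a) c^Ra≤1 (hi j) ⟩
      1ℚ ∎
      where
      open ℚ.≤-Reasoning
      tail : Graph n → Bool
      tail G = edges S G ≤ᵇ lo j
      P c : ℚ
      P = prob tail
      c = 1ℚ - r * u
      0≤ru : 0ℚ ≤ r * u
      0≤ru = *-nonNeg r u 0≤r 0≤u
      ru≤1 : r * u ≤ 1ℚ
      ru≤1 = *-mono-≤-nonNeg {r} {1ℚ} {u} {1ℚ} 0≤1 0≤u r≤1 u≤1
      0≤c : 0ℚ ≤ c
      0≤c = ≤⇒0≤- ru≤1
      c≤1 : c ≤ 1ℚ
      c≤1 = ≤-by (r * u) 0≤ru (solve 1 (λ x → con 1ℚ := con 1ℚ :- x :+ x) refl (r * u))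
      c^Ra≤1 : c ^ R * a ≤ 1ℚ
      c^Ra≤1 = ℚ.≤-trans
        (*-monoˡ (c ^ R) (^-nonNeg 0≤c R)
          (≤-by (u * (ι R * r - 1ℚ)) (*-nonNeg u (ι R * r - 1ℚ) 0≤u (≤⇒0≤- 1≤Rr))
            (solve 3 (λ u R r → con 1ℚ :+ R :* (r :* u) := con 1ℚ :+ u :+ u :* (R :* r :- con 1ℚ)) refl u (ι R) r)))
        ([1-x]^n[1+nx]≤1 0≤ru ru≤1 R)
      tilt : ∀ x → b ^ lo j * indicator (x ≤ᵇ lo j) ≤ b ^ x
      tilt x with x ≤ᵇ lo j in eq
      ... | false = subst (_≤ b ^ x) (sym (ℚ.*-zeroʳ (b ^ lo j))) (^-nonNeg 0≤b x)
      ... | true  = subst (_≤ b ^ x) (sym (ℚ.*-identityʳ (b ^ lo j)))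
        (^-antimonoʳ 0≤b b≤1 (ℕ.≤ᵇ⇒≤ x (lo j) (subst T (sym eq) tt)))
      markov : b ^ lo j * P ≤ c ^ size S
      markov = subst₂ _≤_ (EG-* (b ^ lo j) (indicator ∘ tail))
        (trans (moment b S) (cong (_^ size S)
          (solve 2 (λ r u → con 1ℚ :- r :+ r :* (con 1ℚ :- u) := con 1ℚ :- r :* u) refl r u)))
        (EG-mono (λ G → tilt (edges S G)))

-- Typical graphs: their probability and their properties.

module TypicalGraphs where

  open import Defs hiding (_+_; _*_; _≤_; _<_; _-_; -_; ∣_∣; _^_)
  open Rationals
  open Counting
  open RandomGraphs
  open Concentration
  open TriangleDeletion
  open import Data.Bool.Base using (Bool; true; false; not; _∧_; _∨_; T)
  open import Data.Bool.ListAction using (any)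
  open import Data.Bool.Properties using (∧-comm; ∧-identityʳ; ∧-zeroʳ)
  open import Data.Empty using (⊥-elim)
  open import Data.Fin.Base as Fin using (Fin; zero; suc)
  import Data.Fin.Properties as Fin
  open import Data.List.Base using (List; []; _∷_; length; map; allFin; cartesianProductWith)
  import Data.List.Properties as List
  open import Data.List.Membership.Propositional using (_∈_)
  open import Data.List.Membership.Propositional.Properties using (∈-allFin)
  open import Data.List.Relation.Unary.Any using (here; there)
  open import Data.Nat.Base as ℕ using (ℕ; zero; suc; _≤ᵇ_; _<ᵇ_)
  import Data.Nat.Properties as ℕ
  open import Data.Product.Base using (_×_; _,_; proj₁; proj₂)
  open import Data.Rational.Base hiding (_≤ᵇ_; floor)
  import Data.Rational.Properties as ℚ
  open import Data.Rational.Solver using (module +-*-Solver)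
  open import Data.Vec.Base using (Vec; _∷_; lookup)
  open import Function.Base using (_∘_)
  open import Relation.Binary.PropositionalEquality
  open import Relation.Nullary using (¬_; yes; no)
  open import Relation.Nullary.Decidable using (⌊_⌋)
  open +-*-Solver using (solve; _:=_; _:+_; _:*_; _:-_; :-_)

  -- The value off the upper triangle i < j is immaterial.
  star : ∀ {n} → Fin n → Fin n → Fin n → Bool
  star zero    zero    _       = true
  star zero    (suc _) _       = false
  star (suc v) zero    zero    = false
  star (suc v) zero    (suc j) = ⌊ v Fin.≟ j ⌋
  star (suc v) (suc i) zero    = false
  star (suc v) (suc i) (suc j) = star v i j

  upper-zero : ∀ n → upper {n} (λ _ _ → 0) ≡ 0
  upper-zero zero    = refl
  upper-zero (suc n) = cong₂ ℕ._+_ (∑-zero n) (upper-zero n)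

  edges-star : ∀ {n} (G : Graph n) v → edges (star v) G ≡ degree G v
  edges-star {suc n} (extend w G) zero = trans
    (cong₂ ℕ._+_ (sum-cong-≗ (λ j → cong ⟦_⟧ (∧-identityʳ (lookup w j))))
      (trans (upper-cong (λ i j → cong ⟦_⟧ (∧-zeroʳ (adj G i j)))) (upper-zero n)))
    (trans (ℕ.+-identityʳ _) (sym (degree≡∑ (extend w G) zero)))
  edges-star (extend w G) (suc v) = trans
    (cong₂ ℕ._+_ (∑-select (lookup w) v) (trans (edges-star G v) (degree≡∑ G v)))
    (sym (degree≡∑ (extend w G) (suc v)))

  size-star : ∀ {n} (v : Fin n) → size (star v) ≡ n ℕ.∸ 1
  size-star {suc n}       zero    = trans (cong₂ ℕ._+_ (∑-const n 1) (upper-zero n))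
    (trans (ℕ.+-identityʳ _) (ℕ.*-identityʳ n))
  size-star {suc (suc n)} (suc v) = cong₂ ℕ._+_ (∑-≟ v) (size-star v)

  -- The ordered pairs of neighbours number the square of the degree; without the diagonal they are
  -- each unordered pair twice.
  size-neighbours : ∀ {n} (G : Graph n) v → 2 ℕ.* size (neighbours G v) ℕ.≤ degree G v ℕ.* degree G v
  size-neighbours G v = begin
    2 ℕ.* size (neighbours G v)
      ≤⟨ ℕ.m≤n+m _ (∑ (λ i → ⟦ neighbours G v i i ⟧)) ⟩
    ∑ (λ i → ⟦ neighbours G v i i ⟧) ℕ.+ 2 ℕ.* size (neighbours G v)
      ≡⟨ ∑∑≡diagonal+2upper (λ i j → ⟦ neighbours G v i j ⟧) (λ i j → cong ⟦_⟧ (∧-comm (adj G v i) (adj G v j))) ⟨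
    ∑ (λ i → ∑ (λ j → ⟦ adj G v i ∧ adj G v j ⟧))
      ≡⟨ sum-cong-≗ (λ i → sum-cong-≗ (λ j → ⟦∧⟧ (adj G v i) (adj G v j))) ⟩
    ∑ (λ i → ∑ (λ j → ⟦ adj G v i ⟧ ℕ.* ⟦ adj G v j ⟧))
      ≡⟨ sum-cong-≗ (λ i → *-distribˡ-sum ⟦ adj G v i ⟧ (λ j → ⟦ adj G v j ⟧)) ⟨
    ∑ (λ i → ⟦ adj G v i ⟧ ℕ.* ∑ (λ j → ⟦ adj G v j ⟧))
      ≡⟨ *-distribʳ-sum (∑ (λ j → ⟦ adj G v j ⟧)) (λ i → ⟦ adj G v i ⟧) ⟨
    ∑ (λ i → ⟦ adj G v i ⟧) ℕ.* ∑ (λ j → ⟦ adj G v j ⟧)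
      ≡⟨ cong₂ ℕ._*_ (degree≡∑ G v) (degree≡∑ G v) ⟨
    degree G v ℕ.* degree G v ∎
    where
    open ℕ.≤-Reasoning

  degree-mergeStar : ∀ {n} v (G G′ : Graph n) → degree (mergeStar v G G′) v ≡ degree G v
  degree-mergeStar v G G′ = trans (degree≡∑ (mergeStar v G G′) v)
    (trans (sum-cong-≗ (λ j → cong ⟦_⟧ (adj-mergeStar-at v G G′ j))) (sym (degree≡∑ G v)))

  -- N(v) is read off the star, hence from G, while pairs inside N(v) avoid v and are read from G′.
  -- Pairs that contain v contribute to neither side, as v is not its own neighbour.
  edges-neighbours-mergeStar : ∀ {n} v (G G′ : Graph n) →
    edges (neighbours (mergeStar v G G′) v) (mergeStar v G G′) ≡ edges (neighbours G v) G′
  edges-neighbours-mergeStar v G G′ = upper-cong λ i j → cong ⟦_⟧ (trans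
    (cong₂ (λ a b → adj (mergeStar v G G′) i j ∧ (a ∧ b)) (adj-mergeStar-at v G G′ i) (adj-mergeStar-at v G G′ j))
    (off-star i j))
    where
    off-star : ∀ i j → adj (mergeStar v G G′) i j ∧ (adj G v i ∧ adj G v j) ≡ adj G′ i j ∧ (adj G v i ∧ adj G v j)
    off-star i j with i Fin.≟ v | j Fin.≟ v
    ... | yes refl | _        rewrite adj-irrefl G v = trans (∧-zeroʳ (adj (mergeStar v G G′) v j)) (sym (∧-zeroʳ (adj G′ v j)))
    ... | no _     | yes refl rewrite adj-irrefl G v | ∧-zeroʳ (adj G v i) =
      trans (∧-zeroʳ (adj (mergeStar v G G′) i v)) (sym (∧-zeroʳ (adj G′ i v)))
    ... | no i≢v   | no j≢v   = cong (_∧ (adj G v i ∧ adj G v j)) (adj-mergeStar-off v G G′ i j i≢v j≢v)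

  length-cartesianProductWith : ∀ {A B C : Set} (f : A → B → C) xs ys →
    length (cartesianProductWith f xs ys) ≡ length xs ℕ.* length ys
  length-cartesianProductWith f []       ys = refl
  length-cartesianProductWith f (x ∷ xs) ys = trans (List.length-++ (map (f x) ys))
    (cong₂ ℕ._+_ (List.length-map (f x) ys) (length-cartesianProductWith f xs ys))

  length-allVecs : ∀ {A : Set} (xs : List A) n → length (allVecs xs n) ≡ length xs ℕ.^ n
  length-allVecs xs zero    = refl
  length-allVecs xs (suc n) = trans (length-cartesianProductWith _∷_ xs (allVecs xs n))
    (cong (length xs ℕ.*_) (length-allVecs xs n))

  not-∨ : ∀ a {b} → T (not (a ∨ b)) → T (not a) × T (not b)
  not-∨ false h = _ , h

  not-any : ∀ {A : Set} (p : A → Bool) {x} xs → T (not (any p xs)) → x ∈ xs → T (not (p x))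
  not-any p (x ∷ xs) h (here refl)  = proj₁ (not-∨ (p x) h)
  not-any p (x ∷ xs) h (there x∈xs) = not-any p xs (proj₂ (not-∨ (p x) h)) x∈xs

  not-≤ᵇ : ∀ {m n} → T (not (m ≤ᵇ n)) → n ℕ.< m
  not-≤ᵇ {m} {n} h = ℕ.≰⇒> (λ m≤n → contradict (m ≤ᵇ n) h (ℕ.≤⇒≤ᵇ m≤n))
    where
    contradict : ∀ b → T (not b) → ¬ T b
    contradict false _ ()

  rare-≤ : ∀ {m n x} → 0ℚ ≤ x → m ℕ.≤ n → ι n * x ≤ 1ℚ → ι m * x ≤ 1ℚ
  rare-≤ {m} {n} {x} 0≤x m≤n = ℚ.≤-trans (*-monoʳ x 0≤x (ι-mono m≤n))

  m∸n≤o⇒m≤o+n : ∀ {m n o} → m ℕ.∸ n ℕ.≤ o → m ℕ.≤ o ℕ.+ n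
  m∸n≤o⇒m≤o+n {m} {n} {o} h = subst (m ℕ.≤_) (ℕ.+-comm n o) (ℕ.≤-trans (ℕ.m≤n+m∸n m n) (ℕ.+-monoʳ-≤ n h))

  -- The triangle condition is only imposed on vertices of moderate degree, so that resampling the
  -- edges off v turns it into an upper tail for a fixed set of pairs.
  module Event (q n D j₁ j₂ j₃ j₄ : ℕ) where

    open Tilt D using (lo; hi)
    -- Triangles are only an error term, so thresholds of ratio 3 are precise enough: `lo₁ j` is 2j
    -- and `hi₁ j` is 6j.
    open Tilt 1 using () renaming (lo to lo₁; hi to hi₁)

    badTriangles badVertex : Fin n → Graph n → Bool
    badTriangles v G = (degree G v <ᵇ hi j₂) ∧ (hi₁ j₃ ≤ᵇ edges (neighbours G v) G)
    badVertex v G = (degree G v ≤ᵇ lo j₁) ∨ ((hi j₂ ≤ᵇ degree G v) ∨ badTriangles v G)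

    badColouring : Vec (Fin q) n → Graph n → Bool
    badColouring φ G = edges (sameColour φ) G ≤ᵇ lo j₄

    bad typical : Graph n → Bool
    bad G = any (λ v → badVertex v G) (allFin n) ∨ any (λ φ → badColouring φ G) (allVecs (allFin q) n)
    typical G = not (bad G)

    module Consequences (G : Graph n) (G-typical : T (typical G)) where

      private
        vertex : ∀ v → T (not (badVertex v G))
        vertex v = not-any (λ v → badVertex v G) (allFin n) (proj₁ (not-∨ (any (λ v → badVertex v G) (allFin n)) G-typical)) (∈-allFin v)

      lo<degree : ∀ v → lo j₁ ℕ.< degree G v
      lo<degree v = not-≤ᵇ (proj₁ (not-∨ (degree G v ≤ᵇ lo j₁) (vertex v)))

      degree<hi : ∀ v → degree G v ℕ.< hi j₂
      degree<hi v = not-≤ᵇ (proj₁ (not-∨ (hi j₂ ≤ᵇ degree G v) (proj₂ (not-∨ (degree G v ≤ᵇ lo j₁) (vertex v)))))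

      triangles<hi : ∀ v → edges (neighbours G v) G ℕ.< hi₁ j₃
      triangles<hi v = not-≤ᵇ (not-∧ (degree G v <ᵇ hi j₂) (ℕ.<⇒<ᵇ (degree<hi v))
        (proj₂ (not-∨ (hi j₂ ≤ᵇ degree G v) (proj₂ (not-∨ (degree G v ≤ᵇ lo j₁) (vertex v))))))
        where
        not-∧ : ∀ a {b} → T a → T (not (a ∧ b)) → T (not b)
        not-∧ true _ h = h

      lo<monochromatic : ∀ φ → lo j₄ ℕ.< edges (sameColour φ) G
      lo<monochromatic φ = not-≤ᵇ (not-any (λ φ → badColouring φ G) (allVecs (allFin q) n)
        (proj₂ (not-∨ (any (λ v → badVertex v G) (allFin n)) G-typical)) (∈-allVecs φ))

    module Likely (r : ℚ) (0≤r : 0ℚ ≤ r) (r≤1 : r ≤ 1ℚ) where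

      open Expectation r
      open Monotone 0≤r r≤1

      -- After resampling, the outer graph G fixes N(v) and the inner graph G′ supplies the edges
      -- inside. If the degree is below `hi j₂`, N(v) has at most (hi j₂)²/2 pairs and the upper
      -- tail applies; otherwise the event is empty.
      badTriangles-rare : ∀ {R} → ι R * r ≤ 1ℚ → hi j₂ ℕ.* hi j₂ ℕ.≤ 2 ℕ.* (R ℕ.* lo₁ j₃) →
        ∀ v → ι (2 ℕ.^ j₃) * prob (badTriangles v) ≤ 1ℚ
      badTriangles-rare {R} Rr≤1 few-pairs v = begin
        c * prob (badTriangles v)
          ≡⟨ cong (c *_) (EG-resample v (indicator ∘ badTriangles v)) ⟨
        c * EG (λ G → EG (λ G′ → indicator (badTriangles v (mergeStar v G G′))))
          ≡⟨ EG-* c (λ G → EG (λ G′ → indicator (badTriangles v (mergeStar v G G′)))) ⟨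
        EG (λ G → c * EG (λ G′ → indicator (badTriangles v (mergeStar v G G′))))
          ≤⟨ EG-≤ conditionally ⟩
        1ℚ ∎
        where
        open ℚ.≤-Reasoning
        c : ℚ
        c = ι (2 ℕ.^ j₃)
        conditionally : ∀ G → c * EG (λ G′ → indicator (badTriangles v (mergeStar v G G′))) ≤ 1ℚ
        conditionally G = subst (λ x → c * x ≤ 1ℚ)
          (EG-cong (λ G′ → cong₂ (λ m e → indicator ((m <ᵇ hi j₂) ∧ (hi₁ j₃ ≤ᵇ e)))
            (sym (degree-mergeStar v G G′)) (sym (edges-neighbours-mergeStar v G G′))))
          tail
          where
          tail : c * EG (λ G′ → indicator ((degree G v <ᵇ hi j₂) ∧ (hi₁ j₃ ≤ᵇ edges (neighbours G v) G′))) ≤ 1ℚ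
          tail with degree G v <ᵇ hi j₂ in eq
          ... | false = subst (_≤ 1ℚ) (sym (trans (cong (c *_) (EG-const {n} 0ℚ)) (ℚ.*-zeroʳ c))) 0≤1
          ... | true  = Tails.upper-tail r 0≤r r≤1 1 (neighbours G v) j₃ {R} Rr≤1
            (ℕ.*-cancelˡ-≤ 2 (ℕ.≤-trans (size-neighbours G v) (ℕ.≤-trans (ℕ.*-mono-≤ deg≤ deg≤) few-pairs)))
            where
            deg≤ : degree G v ℕ.≤ hi j₂
            deg≤ = ℕ.<⇒≤ (ℕ.<ᵇ⇒< (degree G v) (hi j₂) (subst T (sym eq) _))

      typical-likely : ∀ {R R′} → 1 ℕ.≤ n → 1 ℕ.≤ q → ι R * r ≤ 1ℚ → 1ℚ ≤ ι R′ * r →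
        R′ ℕ.* hi j₁ ℕ.≤ n ℕ.∸ 1 → n ℕ.≤ R ℕ.* lo j₂ → hi j₂ ℕ.* hi j₂ ℕ.≤ 2 ℕ.* (R ℕ.* lo₁ j₃) →
        (∀ (φ : Vec (Fin q) n) → R′ ℕ.* hi j₄ ℕ.≤ size (sameColour φ)) →
        3 ℕ.* (n ℕ.* (2 ℕ.* D)) ℕ.≤ 2 ℕ.^ j₁ → 3 ℕ.* (n ℕ.* (2 ℕ.* D)) ℕ.≤ 2 ℕ.^ j₂ →
        3 ℕ.* (n ℕ.* (2 ℕ.* D)) ℕ.≤ 2 ℕ.^ j₃ → q ℕ.^ n ℕ.* (2 ℕ.* D) ℕ.≤ 2 ℕ.^ j₄ →
        ι D * (1ℚ - prob typical) ≤ 1ℚ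
      typical-likely {R} {R′} 1≤n 1≤q Rr≤1 1≤R′r star-large star-small few-pairs class-large J₁ J₂ J₃ J₄ =
        subst (λ x → ι D * x ≤ 1ℚ) (sym complement) (*-cancelˡ (ι 2) (ι-pos {2} (ℕ.s≤s ℕ.z≤n)) (begin
          ι 2 * (ι D * prob bad)
            ≡⟨ trans (sym (ℚ.*-assoc (ι 2) (ι D) (prob bad))) (cong (_* prob bad) (sym (ι-* 2 D))) ⟩
          ι (2 ℕ.* D) * prob bad
            ≤⟨ *-monoˡ (ι (2 ℕ.* D)) (ι-nonNeg (2 ℕ.* D)) (prob-∨ someVertex someColouring) ⟩
          ι (2 ℕ.* D) * (prob someVertex + prob someColouring)
            ≡⟨ ℚ.*-distribˡ-+ (ι (2 ℕ.* D)) (prob someVertex) (prob someColouring) ⟩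
          ι (2 ℕ.* D) * prob someVertex + ι (2 ℕ.* D) * prob someColouring
            ≤⟨ ℚ.+-mono-≤ someVertex-rare someColouring-rare ⟩
          ι 2 * 1ℚ ∎))
        where
        open ℚ.≤-Reasoning
        open Tails r 0≤r r≤1 D
        someVertex someColouring : Graph n → Bool
        someVertex G = any (λ v → badVertex v G) (allFin n)
        someColouring G = any (λ φ → badColouring φ G) (allVecs (allFin q) n)

        complement : 1ℚ - prob typical ≡ prob bad
        complement = trans (cong (_- prob typical)
            (trans (sym (EG-const {n} 1ℚ)) (trans (EG-cong (λ G → indicator-not (bad G))) (EG-+ (indicator ∘ typical) (indicator ∘ bad)))))
          (solve 2 (λ t b → t :+ b :- t := b) refl (prob typical) (prob bad))
          where
          indicator-not : ∀ b → 1ℚ ≡ indicator (not b) + indicator b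
          indicator-not false = refl
          indicator-not true  = refl

        cancel : ∀ {x N} M → 1 ℕ.≤ N → ι (N ℕ.* M) * x ≤ ι N → ι M * x ≤ 1ℚ
        cancel {x} {N} M 1≤N h = *-cancelˡ (ι N) (ι-pos 1≤N) (subst₂ _≤_
          (trans (cong (_* x) (ι-* N M)) (ℚ.*-assoc (ι N) (ι M) x)) (sym (ℚ.*-identityʳ (ι N))) h)

        badVertex-rare : ∀ v → ι (n ℕ.* (2 ℕ.* D)) * prob (badVertex v) ≤ 1ℚ
        badVertex-rare v = cancel {prob (badVertex v)} {3} (n ℕ.* (2 ℕ.* D)) (ℕ.s≤s ℕ.z≤n) (begin
          c * prob (badVertex v)
            ≤⟨ *-monoˡ c (ι-nonNeg N) (ℚ.≤-trans
                 (prob-∨ small (λ G → big G ∨ badTriangles v G))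
                 (ℚ.+-monoʳ-≤ (prob small) (prob-∨ big (badTriangles v)))) ⟩
          c * (prob small + (prob big + prob (badTriangles v)))
            ≡⟨ distribute c (prob small) (prob big) (prob (badTriangles v)) ⟩
          c * prob small + (c * prob big + c * prob (badTriangles v))
            ≤⟨ ℚ.+-mono-≤
                 (rare-≤ {N} {2 ℕ.^ j₁} (prob-nonNeg small) J₁ small-rare)
                 (ℚ.+-mono-≤ (rare-≤ {N} {2 ℕ.^ j₂} (prob-nonNeg big) J₂ big-rare)
                   (rare-≤ {N} {2 ℕ.^ j₃} (prob-nonNeg (badTriangles v)) J₃ (badTriangles-rare {R} Rr≤1 few-pairs v))) ⟩
          ι 3 ∎)
          where
          N = 3 ℕ.* (n ℕ.* (2 ℕ.* D))
          c : ℚ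
          c = ι N
          small big : Graph n → Bool
          small G = degree G v ≤ᵇ lo j₁
          big G = hi j₂ ≤ᵇ degree G v
          distribute : ∀ c x y z → c * (x + (y + z)) ≡ c * x + (c * y + c * z)
          distribute = solve 4 (λ c x y z → c :* (x :+ (y :+ z)) := c :* x :+ (c :* y :+ c :* z)) refl
          small-rare : ι (2 ℕ.^ j₁) * prob small ≤ 1ℚ
          small-rare = subst (λ x → ι (2 ℕ.^ j₁) * x ≤ 1ℚ)
            (EG-cong (λ G → cong (λ e → indicator (e ≤ᵇ lo j₁)) (edges-star G v)))
            (lower-tail (star v) j₁ {R′} 1≤R′r (subst (R′ ℕ.* hi j₁ ℕ.≤_) (sym (size-star v)) star-large))
          big-rare : ι (2 ℕ.^ j₂) * prob big ≤ 1ℚ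
          big-rare = subst (λ x → ι (2 ℕ.^ j₂) * x ≤ 1ℚ)
            (EG-cong (λ G → cong (λ e → indicator (hi j₂ ≤ᵇ e)) (edges-star G v)))
            (upper-tail (star v) j₂ {R} Rr≤1 (ℕ.≤-trans (ℕ.≤-reflexive (size-star v)) (ℕ.≤-trans (ℕ.m∸n≤m n 1) star-small)))

        someVertex-rare : ι (2 ℕ.* D) * prob someVertex ≤ 1ℚ
        someVertex-rare = cancel {prob someVertex} {n} (2 ℕ.* D) 1≤n
          (subst (λ l → ι (n ℕ.* (2 ℕ.* D)) * prob someVertex ≤ ι l) (List.length-tabulate (λ (v : Fin n) → v))
            (prob-any badVertex (ι (n ℕ.* (2 ℕ.* D))) (ι-nonNeg (n ℕ.* (2 ℕ.* D))) badVertex-rare (allFin n)))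

        someColouring-rare : ι (2 ℕ.* D) * prob someColouring ≤ 1ℚ
        someColouring-rare = cancel {prob someColouring} {q ℕ.^ n} (2 ℕ.* D) (ℕ.m^n>0 q {{ℕ.>-nonZero 1≤q}} n)
          (subst (λ l → ι (q ℕ.^ n ℕ.* (2 ℕ.* D)) * prob someColouring ≤ ι l)
            (trans (length-allVecs (allFin q) n) (cong (ℕ._^ n) (List.length-tabulate (λ (c : Fin q) → c))))
            (prob-any badColouring (ι (q ℕ.^ n ℕ.* (2 ℕ.* D))) (ι-nonNeg (q ℕ.^ n ℕ.* (2 ℕ.* D)))
              (λ φ → rare-≤ {q ℕ.^ n ℕ.* (2 ℕ.* D)} {2 ℕ.^ j₄} (prob-nonNeg (badColouring φ)) J₄
                (lower-tail (sameColour φ) j₄ {R′} 1≤R′r (class-large φ)))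
              (allVecs (allFin q) n)))

  module Typical (q n D j₁ j₂ j₃ j₄ : ℕ) (1≤n : 1 ℕ.≤ n) (G : Graph n) (G-typical : T (Event.typical q n D j₁ j₂ j₃ j₄ G)) where

    open Tilt D using (lo; hi)
    open Tilt 1 using () renaming (lo to lo₁; hi to hi₁)
    open Event q n D j₁ j₂ j₃ j₄
    open Consequences G G-typical
    open ℕ.≤-Reasoning

    private
      H : Graph n
      H = deleteTriangles G

    δ-lower : lo j₁ ℕ.≤ δ H ℕ.+ 2 ℕ.* hi₁ j₃
    δ-lower = m∸n≤o⇒m≤o+n (≤δ H 1≤n λ v → ℕ.m≤n+o⇒m∸n≤o _ (2 ℕ.* hi₁ j₃) (begin
      lo j₁                                                  ≤⟨ ℕ.<⇒≤ (lo<degree v) ⟩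
      degree G v                                             ≤⟨ degree-deleteTriangles G v ⟩
      degree H v ℕ.+ 2 ℕ.* edges (neighbours G v) G          ≤⟨ ℕ.+-monoʳ-≤ (degree H v) (ℕ.*-monoʳ-≤ 2 (ℕ.<⇒≤ (triangles<hi v))) ⟩
      degree H v ℕ.+ 2 ℕ.* hi₁ j₃                            ≡⟨ ℕ.+-comm (degree H v) _ ⟩
      2 ℕ.* hi₁ j₃ ℕ.+ degree H v                            ∎))

    degree-upper : ∀ v → degree G v ℕ.≤ hi j₂
    degree-upper v = ℕ.<⇒≤ (degree<hi v)

    -- By the handshake identity the event for j₂ also bounds the number of edges, so that
    -- `del-upper` rests on degrees alone.
    2*edgeCount-upper : 2 ℕ.* edgeCount G ℕ.≤ n ℕ.* hi j₂
    2*edgeCount-upper = subst (ℕ._≤ n ℕ.* hi j₂) (handshake G) (∑-bound degree-upper)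

    δ-upper : δ H ℕ.≤ hi j₂
    δ-upper = δ≤ H 1≤n λ v → begin
      degree H v                                ≡⟨ degree≡∑ H v ⟩
      ∑ (λ j → ⟦ adj H v j ⟧)                   ≤⟨ ∑-mono (λ j → ⟦⟧-mono (deleteTriangles-⊆ G v j)) ⟩
      ∑ (λ j → ⟦ adj G v j ⟧)                   ≡⟨ degree≡∑ G v ⟨
      degree G v                                ≤⟨ degree-upper v ⟩
      hi j₂                                     ∎
      where
      ⟦⟧-mono : ∀ {a b} → (T a → T b) → ⟦ a ⟧ ℕ.≤ ⟦ b ⟧
      ⟦⟧-mono {false}         _   = ℕ.z≤n
      ⟦⟧-mono {true}  {true}  _   = ℕ.≤-refl
      ⟦⟧-mono {true}  {false} a⇒b = ⊥-elim (a⇒b _)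

    -- The loss to triangles is bounded by the same number for every colouring and therefore passes
    -- through the minimum.
    del-lower : 1 ℕ.≤ q → lo j₄ ℕ.≤ del q H ℕ.+ n ℕ.* hi₁ j₃
    del-lower 1≤q = m∸n≤o⇒m≤o+n (≤del H 1≤q λ φ → ℕ.m≤n+o⇒m∸n≤o _ (n ℕ.* hi₁ j₃) (begin
      lo j₄                                                                          ≤⟨ ℕ.<⇒≤ (lo<monochromatic φ) ⟩
      edges (sameColour φ) G                                                         ≤⟨ edges-deleteTriangles G (sameColour φ) ⟩
      edges (sameColour φ) H ℕ.+ ∑ (λ v → edges (neighbours G v) G)                  ≤⟨ ℕ.+-monoʳ-≤ (edges (sameColour φ) H) (∑-bound (λ v → ℕ.<⇒≤ (triangles<hi v))) ⟩
      edges (sameColour φ) H ℕ.+ n ℕ.* hi₁ j₃                                    ≡⟨ cong (ℕ._+ n ℕ.* hi₁ j₃) (monochromatic≡edges H φ) ⟨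
      monochromatic H φ ℕ.+ n ℕ.* hi₁ j₃                                         ≡⟨ ℕ.+-comm (monochromatic H φ) _ ⟩
      n ℕ.* hi₁ j₃ ℕ.+ monochromatic H φ                                         ∎))

    del-upper : 1 ℕ.≤ q → 2 ℕ.* q ℕ.* del q H ℕ.≤ n ℕ.* hi j₂
    del-upper 1≤q = begin
      2 ℕ.* q ℕ.* del q H                ≡⟨ ℕ.*-assoc 2 q (del q H) ⟩
      2 ℕ.* (q ℕ.* del q H)              ≤⟨ ℕ.*-monoʳ-≤ 2 (ℕ.≤-trans (q*del≤edgeCount H 1≤q) (edgeCount-deleteTriangles G)) ⟩
      2 ℕ.* edgeCount G                  ≤⟨ 2*edgeCount-upper ⟩
      n ℕ.* hi j₂                    ∎

-- Thresholds as natural numbers: rounding errors and the choice of parameters.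

module Scales where

  open Counting using (∑; term≤∑)
  open import Data.Fin.Base using (Fin)
  open import Data.Fin.Patterns using (0F; 1F; 2F; 3F; 4F; 5F; 6F; 7F; 8F)
  open import Data.Nat.Base
  open import Data.Nat.DivMod using (_/_; _%_; m≡m%n+[m/n]*n; m%n<n; /-monoˡ-≤; m*n/n≡m)
  open import Data.Nat.Properties
  open import Data.Nat.Tactic.RingSolver using (solve-∀)
  open import Data.Product.Base using (∃; _×_; _,_; proj₁; proj₂)
  open import Data.Vec.Base using (Vec; []; _∷_; lookup)
  open import Relation.Binary.PropositionalEquality
  open ≤-Reasoning

  n≤2^n : ∀ n → n ≤ 2 ^ n
  n≤2^n zero    = z≤n
  n≤2^n (suc n) = begin
    1 + n                   ≤⟨ +-mono-≤ (m^n>0 2 n) (n≤2^n n) ⟩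
    2 ^ n + 2 ^ n           ≡⟨ cong (2 ^ n +_) (+-identityʳ (2 ^ n)) ⟨
    2 ^ suc n               ∎

  module Approx (D : ℕ) (1≤D : 1 ≤ D) where

    private
      instance
        D≢0 : NonZero D
        D≢0 = >-nonZero 1≤D

    infix 4 _≲[_]_
    -- x ≤ (1 + e/D) y with the denominator cleared: the index counts relative errors in units of
    -- 1/D.
    _≲[_]_ : ℕ → ℕ → ℕ → Set
    x ≲[ e ] y = D * x ≤ (D + e) * y

    ≲-≤-trans : ∀ {e x y z} → x ≲[ e ] y → y ≤ z → x ≲[ e ] z
    ≲-≤-trans {e} x≲y y≤z = ≤-trans x≲y (*-monoʳ-≤ (D + e) y≤z)

    ≤-≲-trans : ∀ {e x y z} → x ≤ y → y ≲[ e ] z → x ≲[ e ] z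
    ≤-≲-trans x≤y y≲z = ≤-trans (*-monoʳ-≤ D x≤y) y≲z

    -- In (1 + e/D)(1 + f/D) the last term ef/D² is enlarged to ef/D, as D ≥ 1.
    ≲-trans : ∀ {e f x y z} → x ≲[ e ] y → y ≲[ f ] z → x ≲[ e + f + e * f ] z
    ≲-trans {e} {f} {x} {y} {z} x≲y y≲z = *-cancelˡ-≤ D (begin
      D * (D * x)                                    ≤⟨ *-monoʳ-≤ D x≲y ⟩
      D * ((D + e) * y)                              ≡⟨ swap D (D + e) y ⟩
      (D + e) * (D * y)                              ≤⟨ *-monoʳ-≤ (D + e) y≲z ⟩
      (D + e) * ((D + f) * z)                        ≡⟨ expand D e f z ⟩
      (D * D + D * (e + f)) * z + 1 * (e * f * z)    ≤⟨ +-monoʳ-≤ ((D * D + D * (e + f)) * z) (*-monoˡ-≤ (e * f * z) 1≤D) ⟩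
      (D * D + D * (e + f)) * z + D * (e * f * z)    ≡⟨ collect D e f z ⟩
      D * ((D + (e + f + e * f)) * z)                ∎)
      where
      swap : ∀ a b c → a * (b * c) ≡ b * (a * c)
      swap = solve-∀
      expand : ∀ D e f z → (D + e) * ((D + f) * z) ≡ (D * D + D * (e + f)) * z + 1 * (e * f * z)
      expand = solve-∀
      collect : ∀ D e f z → (D * D + D * (e + f)) * z + D * (e * f * z) ≡ D * ((D + (e + f + e * f)) * z)
      collect = solve-∀

    ≲-* : ∀ {e x y} k → x ≲[ e ] y → k * x ≲[ e ] k * y
    ≲-* {e} {x} {y} k x≲y = begin
      D * (k * x)          ≡⟨ swap D k x ⟩
      k * (D * x)          ≤⟨ *-monoʳ-≤ k x≲y ⟩
      k * ((D + e) * y)    ≡⟨ swap k (D + e) y ⟩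
      (D + e) * (k * y)    ∎
      where
      swap : ∀ a b c → a * (b * c) ≡ b * (a * c)
      swap = solve-∀

    module _ (a b T : ℕ) (D≤T : D ≤ T) (1≤b : 1 ≤ b) (bT≤a : b * T ≤ a) where

      private
        instance
          b≢0 : NonZero b
          b≢0 = >-nonZero 1≤b

        j : ℕ
        j = a / b

        T≤j : T ≤ j
        T≤j = subst (_≤ j) (m*n/n≡m T b) (/-monoˡ-≤ b (subst (_≤ a) (*-comm b T) bT≤a))

        bj≤a : b * j ≤ a
        bj≤a = subst₂ _≤_ (*-comm j b) (sym (m≡m%n+[m/n]*n a b)) (m≤n+m (j * b) (a % b))

        a≤b+bj : a ≤ b + b * j
        a≤b+bj = subst₂ _≤_ (sym (m≡m%n+[m/n]*n a b)) (cong (b +_) (*-comm j b)) (+-monoˡ-≤ (j * b) (<⇒≤ (m%n<n a b)))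

      -- Rounding to a multiple of b loses at most b, which is a share of at most 1/D because the
      -- quotient is at least T ≥ D. The bound T ≤ j is later what makes 2^j outweigh a union bound.
      floor : ∃ λ j → T ≤ j × b * j ≤ a × a ≲[ 1 ] b * j
      floor = j , T≤j , bj≤a , (begin
        D * a                      ≤⟨ *-monoʳ-≤ D a≤b+bj ⟩
        D * (b + b * j)            ≡⟨ *-distribˡ-+ D b (b * j) ⟩
        D * b + D * (b * j)        ≤⟨ +-monoˡ-≤ (D * (b * j)) (*-monoˡ-≤ b (≤-trans D≤T T≤j)) ⟩
        j * b + D * (b * j)        ≡⟨ collect j b D ⟩
        (D + 1) * (b * j)          ∎)
        where
        collect : ∀ j b D → j * b + D * (b * j) ≡ (D + 1) * (b * j)
        collect = solve-∀

      ceiling : ∃ λ j → T ≤ j × a ≤ b * j × b * j ≲[ 1 ] a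
      ceiling = suc j , m≤n⇒m≤1+n T≤j , subst (a ≤_) (sym (*-suc b j)) a≤b+bj , (begin
        D * (b * suc j)            ≡⟨ expand D b j ⟩
        D * (b * j) + b * D        ≤⟨ +-mono-≤ (*-monoʳ-≤ D bj≤a) (≤-trans (*-monoʳ-≤ b D≤T) bT≤a) ⟩
        D * a + a                  ≡⟨ collect D a ⟩
        (D + 1) * a                ∎)
        where
        expand : ∀ D b j → D * (b * suc j) ≡ D * (b * j) + b * D
        expand = solve-∀
        collect : ∀ D a → D * a + a ≡ (D + 1) * a
        collect = solve-∀

    ≲-∸ : ∀ n m → (D + 1) * m ≤ n → n ≲[ 1 ] n ∸ m
    ≲-∸ n m h = +-cancelʳ-≤ ((D + 1) * m) (D * n) ((D + 1) * (n ∸ m)) (begin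
      D * n + (D + 1) * m                ≤⟨ +-monoʳ-≤ (D * n) h ⟩
      D * n + n                          ≡⟨ collect D n ⟩
      (D + 1) * n                        ≡⟨ cong ((D + 1) *_) (m∸n+n≡m m≤n) ⟨
      (D + 1) * (n ∸ m + m)              ≡⟨ *-distribˡ-+ (D + 1) (n ∸ m) m ⟩
      (D + 1) * (n ∸ m) + (D + 1) * m    ∎)
      where
      collect : ∀ D n → D * n + n ≡ (D + 1) * n
      collect = solve-∀
      m≤n : m ≤ n
      m≤n = ≤-trans (m≤n*m m (D + 1) {{>-nonZero (m≤n+m 1 D)}}) h

  -- M is a count scaled by R in place of 1/p, N the value it should have, and t the scaled loss to
  -- triangles. The constants come from `≲-trans`: 2 + 1 + 2·1 = 5, and 1 + 1 + 1·1 = 3 followed by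
  -- 5 makes 3 + 5 + 3·5 = 23.
  record Close (D N M : ℕ) : Set where
    field
      t     : ℕ
      small : D * t ≤ N
      lower : D * N ≤ (D + 23) * (M + t)
      upper : D * M ≤ (D + 5) * N

  module Parameters (q D : ℕ) (1≤q : 1 ≤ q) (1≤D : 1 ≤ D) where

    open Approx D 1≤D

    c₀ c₁ : ℕ
    c₀ = D * suc D
    c₁ = suc D * suc (suc D)

    -- The constants by which n / (R (1 + L)), R²/n or R must exceed 1 in Choice, where R plays the role of
    -- 1/p and 1 + L bounds log₂ n.
    requirements : Vec ℕ 9
    requirements =
        4 * c₁ * (1 + 6 * D) + 1
      ∷ c₀ * (1 + 6 * D)
      ∷ 12 * D * q * (1 + 6 * D)
      ∷ 8 * q * c₁ * (q + 2 * D) + q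
      ∷ (D + 1) * 1
      ∷ (D + 1) * q
      ∷ 216 * D * q
      ∷ 3 * D
      ∷ 1
      ∷ []

    abstract

      K : ℕ
      K = ∑ (lookup requirements)

      ≤K : ∀ i → lookup requirements i ≤ K
      ≤K = term≤∑ (lookup requirements)

    module Choice (n R L : ℕ) (n<2^[1+L] : n < 2 ^ suc L) (KRL≤n : K * (R * suc L) ≤ n)
      (Kn≤RR : K * n ≤ R * R) (K≤R : K ≤ R) where

      private
        W : ℕ
        W = suc L

        1≤R : 1 ≤ R
        1≤R = ≤-trans (≤K 8F) K≤R

        instance
          R≢0 : NonZero R
          R≢0 = >-nonZero 1≤R
          D≢0 : NonZero D
          D≢0 = >-nonZero 1≤D
          q≢0 : NonZero q
          q≢0 = >-nonZero 1≤q
          c₀≢0 : NonZero c₀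
          c₀≢0 = m*n≢0 D (suc D)

        kRW≤n : ∀ i → lookup requirements i * (R * W) ≤ n
        kRW≤n i = ≤-trans (*-monoˡ-≤ (R * W) (≤K i)) KRL≤n

        kR≤n : ∀ i → lookup requirements i * R ≤ n
        kR≤n i = ≤-trans (*-monoʳ-≤ (lookup requirements i) (m≤m*n R W)) (kRW≤n i)

        k≤n : ∀ i → lookup requirements i ≤ n
        k≤n i = ≤-trans (m≤m*n (lookup requirements i) R) (kR≤n i)

        -- Exponents for the union bounds: 2^T is at least 3n · 2D for the vertices, as n < 2^W, and
        -- 2^T′ is at least q^n · 2D for the colourings.
        T T′ : ℕ
        T = W + 6 * D
        T′ = q * n + 2 * D

        D≤T : D ≤ T
        D≤T = ≤-trans (m≤n*m D 6) (m≤n+m (6 * D) W)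

        D≤T′ : D ≤ T′
        D≤T′ = ≤-trans (m≤n*m D 2) (m≤n+m (2 * D) (q * n))

        T≤ : T ≤ W * (1 + 6 * D)
        T≤ = begin
          W + 6 * D             ≤⟨ +-monoʳ-≤ W (m≤n*m (6 * D) W) ⟩
          W + W * (6 * D)       ≡⟨ *-suc W (6 * D) ⟨
          W * (1 + 6 * D)       ∎

        R+3≤4R : R + 3 ≤ 4 * R
        R+3≤4R = begin
          R + 3 * 1             ≤⟨ +-monoʳ-≤ R (*-monoʳ-≤ 3 1≤R) ⟩
          4 * R                 ∎

        1≤n : 1 ≤ n
        1≤n = k≤n 8F

        c₁≤3c₀ : c₁ ≤ 3 * c₀
        c₁≤3c₀ = begin
          suc D * suc (suc D)       ≡⟨ *-comm (suc D) (2 + D) ⟩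
          (2 * 1 + D) * suc D       ≤⟨ *-monoˡ-≤ (suc D) (+-monoˡ-≤ D (*-monoʳ-≤ 2 1≤D)) ⟩
          (2 * D + D) * suc D       ≡⟨ eq D ⟩
          3 * c₀                    ∎
          where
          eq : ∀ D → (2 * D + D) * suc D ≡ 3 * (D * suc D)
          eq = solve-∀

        -- Each j is chosen to bring b j close to n - 1, n, n and n(n - q) respectively. Lower tails
        -- use R + 3, where (R + 3) r ≥ 1, and upper tails use R. The 12 in `b₃` is 2 · 6: a loss of
        -- `2 * hi₁ j₃` edges at a vertex, or of `n * hi₁ j₃` edges altogether, is then a relative
        -- error of at most 1/D, also after the factor 2q of `close-del`.
        b₁ b₂ b₃ b₄ : ℕ
        b₁ = (R + 3) * c₁
        b₂ = R * c₀
        b₃ = 12 * D * q * R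
        b₄ = 2 * q * ((R + 3) * c₁)

        b₁T≤n∸1 : b₁ * T ≤ n ∸ 1
        b₁T≤n∸1 = m+n≤o⇒m≤o∸n (b₁ * T) (begin
          (R + 3) * c₁ * T + 1
            ≤⟨ +-mono-≤ (*-mono-≤ (*-monoˡ-≤ c₁ R+3≤4R) T≤) (m≤m*n 1 (R * W) {{m*n≢0 R W}}) ⟩
          4 * R * c₁ * (W * (1 + 6 * D)) + 1 * (R * W)
            ≡⟨ eq R c₁ W (1 + 6 * D) ⟩
          (4 * c₁ * (1 + 6 * D) + 1) * (R * W)
            ≤⟨ kRW≤n 0F ⟩
          n ∎)
          where
          eq : ∀ R c W x → 4 * R * c * (W * x) + 1 * (R * W) ≡ (4 * c * x + 1) * (R * W)
          eq = solve-∀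

        b₂T≤n : b₂ * T ≤ n
        b₂T≤n = begin
          R * c₀ * T                        ≤⟨ *-monoʳ-≤ (R * c₀) T≤ ⟩
          R * c₀ * (W * (1 + 6 * D))        ≡⟨ eq R c₀ W (1 + 6 * D) ⟩
          c₀ * (1 + 6 * D) * (R * W)        ≤⟨ kRW≤n 1F ⟩
          n                                 ∎
          where
          eq : ∀ R c W x → R * c * (W * x) ≡ c * x * (R * W)
          eq = solve-∀

        b₃T≤n : b₃ * T ≤ n
        b₃T≤n = begin
          12 * D * q * R * T                          ≤⟨ *-monoʳ-≤ b₃ T≤ ⟩
          12 * D * q * R * (W * (1 + 6 * D))          ≡⟨ eq R (12 * D * q) W (1 + 6 * D) ⟩
          12 * D * q * (1 + 6 * D) * (R * W)          ≤⟨ kRW≤n 2F ⟩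
          n                                           ∎
          where
          eq : ∀ R c W x → c * R * (W * x) ≡ c * x * (R * W)
          eq = solve-∀

        -- T′ is linear in n, but the number of monochromatic pairs is quadratic. So n has to exceed
        -- only a multiple of R here, whereas the bounds for vertices take a multiple of R W.
        b₄T′≤ : b₄ * T′ ≤ n * (n ∸ q)
        b₄T′≤ = begin
          2 * q * ((R + 3) * c₁) * (q * n + 2 * D)
            ≤⟨ *-mono-≤ (*-monoʳ-≤ (2 * q) (*-monoˡ-≤ c₁ R+3≤4R)) (+-monoʳ-≤ (q * n) (m≤m*n (2 * D) n {{>-nonZero 1≤n}})) ⟩
          2 * q * (4 * R * c₁) * (q * n + 2 * D * n)
            ≡⟨ eq q R c₁ n D ⟩
          n * (8 * q * c₁ * (q + 2 * D) * R)
            ≤⟨ *-monoʳ-≤ n (m+n≤o⇒m≤o∸n _ (≤-trans (begin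
                 8 * q * c₁ * (q + 2 * D) * R + q        ≤⟨ +-monoʳ-≤ _ (m≤m*n q R) ⟩
                 8 * q * c₁ * (q + 2 * D) * R + q * R    ≡⟨ *-distribʳ-+ R (8 * q * c₁ * (q + 2 * D)) q ⟨
                 (8 * q * c₁ * (q + 2 * D) + q) * R      ∎) (kR≤n 3F))) ⟩
          n * (n ∸ q) ∎
          where
          eq : ∀ q R c n D → 2 * q * (4 * R * c) * (q * n + 2 * D * n) ≡ n * (8 * q * c * (q + 2 * D) * R)
          eq = solve-∀

        1≤* : ∀ {a b} → 1 ≤ a → 1 ≤ b → 1 ≤ a * b
        1≤* = *-mono-≤ {1} {_} {1}

        1≤c₁ : 1 ≤ c₁
        1≤c₁ = s≤s z≤n

        1≤R+3 : 1 ≤ R + 3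
        1≤R+3 = ≤-trans 1≤R (m≤m+n R 3)

        choice₁ : ∃ λ j → T ≤ j × b₁ * j ≤ n ∸ 1 × n ∸ 1 ≲[ 1 ] b₁ * j
        choice₁ = floor (n ∸ 1) b₁ T D≤T (1≤* 1≤R+3 1≤c₁) b₁T≤n∸1

        choice₂ : ∃ λ j → T ≤ j × n ≤ b₂ * j × b₂ * j ≲[ 1 ] n
        choice₂ = ceiling n b₂ T D≤T (1≤* 1≤R (>-nonZero⁻¹ c₀)) b₂T≤n

        choice₃ : ∃ λ j → T ≤ j × b₃ * j ≤ n × n ≲[ 1 ] b₃ * j
        choice₃ = floor n b₃ T D≤T (1≤* (1≤* (1≤* {12} (s≤s z≤n) 1≤D) 1≤q) 1≤R) b₃T≤n

        choice₄ : ∃ λ j → T′ ≤ j × b₄ * j ≤ n * (n ∸ q) × n * (n ∸ q) ≲[ 1 ] b₄ * j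
        choice₄ = floor (n * (n ∸ q)) b₄ T′ D≤T′ (1≤* (1≤* {2} (s≤s z≤n) 1≤q) (1≤* 1≤R+3 1≤c₁)) b₄T′≤

      j₁ j₂ j₃ j₄ : ℕ
      j₁ = proj₁ choice₁
      j₂ = proj₁ choice₂
      j₃ = proj₁ choice₃
      j₄ = proj₁ choice₄

      private
        b₁j₁≤n∸1 = proj₁ (proj₂ (proj₂ choice₁))
        n∸1≲b₁j₁ = proj₂ (proj₂ (proj₂ choice₁))
        n≤b₂j₂   = proj₁ (proj₂ (proj₂ choice₂))
        b₂j₂≲n   = proj₂ (proj₂ (proj₂ choice₂))
        b₃j₃≤n   = proj₁ (proj₂ (proj₂ choice₃))
        n≲b₃j₃   = proj₂ (proj₂ (proj₂ choice₃))
        b₄j₄≤    = proj₁ (proj₂ (proj₂ choice₄))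
        ≲b₄j₄    = proj₂ (proj₂ (proj₂ choice₄))

        power : ∀ {j} → T ≤ j → 3 * (n * (2 * D)) ≤ 2 ^ j
        power {j} T≤j = begin
          3 * (n * (2 * D))              ≡⟨ eq n D ⟩
          n * (6 * D)                    ≤⟨ *-mono-≤ (<⇒≤ n<2^[1+L]) (n≤2^n (6 * D)) ⟩
          2 ^ W * 2 ^ (6 * D)            ≡⟨ ^-distribˡ-+-* 2 W (6 * D) ⟨
          2 ^ T                          ≤⟨ ^-monoʳ-≤ 2 T≤j ⟩
          2 ^ j                          ∎
          where
          eq : ∀ n D → 3 * (n * (2 * D)) ≡ n * (6 * D)
          eq = solve-∀

      power₁ : 3 * (n * (2 * D)) ≤ 2 ^ j₁
      power₁ = power (proj₁ (proj₂ choice₁))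

      power₂ : 3 * (n * (2 * D)) ≤ 2 ^ j₂
      power₂ = power (proj₁ (proj₂ choice₂))

      power₃ : 3 * (n * (2 * D)) ≤ 2 ^ j₃
      power₃ = power (proj₁ (proj₂ choice₃))

      power₄ : q ^ n * (2 * D) ≤ 2 ^ j₄
      power₄ = begin
        q ^ n * (2 * D)                  ≤⟨ *-mono-≤ (^-monoˡ-≤ n (n≤2^n q)) (n≤2^n (2 * D)) ⟩
        (2 ^ q) ^ n * 2 ^ (2 * D)        ≡⟨ cong (_* 2 ^ (2 * D)) (^-*-assoc 2 q n) ⟩
        2 ^ (q * n) * 2 ^ (2 * D)        ≡⟨ ^-distribˡ-+-* 2 (q * n) (2 * D) ⟨
        2 ^ T′                           ≤⟨ ^-monoʳ-≤ 2 (proj₁ (proj₂ choice₄)) ⟩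
        2 ^ j₄                           ∎

      star-large : (R + 3) * (c₁ * j₁) ≤ n ∸ 1
      star-large = subst (_≤ n ∸ 1) (*-assoc (R + 3) c₁ j₁) b₁j₁≤n∸1

      star-small : n ≤ R * (c₀ * j₂)
      star-small = subst (n ≤_) (*-assoc R c₀ j₂) n≤b₂j₂

      class-large : ∀ s → n * n ≤ q * (n + 2 * s) → (R + 3) * (c₁ * j₄) ≤ s
      class-large s h = *-cancelˡ-≤ (2 * q) {{m*n≢0 2 q}} (begin
        2 * q * ((R + 3) * (c₁ * j₄))      ≡⟨ eq q (R + 3) c₁ j₄ ⟩
        b₄ * j₄                            ≤⟨ b₄j₄≤ ⟩
        n * (n ∸ q)                        ≡⟨ *-distribˡ-∸ n n q ⟩
        n * n ∸ n * q                      ≤⟨ m≤n+o⇒m∸n≤o (n * n) (n * q) (≤-trans h (≤-reflexive (eq′ q n s))) ⟩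
        2 * q * s                          ∎)
        where
        eq : ∀ q a c j → 2 * q * (a * (c * j)) ≡ 2 * q * (a * c) * j
        eq = solve-∀
        eq′ : ∀ q n s → q * (n + 2 * s) ≡ n * q + 2 * q * s
        eq′ = solve-∀

      private
        D+1≤2D : D + 1 ≤ 2 * D
        D+1≤2D = ≤-trans (+-monoʳ-≤ D 1≤D) (≤-reflexive (cong (D +_) (sym (+-identityʳ D))))

        double : ∀ {x y} → x ≲[ 1 ] y → x ≤ 2 * y
        double {x} {y} x≲y = *-cancelˡ-≤ D (≤-trans x≲y (≤-trans (*-monoˡ-≤ y D+1≤2D) (≤-reflexive (eq D y))))
          where
          eq : ∀ D y → 2 * D * y ≡ D * (2 * y)
          eq = solve-∀

      -- Here np² → 0 enters, in the form 216 D q n ≤ R². The expected number of edges in N(v),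
      -- about p(pn)²/2, must not exceed `lo₁ j₃` = 2 j₃, which is about pn/(6Dq). Multiplied by R²,
      -- the left side is a product of two factors at most 6n, one of which is traded for j₃;
      -- `1 * 2 * j₃` is `lo₁ j₃` unfolded.
      few-pairs : c₁ * j₂ * (c₁ * j₂) ≤ 2 * (R * (1 * 2 * j₃))
      few-pairs = *-cancelˡ-≤ (R * R) {{m*n≢0 R R}} (begin
        R * R * (c₁ * j₂ * (c₁ * j₂))                    ≡⟨ square R (c₁ * j₂) ⟩
        R * (c₁ * j₂) * (R * (c₁ * j₂))                  ≤⟨ *-mono-≤ Rhi≤6n (≤-trans Rhi≤6n (*-monoʳ-≤ 6 (double n≲b₃j₃))) ⟩
        6 * n * (6 * (2 * (12 * D * q * R * j₃)))        ≡⟨ eq n D q R j₃ ⟩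
        216 * D * q * n * (2 * (R * (1 * 2 * j₃)))       ≤⟨ *-monoˡ-≤ (2 * (R * (1 * 2 * j₃))) (≤-trans (*-monoˡ-≤ n (≤K 6F)) Kn≤RR) ⟩
        R * R * (2 * (R * (1 * 2 * j₃)))                 ∎)
        where
        square : ∀ R h → R * R * (h * h) ≡ R * h * (R * h)
        square = solve-∀
        eq : ∀ n D q R j → 6 * n * (6 * (2 * (12 * D * q * R * j))) ≡ 216 * D * q * n * (2 * (R * (1 * 2 * j)))
        eq = solve-∀
        Rhi≤6n : R * (c₁ * j₂) ≤ 6 * n
        Rhi≤6n = begin
          R * (c₁ * j₂)              ≤⟨ *-monoʳ-≤ R (*-monoˡ-≤ j₂ c₁≤3c₀) ⟩
          R * (3 * c₀ * j₂)          ≡⟨ eq₁ R c₀ j₂ ⟩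
          3 * (b₂ * j₂)              ≤⟨ *-monoʳ-≤ 3 (double b₂j₂≲n) ⟩
          3 * (2 * n)                ≡⟨ *-assoc 3 2 n ⟨
          6 * n                      ∎
          where
          eq₁ : ∀ R c j → R * (3 * c * j) ≡ 3 * (R * c * j)
          eq₁ = solve-∀

      R+3≲R : R + 3 ≲[ 1 ] R
      R+3≲R = begin
        D * (R + 3)            ≡⟨ eq D R ⟩
        D * R + 3 * D          ≤⟨ +-monoʳ-≤ (D * R) (≤-trans (≤K 7F) K≤R) ⟩
        D * R + R              ≡⟨ eq′ D R ⟩
        (D + 1) * R            ∎
        where
        eq : ∀ D R → D * (R + 3) ≡ D * R + 3 * D
        eq = solve-∀
        eq′ : ∀ D R → D * R + R ≡ (D + 1) * R
        eq′ = solve-∀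

      private
        c₁≲c₀ : c₁ ≲[ 2 ] c₀
        c₁≲c₀ = ≤-reflexive (eq D)
          where
          eq : ∀ D → D * (suc D * suc (suc D)) ≡ (D + 2) * (D * suc D)
          eq = solve-∀

        [R+3]c₁j≲Rc₀j : ∀ j → (R + 3) * c₁ * j ≲[ 5 ] R * c₀ * j
        [R+3]c₁j≲Rc₀j j = subst₂ (_≲[ 5 ]_) (*-comm j _) (*-comm j _)
          (≲-* {5} j (≲-trans {1} {2} {(R + 3) * c₁} {R * c₁}
            (subst₂ (_≲[ 1 ]_) (*-comm c₁ (R + 3)) (*-comm c₁ R) (≲-* {1} {R + 3} {R} c₁ R+3≲R))
            (≲-* {2} R c₁≲c₀)))

        chain : ∀ {N M j} → N ≲[ 1 ] M → M ≲[ 1 ] (R + 3) * c₁ * j → N ≲[ 23 ] R * c₀ * j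
        chain {N} {M} {j} N≲M M≲ = ≲-trans {3} {5} {N} {(R + 3) * c₁ * j} (≲-trans {1} {1} {N} {M} N≲M M≲) ([R+3]c₁j≲Rc₀j j)

        Rc₁j₂≲n : R * (c₁ * j₂) ≲[ 5 ] n
        Rc₁j₂≲n = ≲-trans {2} {1} {R * (c₁ * j₂)} {R * c₀ * j₂}
          (subst₂ (_≲[ 2 ]_) (eq R j₂ c₁) (eq′ R j₂ c₀) (≲-* {2} (R * j₂) c₁≲c₀)) b₂j₂≲n
          where
          eq : ∀ R j c → R * j * c ≡ R * (c * j)
          eq = solve-∀
          eq′ : ∀ R j c → R * j * c ≡ R * c * j
          eq′ = solve-∀

      -- `2 * 3 * j₃` is `hi₁ j₃` unfolded. The factor 1 in front of `R * x` stands where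
      -- `close-del` has 2q, so that `close⇒dist` serves both.
      close-degree : ∀ x → c₀ * j₁ ≤ x + 2 * (2 * 3 * j₃) → x ≤ c₁ * j₂ → Close D n (1 * (R * x))
      close-degree x lower upper = record
        { t     = R * (2 * (2 * 3 * j₃))
        ; small = begin
            D * (R * (2 * (2 * 3 * j₃)))        ≡⟨ eq D R j₃ ⟩
            12 * D * 1 * R * j₃                 ≤⟨ *-monoˡ-≤ j₃ (*-monoˡ-≤ R (*-monoʳ-≤ (12 * D) 1≤q)) ⟩
            b₃ * j₃                             ≤⟨ b₃j₃≤n ⟩
            n                                   ∎
        ; lower = ≲-≤-trans {23} {n} (chain {n} {n ∸ 1} {j₁} (≲-∸ n 1 (k≤n 4F)) n∸1≲b₁j₁) (begin
            R * c₀ * j₁                                   ≡⟨ *-assoc R c₀ j₁ ⟩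
            R * (c₀ * j₁)                                 ≤⟨ *-monoʳ-≤ R lower ⟩
            R * (x + 2 * (2 * 3 * j₃))                    ≡⟨ eq′ R x (2 * (2 * 3 * j₃)) ⟩
            1 * (R * x) + R * (2 * (2 * 3 * j₃))          ∎)
        ; upper = ≤-≲-trans {5} (≤-trans (≤-reflexive (*-identityˡ (R * x))) (*-monoʳ-≤ R upper)) Rc₁j₂≲n
        }
        where
        eq : ∀ D R j → D * (R * (2 * (2 * 3 * j))) ≡ 12 * D * 1 * R * j
        eq = solve-∀
        eq′ : ∀ R x y → R * (x + y) ≡ 1 * (R * x) + R * y
        eq′ = solve-∀

      close-del : ∀ y → c₀ * j₄ ≤ y + n * (2 * 3 * j₃) → 2 * q * y ≤ n * (c₁ * j₂) → Close D (n * n) (2 * q * (R * y))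
      close-del y lower upper = record
        { t     = 2 * q * (R * (n * (2 * 3 * j₃)))
        ; small = begin
            D * (2 * q * (R * (n * (2 * 3 * j₃))))        ≡⟨ eq D q R n j₃ ⟩
            n * (b₃ * j₃)                                 ≤⟨ *-monoʳ-≤ n b₃j₃≤n ⟩
            n * n                                         ∎
        ; lower = ≲-≤-trans {23} {n * n}
            (≲-trans {3} {5} {n * n} {b₄ * j₄}
              (≲-trans {1} {1} {n * n} {n * (n ∸ q)} (≲-* {1} n (≲-∸ n q (k≤n 5F))) ≲b₄j₄)
              (subst (_≲[ 5 ] 2 * q * (R * c₀ * j₄)) (sym (*-assoc (2 * q) ((R + 3) * c₁) j₄)) (≲-* {5} (2 * q) ([R+3]c₁j≲Rc₀j j₄))))
            (begin
              2 * q * (R * c₀ * j₄)                                        ≡⟨ cong (2 * q *_) (*-assoc R c₀ j₄) ⟩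
              2 * q * (R * (c₀ * j₄))                                      ≤⟨ *-monoʳ-≤ (2 * q) (*-monoʳ-≤ R lower) ⟩
              2 * q * (R * (y + n * (2 * 3 * j₃)))                         ≡⟨ eq′ (2 * q) R y (n * (2 * 3 * j₃)) ⟩
              2 * q * (R * y) + 2 * q * (R * (n * (2 * 3 * j₃)))           ∎)
        ; upper = ≤-≲-trans {5} (begin
            2 * q * (R * y)              ≡⟨ swap (2 * q) R y ⟩
            R * (2 * q * y)              ≤⟨ *-monoʳ-≤ R upper ⟩
            R * (n * (c₁ * j₂))          ≡⟨ swap R n (c₁ * j₂) ⟩
            n * (R * (c₁ * j₂))          ∎) (≲-* {5} n Rc₁j₂≲n)
        }
        where
        eq : ∀ D q R n j → D * (2 * q * (R * (n * (2 * 3 * j)))) ≡ n * (12 * D * q * R * j)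
        eq = solve-∀
        eq′ : ∀ Q R y z → Q * (R * (y + z)) ≡ Q * (R * y) + Q * (R * z)
        eq′ = solve-∀
        swap : ∀ a b c → a * (b * c) ≡ b * (a * c)
        swap = solve-∀

-- From natural-number estimates to distances between rationals.

module Estimates where

  open import Defs hiding (_+_; _*_; _≤_; _<_; _-_; -_; ∣_∣)
  open Rationals
  open Scales using (Close)
  import Data.Integer.Base as ℤ
  open import Data.Empty using (⊥-elim)
  open import Data.Nat.Base as ℕ using (ℕ; zero; suc)
  import Data.Nat.Properties as ℕ
  open import Data.Product.Base using (∃; _×_; _,_)
  open import Data.Rational.Base
  import Data.Rational.Properties as ℚ
  open import Data.Rational.Solver using (module +-*-Solver)
  open import Data.Sum.Base using (inj₁; inj₂)
  open import Relation.Binary.PropositionalEquality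
  open import Relation.Nullary using (yes; no)
  open +-*-Solver using (solve; _:=_; _:+_; _:*_; _:-_; :-_; con)

  module _ {d ρ X y n t r : ℚ} (1≤d : 1ℚ ≤ d) (0<ρ : 0ℚ < ρ) (0≤n : 0ℚ ≤ n) (0≤r : 0ℚ ≤ r)
    (y≡ : y ≡ r * n) (ρr≤1 : ρ * r ≤ 1ℚ) (1≤[ρ+3]r : 1ℚ ≤ (ρ + ι 3) * r) (0≤X : 0ℚ ≤ X)
    (R+3≲R : d * (ρ + ι 3) ≤ (d + 1ℚ) * ρ) where

    private
      0≤d : 0ℚ ≤ d
      0≤d = ℚ.≤-trans 0≤1 1≤d

      0<d : 0ℚ < d
      0<d = ℚ.<-≤-trans 0<1 1≤d

      0≤y : 0ℚ ≤ y
      0≤y = subst (0ℚ ≤_) (sym y≡) (*-nonNeg r n 0≤r 0≤n)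

      0≤d+ : ∀ k → 0ℚ ≤ d + ι k
      0≤d+ k = +-nonNeg 0≤d (ι-nonNeg k)

    -- Passing from R + 3 to R costs a factor 1 + 1/d, and (d + 1)(d + 5) ≤ d (d + 11) for d ≥ 1.
    close-upper : d * (ρ * X) ≤ (d + ι 5) * n → d * X ≤ d * 0ℚ + (d + ι 11) * y
    close-upper h = *-cancelˡ d 0<d (*-cancelˡ ρ 0<ρ (begin
      ρ * (d * (d * X))                               ≡⟨ e₁ ρ d X ⟩
      d * (d * (ρ * X))                               ≤⟨ *-monoˡ d 0≤d h ⟩
      d * ((d + ι 5) * n)                             ≡⟨ ℚ.*-identityʳ _ ⟨
      d * ((d + ι 5) * n) * 1ℚ                        ≤⟨ *-monoˡ (d * ((d + ι 5) * n)) (*-nonNeg d _ 0≤d (*-nonNeg (d + ι 5) n (0≤d+ 5) 0≤n)) 1≤[ρ+3]r ⟩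
      d * ((d + ι 5) * n) * ((ρ + ι 3) * r)           ≡⟨ e₂ d n (ρ + ι 3) r (ι 5) ⟩
      d * (ρ + ι 3) * ((d + ι 5) * (r * n))           ≤⟨ *-monoʳ ((d + ι 5) * (r * n)) (*-nonNeg (d + ι 5) (r * n) (0≤d+ 5) (*-nonNeg r n 0≤r 0≤n)) R+3≲R ⟩
      (d + 1ℚ) * ρ * ((d + ι 5) * (r * n))            ≡⟨ cong (λ y → (d + 1ℚ) * ρ * ((d + ι 5) * y)) y≡ ⟨
      (d + 1ℚ) * ρ * ((d + ι 5) * y)                  ≤⟨ ≤-by (ρ * (y * (ι 5 * (d - 1ℚ)))) (*-nonNeg ρ _ (ℚ.<⇒≤ 0<ρ) (*-nonNeg y _ 0≤y (*-nonNeg (ι 5) (d - 1ℚ) (ι-nonNeg 5) (≤⇒0≤- 1≤d)))) (e₃ d ρ y) ⟩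
      ρ * (d * (d * 0ℚ + (d + ι 11) * y))             ∎))
      where
      open ℚ.≤-Reasoning
      e₁ : ∀ ρ d X → ρ * (d * (d * X)) ≡ d * (d * (ρ * X))
      e₁ = solve 3 (λ ρ d X → ρ :* (d :* (d :* X)) := d :* (d :* (ρ :* X))) refl
      e₂ : ∀ d n s r f → d * ((d + f) * n) * (s * r) ≡ d * s * ((d + f) * (r * n))
      e₂ = solve 5 (λ d n s r f → d :* ((d :+ f) :* n) :* (s :* r) := d :* s :* ((d :+ f) :* (r :* n))) refl
      e₃ : ∀ d ρ y → ρ * (d * (d * 0ℚ + (d + ι 11) * y)) ≡ (d + 1ℚ) * ρ * ((d + ι 5) * y) + ρ * (y * (ι 5 * (d - 1ℚ)))
      e₃ = solve 3 (λ d ρ y → ρ :* (d :* (d :* con 0ℚ :+ (d :+ con (ι 11)) :* y))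
              := (d :+ con 1ℚ) :* ρ :* ((d :+ con (ι 5)) :* y) :+ ρ :* (y :* (con (ι 5) :* (d :- con 1ℚ)))) refl

    -- The factor 1 + 23/d accounts for 23 y, and the loss t, which is at most n/d, for one more y.
    -- Their sum 24 is the numerator of `tolerance`.
    close-lower : d * t ≤ n → d * n ≤ (d + ι 23) * (ρ * X + t) → d * y ≤ d * X + ι 24 * y
    close-lower dt≤n h = *-cancelˡ (d + ι 23) (ℚ.<-≤-trans 0<d (≤-+-nonNeg d (ι 23) (ι-nonNeg 23))) (begin
      (d + ι 23) * (d * y)
        ≡⟨ cong (λ y → (d + ι 23) * (d * y)) y≡ ⟩
      (d + ι 23) * (d * (r * n))
        ≡⟨ e₁ d r n (ι 23) ⟩
      r * (d * (d * n)) + ι 23 * (d * (r * n))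
        ≤⟨ ℚ.+-monoˡ-≤ (ι 23 * (d * (r * n))) (*-monoˡ r 0≤r (*-monoˡ d 0≤d h)) ⟩
      r * (d * ((d + ι 23) * (ρ * X + t))) + ι 23 * (d * (r * n))
        ≡⟨ cong (_+ ι 23 * (d * (r * n))) (e₂ d r ρ X t (ι 23)) ⟩
      (d + ι 23) * (d * X * (ρ * r) + r * (d * t)) + ι 23 * (d * (r * n))
        ≤⟨ ℚ.+-monoˡ-≤ (ι 23 * (d * (r * n))) (*-monoˡ (d + ι 23) (0≤d+ 23)
             (ℚ.+-mono-≤ (*-monoˡ (d * X) (*-nonNeg d X 0≤d 0≤X) ρr≤1) (*-monoˡ r 0≤r dt≤n))) ⟩
      (d + ι 23) * (d * X * 1ℚ + r * n) + ι 23 * (d * (r * n))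
        ≡⟨ cong (λ y → (d + ι 23) * (d * X * 1ℚ + y) + ι 23 * (d * y)) y≡ ⟨
      (d + ι 23) * (d * X * 1ℚ + y) + ι 23 * (d * y)
        ≤⟨ ≤-by (ι 23 * (ι 23 * y)) (*-nonNeg (ι 23) _ (ι-nonNeg 23) (*-nonNeg (ι 23) y (ι-nonNeg 23) 0≤y)) (e₃ d X y) ⟩
      (d + ι 23) * (d * X + ι 24 * y) ∎)
      where
      open ℚ.≤-Reasoning
      e₁ : ∀ d r n e → (d + e) * (d * (r * n)) ≡ r * (d * (d * n)) + e * (d * (r * n))
      e₁ = solve 4 (λ d r n e → (d :+ e) :* (d :* (r :* n)) := r :* (d :* (d :* n)) :+ e :* (d :* (r :* n))) refl
      e₂ : ∀ d r ρ X t e → r * (d * ((d + e) * (ρ * X + t))) ≡ (d + e) * (d * X * (ρ * r) + r * (d * t))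
      e₂ = solve 6 (λ d r ρ X t e → r :* (d :* ((d :+ e) :* (ρ :* X :+ t))) := (d :+ e) :* (d :* X :* (ρ :* r) :+ r :* (d :* t))) refl
      e₃ : ∀ d X y → (d + ι 23) * (d * X + ι 24 * y) ≡ (d + ι 23) * (d * X * 1ℚ + y) + ι 23 * (d * y) + ι 23 * (ι 23 * y)
      e₃ = solve 3 (λ d X y → (d :+ con (ι 23)) :* (d :* X :+ con (ι 24) :* y)
             := (d :+ con (ι 23)) :* (d :* X :* con 1ℚ :+ y) :+ con (ι 23) :* (d :* y) :+ con (ι 23) :* (con (ι 23) :* y)) refl

  ≤-shrink : ∀ {c a b} → 1ℚ ≤ c → 0ℚ ≤ b → c * a ≤ b → a ≤ b
  ≤-shrink {c} {a} {b} 1≤c 0≤b ca≤b with ℚ.≤-total 0ℚ a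
  ... | inj₂ a≤0 = ℚ.≤-trans a≤0 0≤b
  ... | inj₁ 0≤a = ℚ.≤-trans (subst (_≤ c * a) (ℚ.*-identityˡ a) (*-monoʳ a 0≤a 1≤c)) ca≤b

  close⇒dist : ∀ {D R Q N x r w κ} → 1 ℕ.≤ D → 1 ℕ.≤ R → 1 ℕ.≤ Q →
    D ℕ.* (R ℕ.+ 3) ℕ.≤ (D ℕ.+ 1) ℕ.* R → Close D N (Q ℕ.* (R ℕ.* x)) →
    0ℚ ≤ r → ι R * r ≤ 1ℚ → 1ℚ ≤ ι (R ℕ.+ 3) * r →
    ι Q * w ≡ r * ι N → ι D * κ ≡ ι 24 → ∣ ι x - w ∣ ≤ κ * (r * ι N)
  close⇒dist {D} {R} {Q} {N} {x} {r} {w} {κ} 1≤D 1≤R 1≤Q R+3≲R close 0≤r Rr≤1 1≤[R+3]r Qw≡y Dκ≡24 =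
    ∣∣-lub (bound above) (bound below)
    where
    open Close close
    open ℚ.≤-Reasoning
    d ρ X y : ℚ
    d = ι D
    ρ = ι R
    X = ι Q * ι x
    y = r * ι N

    0≤y : 0ℚ ≤ y
    0≤y = *-nonNeg r (ι N) 0≤r (ι-nonNeg N)

    ιM : ι (Q ℕ.* (R ℕ.* x)) ≡ ρ * X
    ιM = trans (ι-* Q (R ℕ.* x)) (trans (cong (ι Q *_) (ι-* R x))
      (solve 3 (λ a b c → a :* (b :* c) := b :* (a :* c)) refl (ι Q) (ι R) (ι x)))

    1≤d : 1ℚ ≤ d
    1≤d = ι-mono 1≤D

    0≤X : 0ℚ ≤ X
    0≤X = *-nonNeg (ι Q) (ι x) (ι-nonNeg Q) (ι-nonNeg x)

    1≤[ρ+3]r : 1ℚ ≤ (ρ + ι 3) * r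
    1≤[ρ+3]r = subst (λ s → 1ℚ ≤ s * r) (ι-+ R 3) 1≤[R+3]r

    ρ+3≲ρ : d * (ρ + ι 3) ≤ (d + 1ℚ) * ρ
    ρ+3≲ρ = subst₂ _≤_ (trans (ι-* D (R ℕ.+ 3)) (cong (d *_) (ι-+ R 3)))
      (trans (ι-* (D ℕ.+ 1) R) (cong (_* ρ) (ι-+ D 1))) (ι-mono R+3≲R)

    upperℚ : d * (ρ * X) ≤ (d + ι 5) * ι N
    upperℚ = subst₂ _≤_ (trans (ι-* D (Q ℕ.* (R ℕ.* x))) (cong (d *_) ιM)) (trans (ι-* (D ℕ.+ 5) N) (cong (_* ι N) (ι-+ D 5))) (ι-mono upper)

    smallℚ : d * ι t ≤ ι N
    smallℚ = subst (_≤ ι N) (ι-* D t) (ι-mono small)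

    lowerℚ : d * ι N ≤ (d + ι 23) * (ρ * X + ι t)
    lowerℚ = subst₂ _≤_ (ι-* D N)
      (trans (ι-* (D ℕ.+ 23) (Q ℕ.* (R ℕ.* x) ℕ.+ t)) (cong₂ _*_ (ι-+ D 23) (trans (ι-+ (Q ℕ.* (R ℕ.* x)) t) (cong (_+ ι t) ιM)))) (ι-mono lower)

    above : ι Q * (d * (ι x - w)) ≤ ι 24 * y
    above = begin
      ι Q * (d * (ι x - w))                  ≡⟨ e₁ (ι Q) d (ι x) w ⟩
      d * X - d * (ι Q * w)                  ≡⟨ cong (λ z → d * X - d * z) Qw≡y ⟩
      d * X - d * y                          ≤⟨ ℚ.+-monoˡ-≤ (- (d * y)) (close-upper {d} {ρ} {X} {y} {ι N} {0ℚ} {r} 1≤d (ι-pos 1≤R) (ι-nonNeg N) 0≤r refl Rr≤1 1≤[ρ+3]r 0≤X ρ+3≲ρ upperℚ) ⟩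
      d * 0ℚ + (d + ι 11) * y - d * y        ≡⟨ e₂ d y (ι 11) ⟩
      ι 11 * y                               ≤⟨ *-monoʳ y 0≤y (ι-mono {11} {24} (ℕ.m≤m+n 11 13)) ⟩
      ι 24 * y                               ∎
      where
      e₁ : ∀ q d x w → q * (d * (x - w)) ≡ d * (q * x) - d * (q * w)
      e₁ = solve 4 (λ q d x w → q :* (d :* (x :- w)) := d :* (q :* x) :- d :* (q :* w)) refl
      e₂ : ∀ d y e → d * 0ℚ + (d + e) * y - d * y ≡ e * y
      e₂ = solve 3 (λ d y e → d :* con 0ℚ :+ (d :+ e) :* y :- d :* y := e :* y) refl

    below : ι Q * (d * (- (ι x - w))) ≤ ι 24 * y
    below = begin
      ι Q * (d * (- (ι x - w)))              ≡⟨ e₁ (ι Q) d (ι x) w ⟩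
      d * (ι Q * w) - d * X                  ≡⟨ cong (λ z → d * z - d * X) Qw≡y ⟩
      d * y - d * X                          ≤⟨ ℚ.+-monoˡ-≤ (- (d * X)) (close-lower {d} {ρ} {X} {y} {ι N} {ι t} {r} 1≤d (ι-pos 1≤R) (ι-nonNeg N) 0≤r refl Rr≤1 1≤[ρ+3]r 0≤X ρ+3≲ρ smallℚ lowerℚ) ⟩
      d * X + ι 24 * y - d * X               ≡⟨ e₂ (d * X) (ι 24 * y) ⟩
      ι 24 * y                               ∎
      where
      e₁ : ∀ q d x w → q * (d * (- (x - w))) ≡ d * (q * w) - d * (q * x)
      e₁ = solve 4 (λ q d x w → q :* (d :* (:- (x :- w))) := d :* (q :* w) :- d :* (q :* x)) refl
      e₂ : ∀ a b → a + b - a ≡ b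
      e₂ = solve 2 (λ a b → a :+ b :- a := b) refl

    -- The factor Q ≥ 1 is dropped: the error is measured against rN, not against w = rN/Q.
    bound : ∀ {e} → ι Q * (d * e) ≤ ι 24 * y → e ≤ κ * y
    bound {e} h = *-cancelˡ d (ι-pos 1≤D) (subst (d * e ≤_)
      (trans (cong (_* y) (sym Dκ≡24)) (ℚ.*-assoc d κ y))
      (≤-shrink {ι Q} {d * e} (ι-mono 1≤Q) (*-nonNeg (ι 24) y (ι-nonNeg 24) 0≤y) h))

  -- A lower bound for the logarithm by harmonic sums.

  fraction≡1-1/suc : ∀ m → ℤ.+ m / suc m ≡ 1ℚ - 1/suc m
  fraction≡1-1/suc m = ℚ.≤-antisym (cancel (ℚ.≤-reflexive eq)) (cancel (ℚ.≤-reflexive (sym eq)))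
    where
    cancel : ∀ {a b} → ι (suc m) * a ≤ ι (suc m) * b → a ≤ b
    cancel = *-cancelˡ (ι (suc m)) (ι-pos {suc m} (ℕ.s≤s ℕ.z≤n))
    eq : ι (suc m) * (ℤ.+ m / suc m) ≡ ι (suc m) * (1ℚ - 1/suc m)
    eq = trans (ι*fraction m m) (sym (trans (expand (ι (suc m)) (1/suc m))
      (trans (cong₂ _-_ (ι-suc m) (ι*1/suc m)) (solve 1 (λ x → con 1ℚ :+ x :- con 1ℚ := x) refl (ι m)))))
      where
      expand : ∀ a u → a * (1ℚ - u) ≡ a - a * u
      expand = solve 2 (λ a u → a :* (con 1ℚ :- u) := a :- a :* u) refl

  harmonic : ℕ → ℚ
  harmonic zero    = 0ℚ
  harmonic (suc k) = harmonic k + 1/suc k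

  1/suc-antimono : ∀ {a b} → a ℕ.≤ b → 1/suc b ≤ 1/suc a
  1/suc-antimono {a} {b} a≤b = fraction-≤ {1} {b} {1} {a} (ℕ.*-monoʳ-≤ 1 (ℕ.s≤s a≤b))

  harmonic-block : ∀ a b c → b ℕ.+ a ℕ.≤ suc c → harmonic a + ι b * 1/suc c ≤ harmonic (b ℕ.+ a)
  harmonic-block a zero    c _ = ℚ.≤-reflexive (trans (cong (harmonic a +_) (ℚ.*-zeroˡ (1/suc c))) (ℚ.+-identityʳ (harmonic a)))
  harmonic-block a (suc b) c h = begin
    harmonic a + ι (suc b) * 1/suc c             ≡⟨ cong (λ x → harmonic a + x * 1/suc c) (ι-suc b) ⟩
    harmonic a + (1ℚ + ι b) * 1/suc c            ≡⟨ expand (harmonic a) (ι b) (1/suc c) ⟩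
    harmonic a + ι b * 1/suc c + 1/suc c         ≤⟨ ℚ.+-mono-≤ (harmonic-block a b c (ℕ.m≤n⇒m≤1+n (ℕ.s≤s⁻¹ h))) (1/suc-antimono (ℕ.s≤s⁻¹ h)) ⟩
    harmonic (b ℕ.+ a) + 1/suc (b ℕ.+ a)         ∎
    where
    open ℚ.≤-Reasoning
    expand : ∀ h b u → h + (1ℚ + b) * u ≡ h + b * u + u
    expand = solve 3 (λ h b u → h :+ (con 1ℚ :+ b) :* u := h :+ b :* u :+ u) refl

  harmonic-mono : ∀ {a b} → a ℕ.≤ b → harmonic a ≤ harmonic b
  harmonic-mono {a} {b} a≤b = subst (λ k → harmonic a ≤ harmonic k) (ℕ.m∸n+n≡m a≤b) (go (b ℕ.∸ a))
    where
    go : ∀ d → harmonic a ≤ harmonic (d ℕ.+ a)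
    go zero    = ℚ.≤-refl
    go (suc d) = ℚ.≤-trans (go d) (≤-+-nonNeg (harmonic (d ℕ.+ a)) (1/suc (d ℕ.+ a)) (1/suc-nonNeg (d ℕ.+ a)))

  -- Oresme's argument: the terms with denominators a + 1 to 2a are each at least 1/(2a), so
  -- doubling the range adds at least one half.
  harmonic-2^ : ∀ L → 1ℚ + ½ * ι L ≤ harmonic (2 ℕ.^ L)
  harmonic-2^ zero    = ℚ.≤-refl
  harmonic-2^ (suc L) = begin
    1ℚ + ½ * ι (suc L)                     ≡⟨ cong (λ x → 1ℚ + ½ * x) (ι-suc L) ⟩
    1ℚ + ½ * (1ℚ + ι L)                    ≡⟨ expand (ι L) ⟩
    1ℚ + ½ * ι L + ½                       ≤⟨ ℚ.+-monoˡ-≤ ½ (harmonic-2^ L) ⟩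
    harmonic a + ½                         ≤⟨ half a (ℕ.m^n>0 2 L) ⟩
    harmonic (a ℕ.+ a)                     ≡⟨ cong (λ x → harmonic (a ℕ.+ x)) (ℕ.+-identityʳ a) ⟨
    harmonic (2 ℕ.^ suc L)                 ∎
    where
    open ℚ.≤-Reasoning
    a = 2 ℕ.^ L
    expand : ∀ l → 1ℚ + ½ * (1ℚ + l) ≡ 1ℚ + ½ * l + ½
    expand = solve 1 (λ l → con 1ℚ :+ con ½ :* (con 1ℚ :+ l) := con 1ℚ :+ con ½ :* l :+ con ½) refl
    half : ∀ a → 1 ℕ.≤ a → harmonic a + ½ ≤ harmonic (a ℕ.+ a)
    half a@(suc b) _ = subst (λ x → harmonic a + x ≤ harmonic (a ℕ.+ a)) eq (harmonic-block a a (b ℕ.+ a) ℕ.≤-refl)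
      where
      c = b ℕ.+ a
      eq : ι a * 1/suc c ≡ ½
      eq = trans (solve 2 (λ a u → a :* u := con ½ :* ((a :+ a) :* u)) refl (ι a) (1/suc c))
        (cong (½ *_) (trans (cong (_* 1/suc c) (sym (ι-+ a a))) (ι*1/suc c)))

  -- The base is 1 - u with u = 1/(m + 1), and Bernoulli gives (1 - u)^k / k ≥ 1/k - u. Each of the
  -- k terms thus loses at most u against the harmonic sum.
  logPartialSum≥ : ∀ m k → harmonic k - ι k * 1/suc m ≤ logPartialSum (ℤ.+ m / suc m) k
  logPartialSum≥ m zero    = ℚ.≤-reflexive (cong (λ x → 0ℚ - x) (ℚ.*-zeroˡ (1/suc m)))
  logPartialSum≥ m (suc k) = begin
    harmonic k + v - ι (suc k) * u
      ≡⟨ cong (λ x → harmonic k + v - x * u) (ι-suc k) ⟩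
    harmonic k + v - (1ℚ + ι k) * u
      ≡⟨ regroup (harmonic k) v (ι k) u ⟩
    harmonic k - ι k * u + (v - u)
      ≤⟨ ℚ.+-mono-≤ (logPartialSum≥ m k) (begin
           v - u                          ≡⟨ cong (λ x → v - x) (trans (sym (ℚ.*-identityˡ u)) (cong (_* u) (sym (ι*1/suc k)))) ⟩
           v - ι (suc k) * v * u          ≡⟨ factor v (ι (suc k)) u ⟩
           (1ℚ - ι (suc k) * u) * v       ≤⟨ *-monoʳ v (1/suc-nonNeg k) (bernoulli⁻ (1/suc-nonNeg m) (1/suc-antimono {0} {m} ℕ.z≤n) (suc k)) ⟩
           (1ℚ - u) ^ suc k * v           ≡⟨ cong (λ x → x ^ suc k * v) (fraction≡1-1/suc m) ⟨
           (ℤ.+ m / suc m) ^ suc k * v    ∎) ⟩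
    logPartialSum (ℤ.+ m / suc m) (suc k) ∎
    where
    open ℚ.≤-Reasoning
    u v : ℚ
    u = 1/suc m
    v = 1/suc k
    regroup : ∀ h v k u → h + v - (1ℚ + k) * u ≡ h - k * u + (v - u)
    regroup = solve 4 (λ h v k u → h :+ v :- (con 1ℚ :+ k) :* u := h :- k :* u :+ (v :- u)) refl
    factor : ∀ v k u → v - k * v * u ≡ (1ℚ - k * u) * v
    factor = solve 3 (λ v k u → v :- k :* v :* u := (con 1ℚ :- k :* u) :* v) refl

  logPartialSum-mono : ∀ {r} → 0ℚ ≤ r → ∀ {a b} → a ℕ.≤ b → logPartialSum r a ≤ logPartialSum r b
  logPartialSum-mono {r} 0≤r {a} {b} a≤b = subst (λ k → logPartialSum r a ≤ logPartialSum r k) (ℕ.m∸n+n≡m a≤b) (go (b ℕ.∸ a))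
    where
    go : ∀ d → logPartialSum r a ≤ logPartialSum r (d ℕ.+ a)
    go zero    = ℚ.≤-refl
    go (suc d) = ℚ.≤-trans (go d) (≤-+-nonNeg (logPartialSum r (d ℕ.+ a)) (r ^ suc (d ℕ.+ a) * 1/suc (d ℕ.+ a))
      (*-nonNeg (r ^ suc (d ℕ.+ a)) (1/suc (d ℕ.+ a)) (^-nonNeg 0≤r (suc (d ℕ.+ a))) (1/suc-nonNeg (d ℕ.+ a))))

  -- After n terms the loss against the harmonic sum is n · (1/n) = 1, exactly the leading 1 in
  -- `harmonic-2^`. From there on the partial sums only grow.
  log-lower : ∀ n L → 2 ℕ.^ L ℕ.≤ n → ∀ i → n ℕ.≤ i → ½ * ι L ≤ seq (log n) i
  log-lower zero    L 2^L≤0 i _   = ⊥-elim (ℕ.<⇒≱ (ℕ.m^n>0 2 L) 2^L≤0)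
  log-lower (suc m) L 2^L≤n i n≤i = begin
    ½ * ι L                                        ≡⟨ shift½ (½ * ι L) ⟩
    1ℚ + ½ * ι L - 1ℚ                              ≤⟨ ℚ.+-monoˡ-≤ (- 1ℚ) (ℚ.≤-trans (harmonic-2^ L) (harmonic-mono 2^L≤n)) ⟩
    harmonic (suc m) - 1ℚ                          ≡⟨ cong (λ x → harmonic (suc m) - x) (ι*1/suc m) ⟨
    harmonic (suc m) - ι (suc m) * 1/suc m         ≤⟨ logPartialSum≥ m (suc m) ⟩
    logPartialSum (ℤ.+ m / suc m) (suc m)          ≤⟨ logPartialSum-mono (fraction-nonNeg m (suc m)) n≤i ⟩
    logPartialSum (ℤ.+ m / suc m) i                ∎
    where
    open ℚ.≤-Reasoning
    shift½ : ∀ x → x ≡ 1ℚ + x - 1ℚ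
    shift½ = solve 1 (λ x → x := con 1ℚ :+ x :- con 1ℚ) refl

  log₂ : ∀ n → 1 ℕ.≤ n → ∃ λ L → 2 ℕ.^ L ℕ.≤ n × n ℕ.< 2 ℕ.^ suc L
  log₂ (suc zero)    _ = 0 , ℕ.≤-refl , ℕ.≤-refl
  log₂ (suc (suc n)) _ with log₂ (suc n) (ℕ.s≤s ℕ.z≤n)
  ... | L , lower , upper with suc (suc n) ℕ.<? 2 ℕ.^ suc L
  ... | yes h = L , ℕ.m≤n⇒m≤1+n lower , h
  ... | no  h = suc L , ℕ.≮⇒≥ h , ℕ.≤-<-trans upper (ℕ.^-monoʳ-< 2 (ℕ.s≤s (ℕ.s≤s ℕ.z≤n)) (ℕ.n<1+n (suc L)))

-- From real hypotheses to the natural-number scale R.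

module Limits where

  open import Defs hiding (_+_; _*_; _≤_; _<_; _-_; -_; ∣_∣)
  open Rationals
  open RandomGraphs using (seq-Pr; module Expectation)
  open Estimates
  open import Data.Bool.Base using (Bool; false)
  open import Data.Empty using (⊥-elim)
  open import Data.Nat.Base as ℕ using (ℕ; zero; suc)
  import Data.Nat.Properties as ℕ
  open import Data.Nat.Tactic.RingSolver using (solve-∀)
  open import Data.Product.Base using (∃; _×_; _,_; proj₁; proj₂)
  open import Data.Rational.Base
  import Data.Rational.Properties as ℚ
  open import Data.Rational.Solver using (module +-*-Solver)
  open import Relation.Binary.PropositionalEquality
  open import Relation.Nullary using (¬_; Dec; yes; no)
  open ℚ-Lemmas using (half-pos; half+half)
  open +-*-Solver using (solve; _:=_; _:+_; _:*_; _:-_; :-_; con)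

  last-true : (P : ℕ → Set) → (∀ m → Dec (P m)) → P 0 → ∀ b → ¬ P b → ∃ λ m → P m × ¬ P (suc m)
  last-true P P? P0 zero    ¬Pb = ⊥-elim (¬Pb P0)
  last-true P P? P0 (suc b) ¬Pb with P? b
  ... | yes Pb = b , Pb , ¬Pb
  ... | no ¬Pb′ = last-true P P? P0 b ¬Pb′

  -- The approximations of p may oscillate forever around some 1/k, which would defeat any window
  -- from 1/(R + 1) to 1/R; the upper end R + 3 leaves room for this.
  record Reciprocal (p : ℝ) (R i₀ : ℕ) : Set where
    field
      0≤seq : ∀ i → i₀ ℕ.≤ i → 0ℚ ≤ seq p i
      upper  : ∀ i → i₀ ℕ.≤ i → ι R * seq p i ≤ 1ℚ
      lower  : ∀ i → i₀ ℕ.≤ i → 1ℚ ≤ ι (R ℕ.+ 3) * seq p i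

  -- A decidable search over rationals finds R with R(ρ + δ′) ≤ 1 < (R + 1)(ρ + δ′), where later
  -- approximations stay within δ′ of ρ. Replacing R + 1 by R + 3 compensates for lowering ρ + δ′ to
  -- ρ - δ′ as soon as (R + 2) δ′ ≤ ρ.
  reciprocal : ∀ p → 0ℝ Defs.< p → ∃ λ R → ∃ λ i₀ → Reciprocal p R i₀
  reciprocal p (ε , 0<ε , M , above) = R , i₀ , record { 0≤seq = λ i i≥ → ℚ.≤-trans 0≤u (u≤ i i≥) ; upper = R-upper ; lower = R-lower }
    where
    open ℚ.≤-Reasoning
    E : ℕ
    E = proj₁ (archimedean 0<ε)
    -- Since ρ ≥ u = 1/(E + 1), R is at most E + 1. The factor v = 1/(E + 3) therefore ensures (R +
    -- 2) δ′ ≤ u ≤ ρ, although R is found only after δ′ is fixed.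
    u v δ′ : ℚ
    u = 1/suc E
    v = 1/suc (suc (suc E))
    δ′ = u * v
    1/suc-pos : ∀ k → 0ℚ < 1/suc k
    1/suc-pos k = ℚ.positive⁻¹ (1/suc k) {{ℚ.normalize-pos 1 (suc k)}}
    0≤u : 0ℚ ≤ u
    0≤u = 1/suc-nonNeg E
    0<δ : 0ℚ < δ′
    0<δ = subst (_< δ′) (ℚ.*-zeroʳ u) (ℚ.*-monoʳ-<-pos u {{positive (1/suc-pos E)}} (1/suc-pos (suc (suc E))))
    0≤δ : 0ℚ ≤ δ′
    0≤δ = ℚ.<⇒≤ 0<δ
    i₀ : ℕ
    i₀ = M ℕ.⊔ proj₁ (cauchy p δ′ 0<δ)
    ρ : ℚ
    ρ = seq p i₀
    u≤ : ∀ i → i₀ ℕ.≤ i → u ≤ seq p i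
    u≤ i i≥ = ℚ.≤-trans (proj₂ (archimedean 0<ε)) (subst (_≤ seq p i) (ℚ.+-identityˡ ε) (above i (ℕ.m⊔n≤o⇒m≤o M _ i≥)))
    dist : ∀ i → i₀ ℕ.≤ i → ∣ seq p i - ρ ∣ ≤ δ′
    dist i i≥ = proj₂ (cauchy p δ′ 0<δ) i i₀ (ℕ.m⊔n≤o⇒n≤o M _ i≥) (ℕ.m⊔n≤o⇒n≤o M _ (ℕ.≤-refl {i₀}))
    P : ℕ → Set
    P m = ι m * (ρ + δ′) ≤ 1ℚ
    ¬Pb : ¬ P (suc (suc E))
    ¬Pb h = ℚ.<-irrefl refl (begin-strict
      1ℚ                                   ≡⟨ ι*1/suc E ⟨
      ι (suc E) * u                        ≡⟨ ℚ.+-identityˡ _ ⟨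
      0ℚ + ι (suc E) * u                   <⟨ ℚ.+-monoˡ-< (ι (suc E) * u) (1/suc-pos E) ⟩
      u + ι (suc E) * u                    ≡⟨ solve 2 (λ u e → u :+ e :* u := (con 1ℚ :+ e) :* u) refl u (ι (suc E)) ⟩
      (1ℚ + ι (suc E)) * u                 ≡⟨ cong (_* u) (ι-suc (suc E)) ⟨
      ι (suc (suc E)) * u                  ≤⟨ *-monoˡ (ι (suc (suc E))) (ι-nonNeg (suc (suc E))) (ℚ.≤-trans (u≤ i₀ ℕ.≤-refl) (≤-+-nonNeg ρ δ′ 0≤δ)) ⟩
      ι (suc (suc E)) * (ρ + δ′)           ≤⟨ h ⟩
      1ℚ                                   ∎)
    found : ∃ λ m → P m × ¬ P (suc m)
    found = last-true P (λ m → ι m * (ρ + δ′) ℚ.≤? 1ℚ) (subst (_≤ 1ℚ) (sym (ℚ.*-zeroˡ (ρ + δ′))) 0≤1) (suc (suc E)) ¬Pb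
    R : ℕ
    R = proj₁ found
    R≤1+E : R ℕ.≤ suc E
    R≤1+E = ι-cancel (*-cancelˡ u (1/suc-pos E) (begin
      u * ι R              ≡⟨ ℚ.*-comm u (ι R) ⟩
      ι R * u              ≤⟨ *-monoˡ (ι R) (ι-nonNeg R) (ℚ.≤-trans (u≤ i₀ ℕ.≤-refl) (≤-+-nonNeg ρ δ′ 0≤δ)) ⟩
      ι R * (ρ + δ′)       ≤⟨ proj₁ (proj₂ found) ⟩
      1ℚ                   ≡⟨ ι*1/suc E ⟨
      ι (suc E) * u        ≡⟨ ℚ.*-comm (ι (suc E)) u ⟩
      u * ι (suc E)        ∎))
    R-upper : ∀ i → i₀ ℕ.≤ i → ι R * seq p i ≤ 1ℚ
    R-upper i i≥ = ℚ.≤-trans (*-monoˡ (ι R) (ι-nonNeg R) (begin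
      seq p i                  ≡⟨ solve 2 (λ x ρ → x := ρ :+ (x :- ρ)) refl (seq p i) ρ ⟩
      ρ + (seq p i - ρ)        ≤⟨ ℚ.+-monoʳ-≤ ρ (ℚ.≤-trans (p≤∣p∣ (seq p i - ρ)) (dist i i≥)) ⟩
      ρ + δ′                   ∎)) (proj₁ (proj₂ found))
    [R+2]δ≤u : ι (R ℕ.+ 2) * δ′ ≤ u
    [R+2]δ≤u = begin
      ι (R ℕ.+ 2) * (u * v)                ≤⟨ *-monoʳ δ′ 0≤δ (ι-mono (ℕ.≤-trans (ℕ.+-monoˡ-≤ 2 R≤1+E) (ℕ.≤-reflexive (ℕ.+-comm (suc E) 2)))) ⟩
      ι (suc (suc (suc E))) * (u * v)      ≡⟨ solve 3 (λ a u v → a :* (u :* v) := u :* (a :* v)) refl (ι (suc (suc (suc E)))) u v ⟩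
      u * (ι (suc (suc (suc E))) * v)      ≡⟨ cong (u *_) (ι*1/suc (suc (suc E))) ⟩
      u * 1ℚ                               ≡⟨ ℚ.*-identityʳ u ⟩
      u                                    ∎
    R-lower : ∀ i → i₀ ℕ.≤ i → 1ℚ ≤ ι (R ℕ.+ 3) * seq p i
    R-lower i i≥ = begin
      1ℚ
        ≤⟨ ℚ.<⇒≤ (ℚ.≰⇒> (proj₂ (proj₂ found))) ⟩
      ι (suc R) * (ρ + δ′)
        ≡⟨ cong (_* (ρ + δ′)) (ι-suc R) ⟩
      (1ℚ + ι R) * (ρ + δ′)
        ≤⟨ ≤-by (ι 2 * (ρ - (ι R + ι 2) * δ′)) (*-nonNeg (ι 2) _ (ι-nonNeg 2) (≤⇒0≤- (subst (λ s → s * δ′ ≤ ρ) (ι-+ R 2) (ℚ.≤-trans [R+2]δ≤u (u≤ i₀ ℕ.≤-refl)))))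
             (identity (ι R) ρ δ′) ⟩
      (ι R + ι 3) * (ρ - δ′)
        ≡⟨ cong (_* (ρ - δ′)) (ι-+ R 3) ⟨
      ι (R ℕ.+ 3) * (ρ - δ′)
        ≤⟨ *-monoˡ (ι (R ℕ.+ 3)) (ι-nonNeg (R ℕ.+ 3)) (begin
             ρ - δ′                              ≤⟨ ℚ.+-monoʳ-≤ ρ (ℚ.neg-antimono-≤ (ℚ.≤-trans (p≤∣p∣ (- (seq p i - ρ))) (subst (_≤ δ′) (sym (ℚ.∣-p∣≡∣p∣ (seq p i - ρ))) (dist i i≥)))) ⟩
             ρ - - (seq p i - ρ)                 ≡⟨ solve 2 (λ x ρ → ρ :- (:- (x :- ρ)) := x) refl (seq p i) ρ ⟩
             seq p i                             ∎) ⟩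
      ι (R ℕ.+ 3) * seq p i ∎
      where
      identity : ∀ s ρ δ′ → (s + ι 3) * (ρ - δ′) ≡ (1ℚ + s) * (ρ + δ′) + ι 2 * (ρ - (s + ι 2) * δ′)
      identity = solve 3 (λ s ρ δ′ → (s :+ con (ι 3)) :* (ρ :- δ′)
        := (con 1ℚ :+ s) :* (ρ :+ δ′) :+ con (ι 2) :* (ρ :- (s :+ con (ι 2)) :* δ′)) refl

  -- 4 K makes up for log n ≥ L / 2 and 1 + L ≤ 2 L, and 16 K² for (R + 3)² ≤ 16 R².
  module Scale {K R n L : ℕ} {r : ℚ} (1≤K : 1 ℕ.≤ K) (2≤n : 2 ℕ.≤ n) (n<2^[1+L] : n ℕ.< 2 ℕ.^ suc L)
    (0≤r : 0ℚ ≤ r) (Rr≤1 : ι R * r ≤ 1ℚ) (1≤[R+3]r : 1ℚ ≤ ι (R ℕ.+ 3) * r)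
    (dense : ι (4 ℕ.* K) * (½ * ι L) ≤ r * ι n) (sparse : ι (16 ℕ.* (K ℕ.* K)) * (ι n * (r * r)) ≤ 1ℚ) where

    private
      1≤L : ∀ L → n ℕ.< 2 ℕ.^ suc L → 1 ℕ.≤ L
      1≤L zero    n<2 = ⊥-elim (ℕ.<⇒≱ n<2 2≤n)
      1≤L (suc L) _   = ℕ.s≤s ℕ.z≤n

      1≤n : 1 ℕ.≤ n
      1≤n = ℕ.≤-trans (ℕ.s≤s ℕ.z≤n) 2≤n

    KR[1+L]≤n : K ℕ.* (R ℕ.* suc L) ℕ.≤ n
    KR[1+L]≤n = ι-cancel (begin
      ι (K ℕ.* (R ℕ.* suc L))                   ≤⟨ ι-mono (ℕ.*-monoʳ-≤ K (ℕ.*-monoʳ-≤ R (ℕ.+-monoˡ-≤ L (1≤L L n<2^[1+L])))) ⟩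
      ι (K ℕ.* (R ℕ.* (L ℕ.+ L)))               ≡⟨ trans (ι-* K _) (cong (ι K *_) (trans (ι-* R _) (cong (ι R *_) (ι-+ L L)))) ⟩
      ι K * (ι R * (ι L + ι L))                 ≡⟨ identity (ι K) (ι R) (ι L) ⟩
      ι R * (ι 4 * ι K * (½ * ι L))             ≡⟨ cong (λ x → ι R * (x * (½ * ι L))) (ι-* 4 K) ⟨
      ι R * (ι (4 ℕ.* K) * (½ * ι L))           ≤⟨ *-monoˡ (ι R) (ι-nonNeg R) dense ⟩
      ι R * (r * ι n)                           ≡⟨ ℚ.*-assoc (ι R) r (ι n) ⟨
      ι R * r * ι n                             ≤⟨ *-monoʳ (ι n) (ι-nonNeg n) Rr≤1 ⟩
      1ℚ * ι n                                  ≡⟨ ℚ.*-identityˡ (ι n) ⟩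
      ι n                                       ∎)
      where
      open ℚ.≤-Reasoning
      identity : ∀ k r l → k * (r * (l + l)) ≡ r * (ι 4 * k * (½ * l))
      identity = solve 3 (λ k r l → k :* (r :* (l :+ l)) := r :* (con (ι 4) :* k :* (con ½ :* l))) refl

    private
      16KKn≤[R+3]² : 16 ℕ.* (K ℕ.* K) ℕ.* n ℕ.≤ (R ℕ.+ 3) ℕ.* (R ℕ.+ 3)
      16KKn≤[R+3]² = ι-cancel (begin
        ι (c ℕ.* n)                               ≡⟨ ι-* c n ⟩
        ι c * ι n                                 ≡⟨ ℚ.*-identityʳ (ι c * ι n) ⟨
        ι c * ι n * 1ℚ                            ≤⟨ *-monoˡ (ι c * ι n) (*-nonNeg (ι c) (ι n) (ι-nonNeg c) (ι-nonNeg n))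
                                                       (*-mono-≤-nonNeg {1ℚ} {s * r} {1ℚ} {s * r} (ℚ.≤-trans 0≤1 1≤[R+3]r) 0≤1 1≤[R+3]r 1≤[R+3]r) ⟩
        ι c * ι n * (s * r * (s * r))             ≡⟨ identity (ι c) (ι n) s r ⟩
        s * s * (ι c * (ι n * (r * r)))           ≤⟨ *-monoˡ (s * s) (*-nonNeg s s (ι-nonNeg (R ℕ.+ 3)) (ι-nonNeg (R ℕ.+ 3))) sparse ⟩
        s * s * 1ℚ                                ≡⟨ trans (ℚ.*-identityʳ (s * s)) (sym (ι-* (R ℕ.+ 3) (R ℕ.+ 3))) ⟩
        ι ((R ℕ.+ 3) ℕ.* (R ℕ.+ 3))               ∎)
        where
        open ℚ.≤-Reasoning
        c = 16 ℕ.* (K ℕ.* K)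
        s = ι (R ℕ.+ 3)
        identity : ∀ c n s r → c * n * (s * r * (s * r)) ≡ s * s * (c * (n * (r * r)))
        identity = solve 4 (λ c n s r → c :* n :* (s :* r :* (s :* r)) := s :* s :* (c :* (n :* (r :* r)))) refl

      open ℕ.≤-Reasoning

      -- For R = 0 the bound 16 K² n ≤ (R + 3)² would give 16 ≤ 9. With R ≥ 1 the step R + 3 ≤ 4R
      -- becomes available.
      1≤R : 1 ℕ.≤ R
      1≤R = ℕ.≮⇒≥ λ R<1 → ℕ.<⇒≱ {9} {16} (ℕ.m≤m+n 10 6) (begin
        16 ℕ.* (1 ℕ.* 1) ℕ.* 1               ≤⟨ ℕ.*-mono-≤ (ℕ.*-monoʳ-≤ 16 (ℕ.*-mono-≤ 1≤K 1≤K)) 1≤n ⟩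
        16 ℕ.* (K ℕ.* K) ℕ.* n               ≤⟨ 16KKn≤[R+3]² ⟩
        (R ℕ.+ 3) ℕ.* (R ℕ.+ 3)              ≡⟨ cong (λ R → (R ℕ.+ 3) ℕ.* (R ℕ.+ 3)) (ℕ.n<1⇒n≡0 R<1) ⟩
        9                                    ∎)

      KKn≤RR : K ℕ.* K ℕ.* n ℕ.≤ R ℕ.* R
      KKn≤RR = ℕ.*-cancelˡ-≤ 16 (begin
        16 ℕ.* (K ℕ.* K ℕ.* n)               ≡⟨ ℕ.*-assoc 16 (K ℕ.* K) n ⟨
        16 ℕ.* (K ℕ.* K) ℕ.* n               ≤⟨ 16KKn≤[R+3]² ⟩
        (R ℕ.+ 3) ℕ.* (R ℕ.+ 3)              ≤⟨ ℕ.*-mono-≤ R+3≤4R R+3≤4R ⟩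
        4 ℕ.* R ℕ.* (4 ℕ.* R)                ≡⟨ identity R ⟩
        16 ℕ.* (R ℕ.* R)                     ∎)
        where
        R+3≤4R : R ℕ.+ 3 ℕ.≤ 4 ℕ.* R
        R+3≤4R = ℕ.+-monoʳ-≤ R (ℕ.*-monoʳ-≤ 3 1≤R)
        identity : ∀ R → 4 ℕ.* R ℕ.* (4 ℕ.* R) ≡ 16 ℕ.* (R ℕ.* R)
        identity = solve-∀

    Kn≤RR : K ℕ.* n ℕ.≤ R ℕ.* R
    Kn≤RR = ℕ.≤-trans (ℕ.*-monoˡ-≤ n (ℕ.m≤m*n K K {{ℕ.>-nonZero 1≤K}})) KKn≤RR

    -- K² ≤ K² n ≤ R²: this is what the square of K in `sparse` provides.
    K≤R : K ℕ.≤ R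
    K≤R = ℕ.≮⇒≥ λ R<K → ℕ.<⇒≱ (ℕ.*-mono-< R<K R<K) (ℕ.≤-trans (ℕ.m≤m*n (K ℕ.* K) n {{ℕ.>-nonZero 1≤n}}) KKn≤RR)

  -- Convergence of real sequences and diagonalisation.

  dist-≤ : ∀ (a b c : ℝ) N → (∀ i → N ℕ.≤ i → ∣ seq a i - seq b i ∣ ≤ seq c i) → Defs.∣ a Defs.- b ∣ Defs.≤ c
  dist-≤ a b c N h ε 0<ε = N , λ i N≤i → ℚ.≤-trans (h i N≤i) (≤-+-nonNeg (seq c i) ε (ℚ.<⇒≤ 0<ε))

  1/ℕ-inverse : ∀ Q → 1 ℕ.≤ Q → ∀ i → ι Q * seq (1/ℕ Q) i ≡ 1ℚ
  1/ℕ-inverse (suc k) _ i = ι*1/suc k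

  record NearOne (D : ℕ) (x : ℝ) : Set where
    field
      i₀     : ℕ
      almost : ∀ i → i₀ ℕ.≤ i → ι D * (1ℚ - seq x i) ≤ 1ℚ
      ≤1     : ∀ i → i₀ ℕ.≤ i → seq x i ≤ 1ℚ

  Pr-nearOne : ∀ {n} D p (A : Graph n → Bool) i₀ →
    (∀ i → i₀ ℕ.≤ i → ι D * (1ℚ - Expectation.prob (seq p i) A) ≤ 1ℚ) →
    (∀ i → i₀ ℕ.≤ i → Expectation.prob (seq p i) A ≤ 1ℚ) → NearOne D (Pr p A)
  Pr-nearOne D p A i₀ almost ≤1 = record
    { i₀     = i₀
    ; almost = λ i i≥ → subst (λ P → ι D * (1ℚ - P) ≤ 1ℚ) (sym (seq-Pr p A i)) (almost i i≥)
    ; ≤1     = λ i i≥ → subst (_≤ 1ℚ) (sym (seq-Pr p A i)) (≤1 i i≥)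
    }

  never : ∀ {n} → Graph n → Bool
  never _ = false

  -- The value at 0 is junk.
  tolerance : ℕ → ℚ
  tolerance zero    = 0ℚ
  tolerance (suc d) = ι 24 * 1/suc d

  tolerance-inverse : ∀ D → 1 ℕ.≤ D → ι D * tolerance D ≡ ι 24
  tolerance-inverse (suc d) _ = trans (swap (ι (suc d)) (ι 24) (1/suc d))
    (trans (cong (ι 24 *_) (ι*1/suc d)) (ℚ.*-identityʳ (ι 24)))
    where
    swap : ∀ a b c → a * (b * c) ≡ b * (a * c)
    swap = solve 3 (λ a b c → a :* (b :* c) := b :* (a :* c)) refl

  -- The diagonalisation: the largest accuracy d + 1 ≤ b whose threshold `N d` has been passed by n,
  -- and 0 if there is none. The bound b keeps the search finite.
  pick : (ℕ → ℕ) → ℕ → ℕ → ℕ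
  pick N n zero    = zero
  pick N n (suc b) with N b ℕ.≤? n
  ... | yes _ = suc b
  ... | no  _ = pick N n b

  pick-satisfies : ∀ {P : ℕ → ℕ → Set} N → (∀ n → P 0 n) → (∀ d n → N d ℕ.≤ n → P (suc d) n) → ∀ n b → P (pick N n b) n
  pick-satisfies N P0 Psuc n zero = P0 n
  pick-satisfies {P} N P0 Psuc n (suc b) with N b ℕ.≤? n
  ... | yes Nb≤n = Psuc b n Nb≤n
  ... | no  _    = pick-satisfies {P} N P0 Psuc n b

  pick-large : ∀ N n b d → d ℕ.< b → N d ℕ.≤ n → d ℕ.< pick N n b
  pick-large N n (suc b) d d<1+b Nd≤n with N b ℕ.≤? n
  ... | yes _    = d<1+b
  ... | no Nb≰n  = pick-large N n b d (ℕ.≤∧≢⇒< (ℕ.s≤s⁻¹ d<1+b) λ { refl → Nb≰n Nd≤n }) Nd≤n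

  Unbounded : (ℕ → ℕ) → Set
  Unbounded k = ∀ d → ∃ λ N → ∀ n → N ℕ.≤ n → d ℕ.< k n

  -- The strict inequality in `TendsTo` asks for a rational gap. Of a rational ε₀ that witnesses 0 <
  -- ε, one half bounds the distance and the other half is the gap.
  tendsTo : ∀ x ℓ →
    (∀ e → 0ℚ < e → ∃ λ N → ∀ n → N ℕ.≤ n → ∃ λ M → ∀ i → M ℕ.≤ i → ∣ seq (x n) i - seq ℓ i ∣ ≤ e) →
    TendsTo x ℓ
  tendsTo x ℓ h ε (ε₀ , 0<ε₀ , M , ε₀≤ε) = N , λ n n≥ →
    let (M′ , dist) = close n n≥
    in ½ * ε₀ , half-pos 0<ε₀ , M ℕ.⊔ M′ , λ i i≥ →
      ℚ.≤-trans (ℚ.+-monoˡ-≤ (½ * ε₀) (dist i (ℕ.m⊔n≤o⇒n≤o M M′ i≥)))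
        (ℚ.≤-trans (ℚ.≤-reflexive (trans (half+half ε₀) (sym (ℚ.+-identityˡ ε₀)))) (ε₀≤ε i (ℕ.m⊔n≤o⇒m≤o M M′ i≥)))
    where
    eventually = h (½ * ε₀) (half-pos 0<ε₀)
    N = proj₁ eventually
    close = proj₂ eventually

  tolerance-tendsTo-0 : ∀ {k} → Unbounded k → TendsTo (λ n → fromℚ (tolerance (k n))) 0ℝ
  tolerance-tendsTo-0 {k} k-unbounded = tendsTo (λ n → fromℚ (tolerance (k n))) 0ℝ λ e 0<e →
    let (e′ , 0<e′ , 24e′≡e) = shrink (ι-pos {24} (ℕ.s≤s ℕ.z≤n)) 0<e
        (d , 1/[1+d]≤e′)     = archimedean 0<e′
        (N , k-large)        = k-unbounded d
    in N , λ n n≥ → 0 , λ i _ → subst (_≤ e) (sym (∣κ-0∣ (k n)))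
         (subst (tolerance (k n) ≤_) 24e′≡e (small d (k n) (k-large n n≥) 1/[1+d]≤e′))
    where
    0≤tolerance : ∀ D → 0ℚ ≤ tolerance D
    0≤tolerance zero    = ℚ.≤-refl
    0≤tolerance (suc d) = *-nonNeg (ι 24) (1/suc d) (ι-nonNeg 24) (1/suc-nonNeg d)
    ∣κ-0∣ : ∀ D → ∣ tolerance D - 0ℚ ∣ ≡ tolerance D
    ∣κ-0∣ D = trans (cong ∣_∣ (ℚ.+-identityʳ (tolerance D))) (ℚ.0≤p⇒∣p∣≡p (0≤tolerance D))
    small : ∀ d D {e′} → d ℕ.< D → 1/suc d ≤ e′ → tolerance D ≤ ι 24 * e′
    small d (suc D) d<1+D h = *-monoˡ (ι 24) (ι-nonNeg 24) (ℚ.≤-trans (1/suc-antimono (ℕ.s≤s⁻¹ d<1+D)) h)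

  nearOne-tendsTo-1 : ∀ {k} x → Unbounded k → (∀ n → NearOne (k n) (x n)) → TendsTo x 1ℝ
  nearOne-tendsTo-1 {k} x k-unbounded x-near = tendsTo x 1ℝ λ e 0<e →
    let (d , 1/[1+d]≤e) = archimedean 0<e
        (N , k-large)   = k-unbounded d
    in N , λ n n≥ → NearOne.i₀ (x-near n) , λ i i≥ → ∣∣-lub
      (ℚ.≤-trans (≤1⇒≤0 (seq (x n) i) (NearOne.≤1 (x-near n) i i≥)) (ℚ.<⇒≤ 0<e))
      (ℚ.≤-trans (ℚ.≤-reflexive (flip (seq (x n) i)))
        (ℚ.≤-trans (invert d (k n) (seq (x n) i) (k-large n n≥) (NearOne.≤1 (x-near n) i i≥) (NearOne.almost (x-near n) i i≥)) 1/[1+d]≤e))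
    where
    flip : ∀ P → - (P - 1ℚ) ≡ 1ℚ - P
    flip = solve 1 (λ P → :- (P :- con 1ℚ) := con 1ℚ :- P) refl
    ≤1⇒≤0 : ∀ P → P ≤ 1ℚ → P - 1ℚ ≤ 0ℚ
    ≤1⇒≤0 P P≤1 = subst (P - 1ℚ ≤_) (ℚ.+-inverseʳ 1ℚ) (ℚ.+-monoˡ-≤ (- 1ℚ) P≤1)
    invert : ∀ d D P → d ℕ.< D → P ≤ 1ℚ → ι D * (1ℚ - P) ≤ 1ℚ → 1ℚ - P ≤ 1/suc d
    invert d D P d<D P≤1 h = *-cancelˡ (ι (suc d)) (ι-pos {suc d} (ℕ.s≤s ℕ.z≤n))
      (ℚ.≤-trans (*-monoʳ (1ℚ - P) (≤⇒0≤- P≤1) (ι-mono d<D)) (subst (ι D * (1ℚ - P) ≤_) (sym (ι*1/suc d)) h))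

  ScaledBy : ℕ → ℕ → ℕ → Set
  ScaledBy K n R = ∃ λ L → n ℕ.< 2 ℕ.^ suc L × K ℕ.* (R ℕ.* suc L) ℕ.≤ n × K ℕ.* n ℕ.≤ R ℕ.* R × K ℕ.≤ R

  -- The conclusions concern natural numbers only, so it is enough to evaluate the real hypotheses
  -- at a single index i beyond all their thresholds, and beyond n for the sake of `log-lower`.
  sparse-dense-scale : ∀ K n p {R i₀} → 1 ℕ.≤ K → 2 ℕ.≤ n → Reciprocal p R i₀ →
    fromℕ (4 ℕ.* K) Defs.* log n Defs.< p Defs.* fromℕ n →
    Defs.∣ fromℕ n Defs.* (p Defs.* p) Defs.- 0ℝ ∣ Defs.< fromℚ (1/suc (16 ℕ.* (K ℕ.* K))) →
    ScaledBy K n R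
  sparse-dense-scale K n p {R} {i₀} 1≤K 2≤n recip (ε , 0<ε , M , above) (ε′ , 0<ε′ , M′ , below) =
    L , n<2^[1+L] , KR[1+L]≤n , Kn≤RR , K≤R
    where
    binary = log₂ n (ℕ.≤-trans (ℕ.s≤s ℕ.z≤n) 2≤n)
    L i c : ℕ
    L = proj₁ binary
    i = (i₀ ℕ.⊔ n) ℕ.⊔ (M ℕ.⊔ M′)
    c = 16 ℕ.* (K ℕ.* K)
    n<2^[1+L] : n ℕ.< 2 ℕ.^ suc L
    n<2^[1+L] = proj₂ (proj₂ binary)
    i₀≤i : i₀ ℕ.≤ i
    i₀≤i = ℕ.≤-trans (ℕ.m≤m⊔n i₀ n) (ℕ.m≤m⊔n (i₀ ℕ.⊔ n) (M ℕ.⊔ M′))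
    n≤i : n ℕ.≤ i
    n≤i = ℕ.≤-trans (ℕ.m≤n⊔m i₀ n) (ℕ.m≤m⊔n (i₀ ℕ.⊔ n) (M ℕ.⊔ M′))
    M≤i : M ℕ.≤ i
    M≤i = ℕ.≤-trans (ℕ.m≤m⊔n M M′) (ℕ.m≤n⊔m (i₀ ℕ.⊔ n) (M ℕ.⊔ M′))
    M′≤i : M′ ℕ.≤ i
    M′≤i = ℕ.≤-trans (ℕ.m≤n⊔m M M′) (ℕ.m≤n⊔m (i₀ ℕ.⊔ n) (M ℕ.⊔ M′))
    r x : ℚ
    r = seq p i
    x = ι n * (r * r)
    0≤r : 0ℚ ≤ r
    0≤r = Reciprocal.0≤seq recip i i₀≤i
    0≤x : 0ℚ ≤ x
    0≤x = *-nonNeg (ι n) (r * r) (ι-nonNeg n) (*-nonNeg r r 0≤r 0≤r)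
    x≤v : x ≤ 1/suc c
    x≤v = ℚ.≤-trans (subst (_≤ ∣ x - 0ℚ ∣) (ℚ.+-identityʳ x) (p≤∣p∣ (x - 0ℚ)))
      (ℚ.≤-trans (≤-+-nonNeg ∣ x - 0ℚ ∣ ε′ (ℚ.<⇒≤ 0<ε′)) (below i M′≤i))
    denseℚ : ι (4 ℕ.* K) * (½ * ι L) ≤ r * ι n
    denseℚ = ℚ.≤-trans (*-monoˡ (ι (4 ℕ.* K)) (ι-nonNeg (4 ℕ.* K)) (log-lower n L (proj₁ (proj₂ binary)) i n≤i))
      (ℚ.≤-trans (≤-+-nonNeg (ι (4 ℕ.* K) * seq (log n) i) ε (ℚ.<⇒≤ 0<ε)) (above i M≤i))
    sparseℚ : ι c * x ≤ 1ℚ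
    sparseℚ = ℚ.≤-trans (*-monoʳ x 0≤x (ι-mono (ℕ.n≤1+n c)))
      (subst (ι (suc c) * x ≤_) (ι*1/suc c) (*-monoˡ (ι (suc c)) (ι-nonNeg (suc c)) x≤v))
    open Scale {K} {R} {n} {L} {r} 1≤K 2≤n n<2^[1+L] 0≤r (Reciprocal.upper recip i i₀≤i) (Reciprocal.lower recip i i₀≤i) denseℚ sparseℚ

-- Assembly of the theorem.

module Conclusion where

  open import Defs hiding (_+_; _*_; _≤_; _<_; _-_; -_; ∣_∣)
  open Rationals
  open Counting using (size; sameColour)
  open RandomGraphs using (module Expectation)
  open TriangleDeletion
  open TypicalGraphs
  open Scales
  open Estimates
  open Limits
  open import Data.Bool.Base using (Bool; T)
  open import Data.Fin.Patterns using (8F)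
  open import Data.Nat.Base as ℕ using (ℕ; suc)
  import Data.Nat.Properties as ℕ
  open import Data.Product.Base using (Σ; ∃; _×_; _,_; proj₁; proj₂)
  open import Data.Rational.Base
  import Data.Rational.Properties as ℚ
  open import Relation.Binary.PropositionalEquality

  module Main (q : ℕ) (2≤q : 2 ℕ.≤ q) (p : ℕ → ℝ) (p-pos : ∀ n → 0ℝ Defs.< p n)
    (p-dense : RatioTendsTo∞ (λ n → p n Defs.* fromℕ n) log)
    (p-sparse : TendsTo (λ n → fromℕ n Defs.* (p n Defs.* p n)) 0ℝ) where

    1≤q : 1 ℕ.≤ q
    1≤q = ℕ.≤-trans (ℕ.s≤s ℕ.z≤n) 2≤q

    Desired : (η θ : ℝ) → ∀ n → Graph n → Set
    Desired η θ n Γ = ∃ λ (H : Graph n) →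
      H ⊆ Γ × TriangleFree H ×
      Defs.∣ fromℕ (δ H) Defs.- p n Defs.* fromℕ n ∣ Defs.≤ η Defs.* (p n Defs.* fromℕ n) ×
      Defs.∣ fromℕ (del q H) Defs.- 1/ℕ (2 ℕ.* q) Defs.* (p n Defs.* fromℕ (n ℕ.^ 2)) ∣ Defs.≤ θ Defs.* (p n Defs.* fromℕ (n ℕ.^ 2))

    -- Event, inclusion and probability bound are kept together, so that D may vary with n and the
    -- chosen events still form the one family that `AAS` asks for.
    Good : ℕ → ℕ → Set
    Good D n = Σ (Graph n → Bool) λ A →
      (∀ G → T (A G) → Desired (fromℚ (tolerance D)) (fromℚ (tolerance D)) n G) × NearOne D (Pr (p n) A)

    -- Serves the n for which no positive accuracy is available yet.
    good-0 : ∀ n → Good 0 n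
    good-0 n = never , (λ _ ()) , Pr-nearOne {n} 0 (p n) never 0
      (λ i _ → subst (_≤ 1ℚ) (sym (ℚ.*-zeroˡ (1ℚ - Expectation.prob (seq (p n) i) (never {n})))) 0≤1)
      (λ i _ → subst (_≤ 1ℚ) (sym (Expectation.EG-const (seq (p n) i) {n} 0ℚ)) 0≤1)

    module Large (D n R i₀ L : ℕ) (1≤D : 1 ℕ.≤ D) (1≤n : 1 ℕ.≤ n) (recip : Reciprocal (p n) R i₀)
      (n<2^[1+L] : n ℕ.< 2 ℕ.^ suc L) (KRL≤n : Parameters.K q D 1≤q 1≤D ℕ.* (R ℕ.* suc L) ℕ.≤ n)
      (Kn≤RR : Parameters.K q D 1≤q 1≤D ℕ.* n ℕ.≤ R ℕ.* R) (K≤R : Parameters.K q D 1≤q 1≤D ℕ.≤ R) where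

      open Parameters q D 1≤q 1≤D
      open Choice n R L n<2^[1+L] KRL≤n Kn≤RR K≤R
      open Reciprocal recip
      open Event q n D j₁ j₂ j₃ j₄ using (typical; module Likely)

      1≤R : 1 ℕ.≤ R
      1≤R = ℕ.≤-trans (≤K 8F) K≤R

      p≤1 : ∀ i → i₀ ℕ.≤ i → seq (p n) i ≤ 1ℚ
      p≤1 i i≥ = ≤-shrink {ι R} (ι-mono 1≤R) 0≤1 (upper i i≥)

      typical-desired : ∀ G → T (typical G) → Desired (fromℚ (tolerance D)) (fromℚ (tolerance D)) n G
      typical-desired G G-typical = H , deleteTriangles-⊆ G , deleteTriangles-triangleFree G ,
        dist-≤ (fromℕ (δ H)) (p n Defs.* fromℕ n) (fromℚ κ Defs.* (p n Defs.* fromℕ n)) i₀ degree-close ,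
        dist-≤ (fromℕ (del q H)) (1/ℕ Q Defs.* (p n Defs.* fromℕ (n ℕ.^ 2))) (fromℚ κ Defs.* (p n Defs.* fromℕ (n ℕ.^ 2))) i₀ del-close
        where
        open Typical q n D j₁ j₂ j₃ j₄ 1≤n G G-typical
        H : Graph n
        H = deleteTriangles G
        κ : ℚ
        κ = tolerance D
        Q : ℕ
        Q = 2 ℕ.* q
        Dκ≡24 : ι D * κ ≡ ι 24
        Dκ≡24 = tolerance-inverse D 1≤D
        degree-close : ∀ i → i₀ ℕ.≤ i → ∣ ι (δ H) - seq (p n) i * ι n ∣ ≤ κ * (seq (p n) i * ι n)
        degree-close i i≥ = close⇒dist {D} {R} {1} {n} {δ H} {seq (p n) i} {seq (p n) i * ι n} {κ}
          1≤D 1≤R ℕ.≤-refl R+3≲R (close-degree (δ H) δ-lower δ-upper)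
          (0≤seq i i≥) (upper i i≥) (lower i i≥) (ℚ.*-identityˡ (seq (p n) i * ι n)) Dκ≡24
        del-close : ∀ i → i₀ ℕ.≤ i →
          ∣ ι (del q H) - seq (1/ℕ Q) i * (seq (p n) i * ι (n ℕ.^ 2)) ∣ ≤ κ * (seq (p n) i * ι (n ℕ.^ 2))
        del-close i i≥ = close⇒dist {D} {R} {Q} {n ℕ.^ 2} {del q H} {seq (p n) i} {seq (1/ℕ Q) i * (seq (p n) i * ι (n ℕ.^ 2))} {κ}
          1≤D 1≤R 1≤Q R+3≲R
          -- `n ^ 2` unfolds to n * (n * 1).
          (subst (λ N → Close D N (Q ℕ.* (R ℕ.* del q H))) (cong (n ℕ.*_) (sym (ℕ.*-identityʳ n)))
            (close-del (del q H) (del-lower 1≤q) (del-upper 1≤q)))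
          (0≤seq i i≥) (upper i i≥) (lower i i≥)
          (trans (sym (ℚ.*-assoc (ι Q) (seq (1/ℕ Q) i) (seq (p n) i * ι (n ℕ.^ 2))))
            (trans (cong (_* (seq (p n) i * ι (n ℕ.^ 2))) (1/ℕ-inverse Q 1≤Q i)) (ℚ.*-identityˡ (seq (p n) i * ι (n ℕ.^ 2)))))
          Dκ≡24
          where
          1≤Q : 1 ℕ.≤ Q
          1≤Q = ℕ.≤-trans 1≤q (ℕ.m≤n*m q 2)

      good : Good D n
      good = typical , typical-desired , Pr-nearOne {n} D (p n) typical i₀
        (λ i i≥ → Likely.typical-likely (seq (p n) i) (0≤seq i i≥) (p≤1 i i≥) {R} {R ℕ.+ 3} 1≤n 1≤q (upper i i≥) (lower i i≥)
          star-large star-small few-pairs (λ φ → class-large (size (sameColour φ)) (size-sameColour φ))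
          power₁ power₂ power₃ power₄)
        (λ i i≥ → Expectation.Monotone.prob≤1 (seq (p n) i) (0≤seq i i≥) (p≤1 i i≥) typical)

    eventually-scaled : ∀ K → 1 ℕ.≤ K → ∃ λ N → ∀ n → N ℕ.≤ n →
      1 ℕ.≤ n × ∃ λ R → ∃ λ i₀ → Reciprocal (p n) R i₀ × ScaledBy K n R
    eventually-scaled K 1≤K = 2 ℕ.⊔ (N₁ ℕ.⊔ N₂) , λ n n≥ →
      let 2≤n              = ℕ.m⊔n≤o⇒m≤o 2 (N₁ ℕ.⊔ N₂) n≥
          (R , i₀ , recip) = reciprocal (p n) (p-pos n)
      in ℕ.≤-trans (ℕ.s≤s ℕ.z≤n) 2≤n , R , i₀ , recip , sparse-dense-scale K n (p n) 1≤K 2≤n recip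
        (proj₂ dense n (ℕ.m⊔n≤o⇒m≤o N₁ N₂ (ℕ.m⊔n≤o⇒n≤o 2 (N₁ ℕ.⊔ N₂) n≥)))
        (proj₂ sparse n (ℕ.m⊔n≤o⇒n≤o N₁ N₂ (ℕ.m⊔n≤o⇒n≤o 2 (N₁ ℕ.⊔ N₂) n≥)))
      where
      v : ℚ
      v = 1/suc (16 ℕ.* (K ℕ.* K))
      0<v : 0ℝ Defs.< fromℚ v
      0<v = v , ℚ.positive⁻¹ v {{ℚ.normalize-pos 1 (suc (16 ℕ.* (K ℕ.* K)))}} , 0 , λ _ _ → ℚ.≤-reflexive (ℚ.+-identityˡ v)
      dense = p-dense (fromℕ (4 ℕ.* K))
      sparse = p-sparse (fromℚ v) 0<v
      N₁ N₂ : ℕ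
      N₁ = proj₁ dense
      N₂ = proj₁ sparse

    eventually-good : ∀ d → ∃ λ N → ∀ n → N ℕ.≤ n → Good (suc d) n
    eventually-good d = proj₁ scaled , λ n n≥ → good-at n (proj₂ scaled n n≥)
      where
      1≤D : 1 ℕ.≤ suc d
      1≤D = ℕ.s≤s ℕ.z≤n
      open Parameters q (suc d) 1≤q 1≤D using (K; ≤K)
      scaled = eventually-scaled K (≤K 8F)
      good-at : ∀ n → (1 ℕ.≤ n × ∃ λ R → ∃ λ i₀ → Reciprocal (p n) R i₀ × ScaledBy K n R) → Good (suc d) n
      good-at n (1≤n , R , i₀ , recip , L , n<2^[1+L] , KR[1+L]≤n , Kn≤RR , K≤R) =
        Large.good (suc d) n R i₀ L 1≤D 1≤n recip n<2^[1+L] KR[1+L]≤n Kn≤RR K≤R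

    threshold : ℕ → ℕ
    threshold d = proj₁ (eventually-good d)

    -- The search bound is n itself: it grows with n, so every accuracy is eventually within reach.
    accuracy : ℕ → ℕ
    accuracy n = pick threshold n n

    accuracy-unbounded : Unbounded accuracy
    accuracy-unbounded d = suc d ℕ.⊔ threshold d , λ n n≥ →
      pick-large threshold n n d (ℕ.m⊔n≤o⇒m≤o (suc d) (threshold d) n≥) (ℕ.m⊔n≤o⇒n≤o (suc d) (threshold d) n≥)

    good-everywhere : ∀ n → Good (accuracy n) n
    good-everywhere n = pick-satisfies {Good} threshold good-0 (λ d → proj₂ (eventually-good d)) n n

    conclusion : ∃ λ (η : ℕ → ℝ) → ∃ λ (θ : ℕ → ℝ) → TendsTo η 0ℝ × TendsTo θ 0ℝ × AAS p (λ n → Desired (η n) (θ n) n)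
    conclusion = η , η , tolerance-tendsTo-0 accuracy-unbounded , tolerance-tendsTo-0 accuracy-unbounded ,
      (λ n → proj₁ (good-everywhere n)) ,
      (λ n → proj₁ (proj₂ (good-everywhere n))) ,
      nearOne-tendsTo-1 (λ n → Pr (p n) (proj₁ (good-everywhere n))) accuracy-unbounded (λ n → proj₂ (proj₂ (good-everywhere n)))
      where
      η : ℕ → ℝ
      η n = fromℚ (tolerance (accuracy n))

open import Defs
open import Data.Nat.Base as ℕ using (ℕ)
open import Data.Product.Base using (∃; _×_; proj₁)

lemma5p3 : (q : ℕ) → 2 ℕ.≤ q →
    (p : ℕ → ℝ) → (∀ n → 0ℝ < p n × p n ≤ 1ℝ) →
    RatioTendsTo∞ (λ n → p n * fromℕ n) log →
    TendsTo (λ n → fromℕ n * (p n * p n)) 0ℝ →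
    ∃ λ (η : ℕ → ℝ) → ∃ λ (θ : ℕ → ℝ) →
    TendsTo η 0ℝ × TendsTo θ 0ℝ ×
    AAS p (λ n Γ → ∃ λ (H : Graph n) →
    H ⊆ Γ × TriangleFree H ×
    ∣ fromℕ (δ H) - p n * fromℕ n ∣ ≤ η n * (p n * fromℕ n) ×
    ∣ fromℕ (del q H) - 1/ℕ (2 ℕ.* q) * (p n * fromℕ (n ℕ.^ 2)) ∣ ≤ θ n * (p n * fromℕ (n ℕ.^ 2)))
lemma5p3 q 2≤q p p-range p-dense p-sparse =
  Conclusion.Main.conclusion q 2≤q p (λ n → proj₁ (p-range n)) p-dense p-sparse
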